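{- There is a $\phi$-approximation algorithm for the Drones Warehouse Problem, where $\phi=\frac{1+\sqrt5}{2}$ is the golden ratio; that is, the algorithm always outputs a valid schedule $f$ with $T(f)\le \phi\cdot T(f^*)$, where $f^*$ is an optimal valid schedule. The algorithm runs in $O((n+m)(\log^2 m+\log n))$ time, where $m$ and $n$ are the number of drones and parcels, respectively.
   Context: Drones Warehouse Problem (DWP): a warehouse has $m$ drones $D_1,\dots,D_m$ and $n$ parcels $P_1,\dots,P_n$. Parcel $P_i$ must be delivered at distance $\ell_i/2$ from the warehouse, so delivering it requires a round trip of total length $\ell_i>0$. Drone $D_j$ has speed $v_j>0$ and battery life $d_j$ (the maximum distance it can travel on one trip); a drone carries one parcel at a time, recharging at the warehouse takes negligible time, and drone $D_j$ can deliver parcel $P_i$ only if $\ell_i\le d_j$. A valid schedule is a map $f$ from drones to sets of parcels such that every parcel is assigned to exactly one drone and every parcel $P_i\in f(D_j)$ satisfies $\ell_i\le d_j$. Its delivery time is $T(f)=\max_{j\in[m]}\sum_{i:P_i\in f(D_j)}\ell_i/v_j$. It is assumed that at least one drone can deliver all parcels (so a valid schedule exists). The goal is to find a valid schedule minimizing $T(f)$. Arithmetic operations and comparisons on real numbers are assumed to take constant time. -}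

module Defs where

open import Algebra.Bundles using (CommutativeRing)
open import Algebra.Core using (Op₁; Op₂)
open import Data.Bool.Base as Bool using (Bool; true; false; if_then_else_)
open import Data.Fin.Base using (Fin; zero; suc; toℕ)
open import Data.Fin.Subset using (Subset; _∈_)
open import Data.Fin.Subset.Properties using (_∈?_)
open import Data.Nat.Base as ℕ using (ℕ; zero; suc)
import Data.Nat.Properties as ℕ
open import Data.Product.Base using (∃-syntax; _×_)
import Data.Vec.Functional as Vector
open import Function.Bundles using (_⇔_)
open import Level using (Level; _⊔_) renaming (suc to lsuc)
open import Relation.Binary.Bundles using (TotalOrder)
open import Relation.Binary.Core using (Rel)
open import Relation.Binary.PropositionalEquality.Core using (_≡_)
open import Relation.Binary.Structures using (IsDecTotalOrder)
open import Relation.Nullary.Decidable.Core using (does)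

-- The algebraic interface through which a real RAM accesses ℝ: field
-- operations together with decidable comparisons.  The inverse is total,
-- but nothing is assumed about the value of 0# ⁻¹.
record OrderedField c ℓ₁ ℓ₂ : Set (lsuc (c ⊔ ℓ₁ ⊔ ℓ₂)) where
  infix  9 _⁻¹
  infixl 7 _/_
  infix  4 _≤_
  field
    commutativeRing : CommutativeRing c ℓ₁

  open CommutativeRing commutativeRing public

  field
    _≤_             : Rel Carrier ℓ₂
    isDecTotalOrder : IsDecTotalOrder _≈_ _≤_
    +-monoˡ-≤       : ∀ z {x y} → x ≤ y → x + z ≤ y + z
    *-nonNegative   : ∀ {x y} → 0# ≤ x → 0# ≤ y → 0# ≤ x * y
    _⁻¹             : Op₁ Carrier
    ⁻¹-cong         : ∀ {x y} → x ≈ y → x ⁻¹ ≈ y ⁻¹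
    ⁻¹-inverseʳ     : ∀ {x} → x ≉ 0# → x * x ⁻¹ ≈ 1#
    1≉0             : 1# ≉ 0#

  open IsDecTotalOrder isDecTotalOrder public using (_≤?_; isTotalOrder)

  totalOrder : TotalOrder c ℓ₁ ℓ₂
  totalOrder = record { isTotalOrder = isTotalOrder }

  open import Relation.Binary.Construct.NonStrictToStrict _≈_ _≤_ public
    using (_<_)
  open import Algebra.Construct.NaturalChoice.Max totalOrder public
    using () renaming (_⊔_ to max)
  open import Algebra.Definitions.RawMonoid +-rawMonoid public
    using (sum) renaming (_×_ to _·_)

  _/_ : Op₂ Carrier
  x / y = x * y ⁻¹

  fromℕ : ℕ → Carrier
  fromℕ k = k · 1#

  IsSquareRootOf : Carrier → Carrier → Set (ℓ₁ ⊔ ℓ₂)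
  IsSquareRootOf r x = 0# ≤ r × r * r ≈ x

module DWP {c ℓ₁ ℓ₂} (F : OrderedField c ℓ₁ ℓ₂) where
  open OrderedField F

  record Instance (m n : ℕ) : Set (c ⊔ ℓ₁ ⊔ ℓ₂) where
    field
      length   : Fin n → Carrier
      speed    : Fin m → Carrier
      battery  : Fin m → Carrier
      length>0 : ∀ i → 0# < length i
      speed>0  : ∀ j → 0# < speed j
      capable  : ∃[ j ] (∀ i → length i ≤ battery j)

  Schedule : ℕ → ℕ → Set
  Schedule m n = Fin m → Subset n

  module _ {m n} (I : Instance m n) where
    open Instance I

    record Valid (f : Schedule m n) : Set ℓ₂ where
      field
        assigned : ∀ i → ∃[ j ] i ∈ f j
        unique   : ∀ {i j k} → i ∈ f j → i ∈ f k → j ≡ k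
        feasible : ∀ {i j} → i ∈ f j → length i ≤ battery j

    load : Schedule m n → Fin m → Carrier
    load f j = sum λ i → if does (i ∈? f j) then length i / speed j else 0#

    -- Loads are nonnegative and m > 0 (by `capable`), so starting the
    -- maximum at 0# does not change its value.
    deliveryTime : Schedule m n → Carrier
    deliveryTime f = Vector.foldr max 0# (load f)

    Optimal : Schedule m n → Set ℓ₂
    Optimal f = Valid f × (∀ g → Valid g → deliveryTime f ≤ deliveryTime g)

-- Memory consists of integer cells and real cells, each addressed by the
-- name of an array and an integer index.  A program mentions finitely many
-- array names, all of them literals.  Integer multiplication and
-- conversions from reals to integers are deliberately absent, as they would
-- make unit cost unrealistic.

ArrayName : Set
ArrayName = ℕ

infixl 7 _*ᴿ_ _/ᴿ_
infixl 6 _+ᴺ_ _∸ᴺ_ _+ᴿ_ _-ᴿ_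
infix  4 _≤ᴺ_ _≤ᴿ_
infixr 3 _andᴮ_
infixr 1 _⨾_

data IntExp : Set where
  litᴺ      : ℕ → IntExp
  readᴺ     : ArrayName → IntExp → IntExp
  _+ᴺ_ _∸ᴺ_ : IntExp → IntExp → IntExp
  halfᴺ     : IntExp → IntExp

data RealExp : Set where
  0ᴿ 1ᴿ                    : RealExp
  readᴿ                    : ArrayName → IntExp → RealExp
  _+ᴿ_ _-ᴿ_ _*ᴿ_ _/ᴿ_      : RealExp → RealExp → RealExp

data Test : Set where
  _≤ᴺ_  : IntExp → IntExp → Test
  _≤ᴿ_  : RealExp → RealExp → Test
  notᴮ  : Test → Test
  _andᴮ_ : Test → Test → Test

data Program : Set where
  skip   : Program
  writeᴺ : ArrayName → IntExp → IntExp → Program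
  writeᴿ : ArrayName → IntExp → RealExp → Program
  _⨾_    : Program → Program → Program
  branch : Test → Program → Program → Program
  while  : Test → Program → Program

-- Every literal, memory access, operation, comparison and statement takes
-- one time unit; executing a statement also pays for its expressions, and
-- sequencing is free.

costᴺ : IntExp → ℕ
costᴺ (litᴺ k)    = 1
costᴺ (readᴺ a e) = 1 ℕ.+ costᴺ e
costᴺ (e +ᴺ e′)   = 1 ℕ.+ costᴺ e ℕ.+ costᴺ e′
costᴺ (e ∸ᴺ e′)   = 1 ℕ.+ costᴺ e ℕ.+ costᴺ e′
costᴺ (halfᴺ e)   = 1 ℕ.+ costᴺ e

costᴿ : RealExp → ℕ
costᴿ 0ᴿ          = 1
costᴿ 1ᴿ          = 1
costᴿ (readᴿ a e) = 1 ℕ.+ costᴺ e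
costᴿ (e +ᴿ e′)   = 1 ℕ.+ costᴿ e ℕ.+ costᴿ e′
costᴿ (e -ᴿ e′)   = 1 ℕ.+ costᴿ e ℕ.+ costᴿ e′
costᴿ (e *ᴿ e′)   = 1 ℕ.+ costᴿ e ℕ.+ costᴿ e′
costᴿ (e /ᴿ e′)   = 1 ℕ.+ costᴿ e ℕ.+ costᴿ e′

costᴮ : Test → ℕ
costᴮ (e ≤ᴺ e′)   = 1 ℕ.+ costᴺ e ℕ.+ costᴺ e′
costᴮ (e ≤ᴿ e′)   = 1 ℕ.+ costᴿ e ℕ.+ costᴿ e′
costᴮ (notᴮ b)    = 1 ℕ.+ costᴮ b
costᴮ (b andᴮ b′) = 1 ℕ.+ costᴮ b ℕ.+ costᴮ b′

Memory : ∀ {a} → Set a → Set a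
Memory A = ArrayName → ℕ → A

_[_,_≔_] : ∀ {a} {A : Set a} → Memory A → ArrayName → ℕ → A → Memory A
(μ [ a , k ≔ x ]) b l =
  if does (a ℕ.≟ b) Bool.∧ does (k ℕ.≟ l) then x else μ b l

module RealRAM {c ℓ₁ ℓ₂} (F : OrderedField c ℓ₁ ℓ₂) where
  open OrderedField F

  record State : Set c where
    constructor state
    field
      ints  : Memory ℕ
      reals : Memory Carrier

  open State public

  ⟦_⟧ᴺ : IntExp → State → ℕ
  ⟦ litᴺ k    ⟧ᴺ s = k
  ⟦ readᴺ a e ⟧ᴺ s = ints s a (⟦ e ⟧ᴺ s)
  ⟦ e +ᴺ e′   ⟧ᴺ s = ⟦ e ⟧ᴺ s ℕ.+ ⟦ e′ ⟧ᴺ s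
  ⟦ e ∸ᴺ e′   ⟧ᴺ s = ⟦ e ⟧ᴺ s ℕ.∸ ⟦ e′ ⟧ᴺ s
  ⟦ halfᴺ e   ⟧ᴺ s = ℕ.⌊ ⟦ e ⟧ᴺ s /2⌋

  ⟦_⟧ᴿ : RealExp → State → Carrier
  ⟦ 0ᴿ        ⟧ᴿ s = 0#
  ⟦ 1ᴿ        ⟧ᴿ s = 1#
  ⟦ readᴿ a e ⟧ᴿ s = reals s a (⟦ e ⟧ᴺ s)
  ⟦ e +ᴿ e′   ⟧ᴿ s = ⟦ e ⟧ᴿ s + ⟦ e′ ⟧ᴿ s
  ⟦ e -ᴿ e′   ⟧ᴿ s = ⟦ e ⟧ᴿ s - ⟦ e′ ⟧ᴿ s
  ⟦ e *ᴿ e′   ⟧ᴿ s = ⟦ e ⟧ᴿ s * ⟦ e′ ⟧ᴿ s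
  ⟦ e /ᴿ e′   ⟧ᴿ s = ⟦ e ⟧ᴿ s / ⟦ e′ ⟧ᴿ s

  ⟦_⟧ᴮ : Test → State → Bool
  ⟦ e ≤ᴺ e′   ⟧ᴮ s = does (⟦ e ⟧ᴺ s ℕ.≤? ⟦ e′ ⟧ᴺ s)
  ⟦ e ≤ᴿ e′   ⟧ᴮ s = does (⟦ e ⟧ᴿ s ≤? ⟦ e′ ⟧ᴿ s)
  ⟦ notᴮ b    ⟧ᴮ s = Bool.not (⟦ b ⟧ᴮ s)
  ⟦ b andᴮ b′ ⟧ᴮ s = ⟦ b ⟧ᴮ s Bool.∧ ⟦ b′ ⟧ᴮ s

  -- ⟨ p , s ⟩⇓⟨ s′ , t ⟩: started in s, program p halts in s′ after t
  -- time units.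
  data ⟨_,_⟩⇓⟨_,_⟩ : Program → State → State → ℕ → Set c where
    ⇓-skip : ∀ {s} → ⟨ skip , s ⟩⇓⟨ s , 1 ⟩

    ⇓-writeᴺ : ∀ {a e e′ s} →
      ⟨ writeᴺ a e e′ , s ⟩⇓⟨
        state (ints s [ a , ⟦ e ⟧ᴺ s ≔ ⟦ e′ ⟧ᴺ s ]) (reals s) ,
        1 ℕ.+ costᴺ e ℕ.+ costᴺ e′ ⟩

    ⇓-writeᴿ : ∀ {a e e′ s} →
      ⟨ writeᴿ a e e′ , s ⟩⇓⟨
        state (ints s) (reals s [ a , ⟦ e ⟧ᴺ s ≔ ⟦ e′ ⟧ᴿ s ]) ,
        1 ℕ.+ costᴺ e ℕ.+ costᴿ e′ ⟩

    ⇓-seq : ∀ {p q s s′ s″ t t′} →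
      ⟨ p , s ⟩⇓⟨ s′ , t ⟩ → ⟨ q , s′ ⟩⇓⟨ s″ , t′ ⟩ →
      ⟨ p ⨾ q , s ⟩⇓⟨ s″ , t ℕ.+ t′ ⟩

    ⇓-branch-true : ∀ {b p q s s′ t} →
      ⟦ b ⟧ᴮ s ≡ true → ⟨ p , s ⟩⇓⟨ s′ , t ⟩ →
      ⟨ branch b p q , s ⟩⇓⟨ s′ , 1 ℕ.+ costᴮ b ℕ.+ t ⟩

    ⇓-branch-false : ∀ {b p q s s′ t} →
      ⟦ b ⟧ᴮ s ≡ false → ⟨ q , s ⟩⇓⟨ s′ , t ⟩ →
      ⟨ branch b p q , s ⟩⇓⟨ s′ , 1 ℕ.+ costᴮ b ℕ.+ t ⟩

    ⇓-while-true : ∀ {b p s s′ s″ t t′} →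
      ⟦ b ⟧ᴮ s ≡ true →
      ⟨ p , s ⟩⇓⟨ s′ , t ⟩ → ⟨ while b p , s′ ⟩⇓⟨ s″ , t′ ⟩ →
      ⟨ while b p , s ⟩⇓⟨ s″ , 1 ℕ.+ costᴮ b ℕ.+ t ℕ.+ t′ ⟩

    ⇓-while-false : ∀ {b p s} →
      ⟦ b ⟧ᴮ s ≡ false →
      ⟨ while b p , s ⟩⇓⟨ s , 1 ℕ.+ costᴮ b ⟩

padded : ∀ {a} {A : Set a} {k} → A → (Fin k → A) → ℕ → A
padded {k = zero}  z xs l       = z
padded {k = suc k} z xs zero    = xs zero
padded {k = suc k} z xs (suc l) = padded z (λ i → xs (suc i)) l

module _ {c ℓ₁ ℓ₂} (F : OrderedField c ℓ₁ ℓ₂) where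
  open OrderedField F
  open DWP F
  open RealRAM F

  -- Integer cells (0,0) and (1,0) hold m and n; real arrays 0, 1 and 2 hold
  -- the lengths, speeds and battery lives.  All other cells are zero.
  input : ∀ {m n} → Instance m n → State
  input {m} {n} I = state int real
    where
    open Instance I

    int : Memory ℕ
    int 0 0 = m
    int 1 0 = n
    int _ _ = 0

    real : Memory Carrier
    real 0 = padded 0# length
    real 1 = padded 0# speed
    real 2 = padded 0# battery
    real _ = λ _ → 0#

  -- Integer array 2 lists, for each parcel, the drone delivering it.
  Outputs : ∀ {m n} → State → Schedule m n → Set
  Outputs s f = ∀ i j → i ∈ f j ⇔ ints s 2 (toℕ i) ≡ toℕ j

{-# OPTIONS --safe #-}
module Submission where

-- First fit: take the parcels in decreasing order of length and give each to the
-- slowest drone p that can carry it and whose load stays within κ * v p.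
--   * If this gets stuck, then every valid schedule needs time at least 2/3 κ.
--   * If it succeeds, its delivery time is at most κ.
-- So it suffices to raise κ by factors 17/16, from some value below the optimum,
-- until first fit succeeds, because 3/2 · 17/16 ≤ 8/5 ≤ φ.  Let S be the sum over
-- all parcels of the time that the fastest suitable drone needs for the parcel.
-- Then S is at most m times the optimum, and first fit succeeds for κ ≥ S, so
-- O(log m) attempts lead from a starting value in [S / 2m, S / m) to a success.
-- Each attempt takes O((n + m) log m) by means of a binary tree of maxima over the
-- drones, slowest first, with min (κ * v p - load p) (battery p) at leaf p:
-- the first leaf that is at least the length of the parcel is the drone sought.
-- The same tree serves for sorting, by repeatedly extracting the maximum.

-- The values of `κ` are tried from below because failure is the informative outcome: being stuck at
-- `κ` forces 2κ ≤ 3T for every valid schedule of time T, so the next value is at most 51/32 T. As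
-- 51/32 lies below 8/5, the program gets by with rational constants, and √5 enters only the final
-- comparison of 8/5 with φ. The lower bounds are kept in the form 5κ ≤ 8T for all valid schedules,
-- which needs neither division nor an optimal schedule. The two bounds on S have simple causes. No
-- drone delivers a parcel sooner than the fastest suitable one, and m drones work for at most T
-- each, so S ≤ mT. Conversely, the fastest suitable drone of a longer parcel can carry a shorter
-- one too, so it is no faster than that of the shorter one; the latter could take all longer
-- parcels as well within time S. Sixteen increases by 1/16 at least double `κ`, so undoing each of
-- the O(log m) halvings of S takes a constant number of attempts. The combinatorial part speaks of
-- sorted positions in ℕ; the permutations computed by sorting tie them to the instance.

open import Defs
open import Data.Bool.Base using (Bool; true; false; not; if_then_else_; _∨_; _∧_)
open import Data.Empty using (⊥; ⊥-elim)
open import Data.Fin.Base using (Fin; zero; suc; toℕ; fromℕ<)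
open import Data.Fin.Properties using (toℕ<n; toℕ-fromℕ<; toℕ-injective; pigeonhole; fromℕ<-injective)
open import Data.Fin.Subset using (_∈_)
open import Data.Fin.Subset.Properties using (_∈?_)
open import Data.List.Base using (List; []; _∷_)
open import Data.Nat.Base as ℕ using (ℕ; zero; suc)
open import Data.Nat.Induction using (<-rec)
open import Data.Nat.Logarithm using (⌊log₂_⌋; ⌊log₂⌋-mono-≤; ⌊log₂⌊n/2⌋⌋≡⌊log₂n⌋∸1)
import Data.Nat.Properties as ℕ
open import Data.Nat.Solver using (module +-*-Solver)
open import Data.Product.Base using (∃-syntax; _×_; _,_; proj₁; proj₂)
open import Data.Sum.Base using (_⊎_; inj₁; inj₂; [_,_]′)
import Data.Vec.Base as Vec
import Data.Vec.Functional as Vector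
open import Data.Vec.Properties using (lookup∘tabulate; lookup⇒[]=; []=⇒lookup)
open import Function.Base using (_∘_)
open import Function.Bundles using (_⇔_; mk⇔; Equivalence)
open import Level using (_⊔_)
open import Relation.Binary.Bundles using (TotalOrder)
open import Relation.Binary.PropositionalEquality as ≡ using (_≡_; _≢_)
open import Relation.Binary.Structures using (IsDecTotalOrder)
open import Relation.Nullary using (¬_; Dec; yes; no; does; contradiction)
open import Relation.Nullary.Decidable using (dec-true; dec-false; does-⇔)

-- Arithmetic of ordered fields

module OrderedFieldProperties {c ℓ₁ ℓ₂} (F : OrderedField c ℓ₁ ℓ₂) where
  open OrderedField F hiding (zero)
  open IsDecTotalOrder isDecTotalOrder public
    using (total; ≤-respˡ-≈; ≤-respʳ-≈)
    renaming (refl to ≤-refl; trans to ≤-trans; reflexive to ≤-reflexive; antisym to ≤-antisym)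
  open import Relation.Binary.Reasoning.PartialOrder (TotalOrder.poset totalOrder) public
  open import Algebra.Solver.Ring.NaturalCoefficients.Default commutativeSemiring public
    using (solve; _:+_; _:*_; _:=_; con)
  open import Algebra.Properties.Ring ring using (-‿distribˡ-*; -‿distribʳ-*; -‿involutive)

  ≡⇒≤ : ∀ {x y} → x ≡ y → x ≤ y
  ≡⇒≤ eq = ≤-reflexive (reflexive eq)

  ≰⇒≥ : ∀ {x y} → ¬ x ≤ y → y ≤ x
  ≰⇒≥ {x} {y} x≰y with total x y
  ... | inj₁ x≤y = contradiction x≤y x≰y
  ... | inj₂ y≤x = y≤x

  +-monoʳ-≤ : ∀ z {x y} → x ≤ y → z + x ≤ z + y
  +-monoʳ-≤ z {x} {y} x≤y = begin
    z + x  ≈⟨ +-comm z x ⟩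
    x + z  ≤⟨ +-monoˡ-≤ z x≤y ⟩
    y + z  ≈⟨ +-comm y z ⟩
    z + y  ∎

  +-mono-≤ : ∀ {x y u v} → x ≤ y → u ≤ v → x + u ≤ y + v
  +-mono-≤ {x} {y} {u} {v} x≤y u≤v = ≤-trans (+-monoˡ-≤ u x≤y) (+-monoʳ-≤ y u≤v)

  x+z-z : ∀ x z → (x + z) + - z ≈ x
  x+z-z x z = trans (+-assoc x z (- z)) (trans (+-congˡ (-‿inverseʳ z)) (+-identityʳ x))

  x-z+z : ∀ x z → (x + - z) + z ≈ x
  x-z+z x z = trans (+-assoc x (- z) z) (trans (+-congˡ (-‿inverseˡ z)) (+-identityʳ x))

  +-cancelʳ-≤ : ∀ z {x y} → x + z ≤ y + z → x ≤ y
  +-cancelʳ-≤ z {x} {y} le = begin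
    x  ≈⟨ x+z-z x z ⟨
    x + z + - z    ≤⟨ +-monoˡ-≤ (- z) le ⟩
    y + z + - z    ≈⟨ x+z-z y z ⟩
    y  ∎

  +-cancelˡ-≤ : ∀ z {x y} → z + x ≤ z + y → x ≤ y
  +-cancelˡ-≤ z {x} {y} le =
    +-cancelʳ-≤ z (≤-respˡ-≈ (+-comm z x) (≤-respʳ-≈ (+-comm z y) le))

  x+z≤y⇒x≤y-z : ∀ {x y z} → x + z ≤ y → x ≤ y - z
  x+z≤y⇒x≤y-z {x} {y} {z} le = ≤-respˡ-≈ (x+z-z x z) (+-monoˡ-≤ (- z) le)

  x≤x+y : ∀ x {y} → 0# ≤ y → x ≤ x + y
  x≤x+y x le = ≤-respˡ-≈ (+-identityʳ x) (+-monoʳ-≤ x le)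

  x≤y+x : ∀ x {y} → 0# ≤ y → x ≤ y + x
  x≤y+x x {y} le = ≤-respʳ-≈ (+-comm x y) (x≤x+y x le)

  +-nonNegative : ∀ {x y} → 0# ≤ x → 0# ≤ y → 0# ≤ x + y
  +-nonNegative {x} 0≤x 0≤y = ≤-trans 0≤x (x≤x+y x 0≤y)

  *-monoʳ-≤ : ∀ {z} → 0# ≤ z → ∀ {x y} → x ≤ y → x * z ≤ y * z
  *-monoʳ-≤ {z} 0≤z {x} {y} x≤y = begin
    x * z  ≤⟨ x≤y+x (x * z) (*-nonNegative 0≤y-x 0≤z) ⟩
    (y + - x) * z + x * z    ≈⟨ distribʳ z (y + - x) x ⟨
    ((y + - x) + x) * z  ≈⟨ *-congʳ (x-z+z y x) ⟩
    y * z  ∎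
    where
    0≤y-x : 0# ≤ y + - x
    0≤y-x = x+z≤y⇒x≤y-z (≤-respˡ-≈ (sym (+-identityˡ x)) x≤y)

  *-monoˡ-≤ : ∀ {z} → 0# ≤ z → ∀ {x y} → x ≤ y → z * x ≤ z * y
  *-monoˡ-≤ {z} 0≤z {x} {y} x≤y =
    ≤-respˡ-≈ (*-comm x z) (≤-respʳ-≈ (*-comm y z) (*-monoʳ-≤ 0≤z x≤y))

  -- The negated form passes along `≤` by contraposition and gives nonnegativity by totality, with
  -- no detour through `≈`.
  Positive : Carrier → Set ℓ₂
  Positive x = ¬ x ≤ 0#

  <⇒positive : ∀ {x} → 0# < x → Positive x
  <⇒positive (0≤x , 0≉x) x≤0 = 0≉x (≤-antisym 0≤x x≤0)

  positive⇒≥0 : ∀ {x} → Positive x → 0# ≤ x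
  positive⇒≥0 = ≰⇒≥

  positive-≤ : ∀ {x y} → Positive x → x ≤ y → Positive y
  positive-≤ x>0 x≤y y≤0 = x>0 (≤-trans x≤y y≤0)

  0≤x² : ∀ x → 0# ≤ x * x
  0≤x² x with total 0# x
  ... | inj₁ 0≤x = *-nonNegative 0≤x 0≤x
  ... | inj₂ x≤0 = ≤-respʳ-≈ sq (*-nonNegative 0≤-x 0≤-x)
    where
    0≤-x : 0# ≤ - x
    0≤-x = ≤-respʳ-≈ (+-identityˡ (- x)) (x+z≤y⇒x≤y-z (≤-respˡ-≈ (sym (+-identityˡ x)) x≤0))
    sq : - x * - x ≈ x * x
    sq = trans (sym (-‿distribˡ-* x (- x)))
           (trans (-‿cong (sym (-‿distribʳ-* x x))) (-‿involutive (x * x)))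

  0≤1 : 0# ≤ 1#
  0≤1 = ≤-respʳ-≈ (*-identityʳ 1#) (0≤x² 1#)

  1>0 : Positive 1#
  1>0 1≤0 = 1≉0 (≤-antisym 1≤0 0≤1)

  x+x≤y+y⇒x≤y : ∀ {x y} → x + x ≤ y + y → x ≤ y
  x+x≤y+y⇒x≤y {x} {y} le with x ≤? y
  ... | yes x≤y = x≤y
  ... | no x≰y = +-cancelʳ-≤ x (≤-trans le (+-monoʳ-≤ y (≰⇒≥ x≰y)))

  module _ {v} (v>0 : Positive v) where
    v*v⁻¹ : v * v ⁻¹ ≈ 1#
    v*v⁻¹ = ⁻¹-inverseʳ λ v≈0 → v>0 (≤-reflexive v≈0)

    x/v*v : ∀ x → x / v * v ≈ x
    x/v*v x = trans (*-assoc x (v ⁻¹) v)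
      (trans (*-congˡ (trans (*-comm (v ⁻¹) v) v*v⁻¹)) (*-identityʳ x))

    x*v/v : ∀ x → x * v / v ≈ x
    x*v/v x = trans (*-assoc x v (v ⁻¹)) (trans (*-congˡ v*v⁻¹) (*-identityʳ x))

    -- The inverse is `v` times its own square, a product of nonnegative factors.
    0≤v⁻¹ : 0# ≤ v ⁻¹
    0≤v⁻¹ = ≤-respʳ-≈ eq (*-nonNegative (positive⇒≥0 v>0) (0≤x² (v ⁻¹)))
      where
      eq : v * (v ⁻¹ * v ⁻¹) ≈ v ⁻¹
      eq = trans (sym (*-assoc v (v ⁻¹) (v ⁻¹))) (trans (*-congʳ v*v⁻¹) (*-identityˡ (v ⁻¹)))

    /-monoˡ-≤ : ∀ {x y} → x ≤ y → x / v ≤ y / v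
    /-monoˡ-≤ = *-monoʳ-≤ 0≤v⁻¹

    *-cancelʳ-≤ : ∀ {x y} → x * v ≤ y * v → x ≤ y
    *-cancelʳ-≤ {x} {y} le = ≤-respˡ-≈ (x*v/v x) (≤-respʳ-≈ (x*v/v y) (/-monoˡ-≤ le))

    x≤y*v⇒x/v≤y : ∀ {x y} → x ≤ y * v → x / v ≤ y
    x≤y*v⇒x/v≤y {x} {y} le = ≤-respʳ-≈ (x*v/v y) (/-monoˡ-≤ le)

  /-antimonoʳ-≤ : ∀ {x u v} → 0# ≤ x → Positive u → u ≤ v → x / v ≤ x / u
  /-antimonoʳ-≤ {x} {u} {v} 0≤x u>0 u≤v = x≤y*v⇒x/v≤y v>0 (begin
    x  ≈⟨ x/v*v u>0 x ⟨
    x / u * u    ≤⟨ *-monoˡ-≤ (*-nonNegative 0≤x (0≤v⁻¹ u>0)) u≤v ⟩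
    x / u * v    ∎)
    where v>0 = positive-≤ u>0 u≤v

  1+1 : Carrier
  1+1 = 1# + 1#

  1+1>0 : Positive 1+1
  1+1>0 = positive-≤ 1>0 (x≤x+y 1# 0≤1)

  half+half : ∀ x → x / 1+1 + x / 1+1 ≈ x
  half+half x = trans (trans (+-cong (sym (*-identityʳ _)) (sym (*-identityʳ _)))
    (sym (distribˡ (x / 1+1) 1# 1#))) (x/v*v 1+1>0 x)

  0≤half : ∀ {x} → 0# ≤ x → 0# ≤ x / 1+1
  0≤half 0≤x = *-nonNegative 0≤x (0≤v⁻¹ 1+1>0)

-- Finite sums and loads of assignments

module Sums {c ℓ₁ ℓ₂} (F : OrderedField c ℓ₁ ℓ₂) where
  open OrderedField F hiding (zero; sum)
  open OrderedFieldProperties F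

  only : Bool → Carrier → Carrier
  only b x = if b then x else 0#

  only-≤ : ∀ b {x y} → (b ≡ true → x ≤ y) → only b x ≤ only b y
  only-≤ true  le = le ≡.refl
  only-≤ false le = ≤-refl

  only-cong : ∀ b {x y} → (b ≡ true → x ≈ y) → only b x ≈ only b y
  only-cong true  eq = eq ≡.refl
  only-cong false eq = refl

  only-≥0 : ∀ b {x} → (b ≡ true → 0# ≤ x) → 0# ≤ only b x
  only-≥0 true  le = le ≡.refl
  only-≥0 false le = ≤-refl

  only-+ : ∀ b {x y} → only b (x + y) ≈ only b x + only b y
  only-+ true  = refl
  only-+ false = sym (+-identityˡ 0#)

  only-* : ∀ b {x y} → only b (x * y) ≈ x * only b y
  only-* true      = refl
  only-* false {x} = sym (zeroʳ x)

  only-not : ∀ b {x} → only b x + only (not b) x ≈ x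
  only-not true  = +-identityʳ _
  only-not false = +-identityˡ _

  eqᵇ-refl : ∀ p → does (p ℕ.≟ p) ≡ true
  eqᵇ-refl p = dec-true (p ℕ.≟ p) ≡.refl

  eqᵇ-≢ : ∀ {p q} → p ≢ q → does (p ℕ.≟ q) ≡ false
  eqᵇ-≢ {p} {q} = dec-false (p ℕ.≟ q)

  only-refl : ∀ p {x} → only (does (p ℕ.≟ p)) x ≈ x
  only-refl p {x} = reflexive (≡.cong (λ e → only e x) (eqᵇ-refl p))

  only-≢ : ∀ {p q x} → p ≢ q → only (does (p ℕ.≟ q)) x ≈ 0#
  only-≢ {x = x} p≢q = reflexive (≡.cong (λ e → only e x) (eqᵇ-≢ p≢q))

  Σ< : ℕ → (ℕ → Carrier) → Carrier
  Σ< zero    f = 0#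
  Σ< (suc k) f = Σ< k f + f k

  Σ-mono : ∀ k {f g} → (∀ i → i ℕ.< k → f i ≤ g i) → Σ< k f ≤ Σ< k g
  Σ-mono zero    le = ≤-refl
  Σ-mono (suc k) le = +-mono-≤ (Σ-mono k λ i i<k → le i (ℕ.m<n⇒m<1+n i<k)) (le k ℕ.≤-refl)

  Σ-cong : ∀ k {f g} → (∀ i → i ℕ.< k → f i ≈ g i) → Σ< k f ≈ Σ< k g
  Σ-cong zero    eq = refl
  Σ-cong (suc k) eq = +-cong (Σ-cong k λ i i<k → eq i (ℕ.m<n⇒m<1+n i<k)) (eq k ℕ.≤-refl)

  Σ-0 : ∀ k → Σ< k (λ _ → 0#) ≈ 0#
  Σ-0 zero    = refl
  Σ-0 (suc k) = trans (+-identityʳ _) (Σ-0 k)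

  Σ-≥0 : ∀ k {f} → (∀ i → i ℕ.< k → 0# ≤ f i) → 0# ≤ Σ< k f
  Σ-≥0 k le = ≤-respˡ-≈ (Σ-0 k) (Σ-mono k le)

  Σ-≈0 : ∀ k {f} → (∀ i → i ℕ.< k → f i ≈ 0#) → Σ< k f ≈ 0#
  Σ-≈0 k eq = trans (Σ-cong k eq) (Σ-0 k)

  Σ-+ : ∀ k f g → Σ< k (λ i → f i + g i) ≈ Σ< k f + Σ< k g
  Σ-+ zero    f g = sym (+-identityˡ 0#)
  Σ-+ (suc k) f g = trans (+-congʳ (Σ-+ k f g))
    (solve 4 (λ a b x y → (a :+ b) :+ (x :+ y) := (a :+ x) :+ (b :+ y)) refl
      (Σ< k f) (Σ< k g) (f k) (g k))

  Σ-*ʳ : ∀ k f x → Σ< k (λ i → f i * x) ≈ Σ< k f * x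
  Σ-*ʳ zero    f x = sym (zeroˡ x)
  Σ-*ʳ (suc k) f x = trans (+-congʳ (Σ-*ʳ k f x)) (sym (distribʳ x (Σ< k f) (f k)))

  Σ-monoˡ : ∀ {j k} {f} → j ℕ.≤ k → (∀ i → i ℕ.< k → 0# ≤ f i) → Σ< j f ≤ Σ< k f
  Σ-monoˡ {j} {k} j≤k f≥0 with ℕ.m≤n⇒m<n∨m≡n j≤k
  ... | inj₂ ≡.refl = ≤-refl
  Σ-monoˡ {j} {suc k} _ f≥0 | inj₁ (ℕ.s≤s j≤k) =
    ≤-trans (Σ-monoˡ j≤k λ i i<k → f≥0 i (ℕ.m<n⇒m<1+n i<k)) (x≤x+y _ (f≥0 k ℕ.≤-refl))

  term≤Σ : ∀ k {f i} → (∀ j → j ℕ.< k → 0# ≤ f j) → i ℕ.< k → f i ≤ Σ< k f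
  term≤Σ k {f} {i} f≥0 i<k =
    ≤-trans (x≤y+x (f i) (Σ-≥0 i λ j j<i → f≥0 j (ℕ.<-trans j<i i<k))) (Σ-monoˡ i<k f≥0)

  Σ-head : ∀ k f → Σ< (suc k) f ≈ f 0 + Σ< k (λ i → f (suc i))
  Σ-head zero    f = +-comm 0# (f 0)
  Σ-head (suc k) f = trans (+-congʳ (Σ-head k f)) (+-assoc _ _ _)

  Σ-single : ∀ {k i} (f : ℕ → Carrier) → i ℕ.< k → Σ< k (λ j → only (does (i ℕ.≟ j)) (f j)) ≈ f i
  Σ-single {suc k} {i} f i<1+k with i ℕ.≟ k
  ... | yes ≡.refl = trans
    (+-cong
      (Σ-≈0 k λ j j<k → reflexive (≡.cong (λ b → only b (f j)) (eqᵇ-≢ (ℕ.>⇒≢ j<k))))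
      (reflexive (≡.cong (λ b → only b (f k)) (eqᵇ-refl k))))
    (+-identityˡ (f k))
  ... | no i≢k = trans
    (+-cong (Σ-single f (ℕ.≤∧≢⇒< (ℕ.s≤s⁻¹ i<1+k) i≢k))
      (reflexive (≡.cong (λ b → only b (f k)) (eqᵇ-≢ i≢k))))
    (+-identityʳ (f i))

  -- By induction on k, with the term of π k removed from f.
  Σ-injection : ∀ k n (π : ℕ → ℕ) f → (∀ i → i ℕ.< k → π i ℕ.< n) →
    (∀ i j → i ℕ.< k → j ℕ.< k → π i ≡ π j → i ≡ j) →
    (∀ j → j ℕ.< n → 0# ≤ f j) → Σ< k (λ i → f (π i)) ≤ Σ< n f
  Σ-injection zero    n π f π<n inj f≥0 = Σ-≥0 n f≥0
  Σ-injection (suc k) n π f π<n inj f≥0 = begin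
    Σ< k (λ i → f (π i)) + f (π k)  ≈⟨ +-congʳ (Σ-cong k same) ⟩
    Σ< k (λ i → f′ (π i)) + f (π k)  ≤⟨ +-monoˡ-≤ (f (π k)) IH ⟩
    Σ< n f′ + f (π k)  ≈⟨ +-congˡ (Σ-single f (π<n k ℕ.≤-refl)) ⟨
    Σ< n f′ + Σ< n (λ j → only (does (π k ℕ.≟ j)) (f j))  ≈⟨ Σ-+ n _ _ ⟨
    Σ< n (λ j → f′ j + only (does (π k ℕ.≟ j)) (f j))
      ≈⟨ Σ-cong n (λ j _ → trans (+-comm _ _) (only-not (does (π k ℕ.≟ j)))) ⟩
    Σ< n f ∎
    where
    f′ : ℕ → Carrier
    f′ j = only (not (does (π k ℕ.≟ j))) (f j)
    same : ∀ i → i ℕ.< k → f (π i) ≈ f′ (π i)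
    same i i<k = reflexive (≡.sym (≡.cong (λ b → only (not b) (f (π i)))
      (eqᵇ-≢ λ eq → ℕ.<⇒≢ i<k (≡.sym (inj k i ℕ.≤-refl (ℕ.m<n⇒m<1+n i<k) eq)))))
    IH : Σ< k (λ i → f′ (π i)) ≤ Σ< n f′
    IH = Σ-injection k n π f′ (λ i i<k → π<n i (ℕ.m<n⇒m<1+n i<k))
      (λ i j i<k j<k → inj i j (ℕ.m<n⇒m<1+n i<k) (ℕ.m<n⇒m<1+n j<k))
      (λ j j<n → only-≥0 (not (does (π k ℕ.≟ j))) λ _ → f≥0 j j<n)

  -- With `b` read as an assignment of items to places, this is the load of place `p` from the first
  -- `t` items. With `u` constantly 1 it counts them.
  weight : (ℕ → Carrier) → (ℕ → ℕ) → ℕ → ℕ → Carrier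
  weight u b t p = Σ< t (λ s → only (does (b s ℕ.≟ p)) (u s))

  weightIn : (ℕ → Carrier) → (ℕ → ℕ) → (ℕ → Bool) → ℕ → Carrier
  weightIn u b S t = Σ< t (λ s → only (S (b s)) (u s))

  weightIn-hit : ∀ u b S t → S (b t) ≡ true → weightIn u b S (suc t) ≈ weightIn u b S t + u t
  weightIn-hit u b S t hit = +-congˡ (reflexive (≡.cong (λ e → only e (u t)) hit))

  weightIn-miss : ∀ u b S t → S (b t) ≡ false → weightIn u b S (suc t) ≈ weightIn u b S t
  weightIn-miss u b S t miss =
    trans (+-congˡ (reflexive (≡.cong (λ e → only e (u t)) miss))) (+-identityʳ _)

  weightIn-not : ∀ u b S t → weightIn u b S t + weightIn u b (λ p → not (S p)) t ≈ Σ< t u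
  weightIn-not u b S t = trans (sym (Σ-+ t _ _)) (Σ-cong t λ s _ → only-not (S (b s)))

  -- Double counting: every item lies in exactly one place below `m`, so the loads of the places in
  -- `S` together count each item placed in `S` once.
  Σ-weight : ∀ m u b S t → (∀ s → s ℕ.< t → b s ℕ.< m) →
    Σ< m (λ p → only (S p) (weight u b t p)) ≈ weightIn u b S t
  Σ-weight m u b S zero    b<m = Σ-≈0 m λ p _ → only-0 (S p)
    where
    only-0 : ∀ e → only e 0# ≈ 0#
    only-0 true  = refl
    only-0 false = refl
  Σ-weight m u b S (suc t) b<m = begin-equality
    Σ< m (λ p → only (S p) (weight u b t p + hit p))
      ≈⟨ Σ-cong m (λ p _ → only-+ (S p)) ⟩
    Σ< m (λ p → only (S p) (weight u b t p) + only (S p) (hit p))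
      ≈⟨ Σ-+ m _ _ ⟩
    Σ< m (λ p → only (S p) (weight u b t p)) + Σ< m (λ p → only (S p) (hit p))
      ≈⟨ +-cong (Σ-weight m u b S t λ s s<t → b<m s (ℕ.m<n⇒m<1+n s<t))
                (trans (Σ-cong m λ p _ → only-only (S p) (does (b t ℕ.≟ p)))
                       (Σ-single (λ p → only (S p) (u t)) (b<m t ℕ.≤-refl))) ⟩
    weightIn u b S t + only (S (b t)) (u t) ∎
    where
    hit : ℕ → Carrier
    hit p = only (does (b t ℕ.≟ p)) (u t)
    only-only : ∀ d e {x} → only d (only e x) ≈ only e (only d x)
    only-only true  e     = refl
    only-only false true  = refl
    only-only false false = refl

  weight-occurs : ∀ u b t p → (∃[ s ] s ℕ.< t × b s ≡ p) ⊎ weight u b t p ≈ 0#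
  weight-occurs u b zero    p = inj₂ refl
  weight-occurs u b (suc t) p with b t ℕ.≟ p | weight-occurs u b t p
  ... | yes eq | _ = inj₁ (t , ℕ.≤-refl , eq)
  ... | no _   | inj₁ (s , s<t , eq) = inj₁ (s , ℕ.m<n⇒m<1+n s<t , eq)
  ... | no neq | inj₂ w≈0 = inj₂ (trans
    (+-cong w≈0 (only-≢ neq)) (+-identityˡ 0#))

  weight-≥0 : ∀ u b t p → (∀ s → s ℕ.< t → 0# ≤ u s) → 0# ≤ weight u b t p
  weight-≥0 u b t p u≥0 = Σ-≥0 t λ s s<t → only-≥0 (does (b s ℕ.≟ p)) λ _ → u≥0 s s<t

  term≤weight : ∀ u b t {s} → (∀ s → s ℕ.< t → 0# ≤ u s) → s ℕ.< t → u s ≤ weight u b t (b s)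
  term≤weight u b t {s} u≥0 s<t = ≤-respˡ-≈
    (only-refl (b s))
    (term≤Σ t (λ j j<t → only-≥0 (does (b j ℕ.≟ b s)) λ _ → u≥0 j j<t) s<t)

  one : ℕ → Carrier
  one _ = 1#

  -- A second item in place `p` would raise the load by a second term of size at least `z`.
  count-≤1 : ∀ u b t p {z} → 0# ≤ z → (∀ s → s ℕ.< t → z ≤ u s) →
    ¬ (z + z ≤ weight u b t p) → weight one b t p ≤ 1#
  count-≤1 u b zero    p z≥0 u≥z few = 0≤1
  count-≤1 u b (suc t) p {z} z≥0 u≥z few with b t ℕ.≟ p
  ... | no neq = begin
    weight one b (suc t) p  ≈⟨ +-congˡ (only-≢ neq) ⟩
    weight one b t p + 0#   ≈⟨ +-identityʳ _ ⟩
    weight one b t p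
      ≤⟨ count-≤1 u b t p z≥0 (λ s s<t → u≥z s (ℕ.m<n⇒m<1+n s<t))
           (λ le → few (≤-trans le (≤-respʳ-≈ (sym eq) ≤-refl))) ⟩
    1# ∎
    where
    eq : weight u b (suc t) p ≈ weight u b t p
    eq = trans (+-congˡ (only-≢ neq)) (+-identityʳ _)
  ... | yes ≡.refl with weight-occurs one b t (b t)
  ...   | inj₂ w≈0 = ≤-reflexive (trans
    (+-cong w≈0 (only-refl (b t))) (+-identityˡ 1#))
  ...   | inj₁ (s , s<t , eq) = contradiction
    (+-mono-≤
      (≤-trans (u≥z s (ℕ.m<n⇒m<1+n s<t))
        (≡.subst (λ q → u s ≤ weight u b t q) eq
          (term≤weight u b t (λ j j<t → ≤-trans z≥0 (u≥z j (ℕ.m<n⇒m<1+n j<t))) s<t)))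
      (≤-respʳ-≈ (reflexive (≡.sym (≡.cong (λ e → only e (u t)) (eqᵇ-refl (b t))))) (u≥z t ℕ.≤-refl)))
    few

-- The lower bound obtained from a failure of first fit

module FirstFitFailure {c ℓ₁ ℓ₂} (F : OrderedField c ℓ₁ ℓ₂) where
  open OrderedField F hiding (zero; sum)
  open OrderedFieldProperties F
  open Sums F

  Fits : (ℓ v d : ℕ → Carrier) → Carrier → (ℕ → ℕ) → ℕ → ℕ → Set ℓ₂
  Fits ℓ v d κ a t p = ℓ t ≤ d p × ℓ t + weight ℓ a t p ≤ κ * v p

  -- Call p small if T * v p < 2 ℓ r.  A schedule o of time T puts at most one of
  -- the parcels 0 … r on a small drone.  First fit puts a parcel on a large drone
  -- only if each small drone able to carry it already carries a parcel, so in
  -- every prefix it places at least as many parcels on small drones as o does;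
  -- the lengths being decreasing, the same holds for volumes.  Large drones are
  -- filled beyond T * v p when r does not fit, so first fit would have placed
  -- more than the total length of the parcels 0 … r.
  module _
    (m r : ℕ) (ℓ v d : ℕ → Carrier) (κ T : Carrier) (a o : ℕ → ℕ)
    (ℓ>0 : ∀ t → t ℕ.≤ r → Positive (ℓ t))
    (ℓ-decreasing : ∀ s t → s ℕ.≤ t → t ℕ.≤ r → ℓ t ≤ ℓ s)
    (v>0 : ∀ p → p ℕ.< m → Positive (v p))
    (v-increasing : ∀ p q → p ℕ.≤ q → q ℕ.< m → v p ≤ v q)
    (a<m : ∀ t → t ℕ.< r → a t ℕ.< m)
    (a-first : ∀ t → t ℕ.< r → ∀ p → p ℕ.< a t → ¬ Fits ℓ v d κ a t p)
    (stuck : ∀ p → p ℕ.< m → ¬ Fits ℓ v d κ a r p)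
    (o<m : ∀ t → t ℕ.≤ r → o t ℕ.< m)
    (o-feasible : ∀ t → t ℕ.≤ r → ℓ t ≤ d (o t))
    (o-load : ∀ p → p ℕ.< m → weight ℓ o (suc r) p ≤ T * v p)
    (3T≤2κ : T + T + T ≤ κ + κ)
    where

    private
      z : Carrier
      z = ℓ r

      z≤ℓ : ∀ t → t ℕ.≤ r → z ≤ ℓ t
      z≤ℓ t t≤r = ℓ-decreasing t r t≤r ℕ.≤-refl

      ℓ≥0 : ∀ t → t ℕ.≤ r → 0# ≤ ℓ t
      ℓ≥0 t t≤r = positive⇒≥0 (ℓ>0 t t≤r)

      z≥0 : 0# ≤ z
      z≥0 = ℓ≥0 r ℕ.≤-refl

      small large : ℕ → Bool
      small p = not (does (z + z ≤? T * v p))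
      large p = not (small p)

      small⇒ : ∀ p → small p ≡ true → ¬ z + z ≤ T * v p
      small⇒ p eq with z + z ≤? T * v p
      small⇒ p () | yes _
      ... | no le = le

      large⇒ : ∀ p → small p ≡ false → z + z ≤ T * v p
      large⇒ p eq with z + z ≤? T * v p
      ... | yes le = le
      large⇒ p () | no _

      3Tv≤2κv : ∀ {p} → p ℕ.< m → T * v p + T * v p + T * v p ≤ κ * v p + κ * v p
      3Tv≤2κv {p} p<m = begin
        T * v p + T * v p + T * v p
          ≈⟨ solve 2 (λ T v → T :* v :+ T :* v :+ T :* v := (T :+ T :+ T) :* v) refl T (v p) ⟩
        (T + T + T) * v p  ≤⟨ *-monoʳ-≤ (positive⇒≥0 (v>0 p p<m)) 3T≤2κ ⟩
        (κ + κ) * v p  ≈⟨ distribʳ (v p) κ κ ⟩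
        κ * v p + κ * v p  ∎

      Tv≤κv : ∀ {p} → p ℕ.< m → 0# ≤ T * v p → T * v p ≤ κ * v p
      Tv≤κv p<m Tv≥0 = x+x≤y+y⇒x≤y (≤-trans (x≤x+y _ Tv≥0) (3Tv≤2κv p<m))

      weight-prefix : ∀ t p → t ℕ.≤ r → weight ℓ o (suc t) p ≤ weight ℓ o (suc r) p
      weight-prefix t p t≤r = Σ-monoˡ (ℕ.s≤s t≤r) λ s s<1+r →
        only-≥0 (does (o s ℕ.≟ p)) λ _ → ℓ≥0 s (ℕ.s≤s⁻¹ s<1+r)

      NO NA VO VA : ℕ → Carrier
      NO = weightIn one o small
      NA = weightIn one a small
      VO = weightIn ℓ o small
      VA = weightIn ℓ a small

      -- The comparison is made drone by drone. On a small drone `o` has at most one parcel, as two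
      -- would exceed what `T` allows. If it has one, then the drone, when empty, could take the
      -- shorter parcel `t`; so its being blocked means that first fit has already used it.
      blocked⇒NO≤NA : ∀ t → t ℕ.≤ r →
        (∀ p → p ℕ.< m → small p ≡ true → ¬ Fits ℓ v d κ a t p) → NO (suc t) ≤ NA t
      blocked⇒NO≤NA t t≤r blocked = begin
        NO (suc t)
          ≈⟨ Σ-weight m one o small (suc t) (λ s s<1+t → o<m s (ℕ.≤-trans (ℕ.s≤s⁻¹ s<1+t) t≤r)) ⟨
        Σ< m (λ p → only (small p) (weight one o (suc t) p))
          ≤⟨ Σ-mono m (λ p p<m → only-≤ (small p) (pointwise p p<m)) ⟩
        Σ< m (λ p → only (small p) (weight one a t p))
          ≈⟨ Σ-weight m one a small t (λ s s<t → a<m s (ℕ.<-≤-trans s<t t≤r)) ⟩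
        NA t ∎
        where
        pointwise : ∀ p → p ℕ.< m → small p ≡ true → weight one o (suc t) p ≤ weight one a t p
        pointwise p p<m sm with weight-occurs one o (suc t) p
        ... | inj₂ w≈0 = ≤-respˡ-≈ (sym w≈0) (weight-≥0 one a t p λ _ _ → 0≤1)
        ... | inj₁ (s , s<1+t , os≡p) with weight-occurs ℓ a t p
        ...   | inj₁ (s′ , s′<t , ≡.refl) = ≤-trans
          (count-≤1 ℓ o (suc t) p z≥0 (λ s s<1+t → z≤ℓ s (ℕ.≤-trans (ℕ.s≤s⁻¹ s<1+t) t≤r))
            λ le → small⇒ p sm (≤-trans le (≤-trans (weight-prefix t p t≤r) (o-load p p<m))))
          (term≤weight one a t (λ _ _ → 0≤1) s′<t)
        ...   | inj₂ w≈0 = contradiction (ℓt≤d , ℓt≤κv) (blocked p p<m sm)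
          where
          s≤t : s ℕ.≤ t
          s≤t = ℕ.s≤s⁻¹ s<1+t
          ℓt≤ℓs : ℓ t ≤ ℓ s
          ℓt≤ℓs = ℓ-decreasing s t s≤t t≤r
          ℓt≤d : ℓ t ≤ d p
          ℓt≤d = ≤-trans ℓt≤ℓs (≡.subst (λ q → ℓ s ≤ d q) os≡p (o-feasible s (ℕ.≤-trans s≤t t≤r)))
          ℓs≤Tv : ℓ s ≤ T * v p
          ℓs≤Tv = ≤-trans
            (≡.subst (λ q → ℓ s ≤ weight ℓ o (suc r) q) os≡p
              (term≤weight ℓ o (suc r) (λ j j<1+r → ℓ≥0 j (ℕ.s≤s⁻¹ j<1+r)) (ℕ.s≤s (ℕ.≤-trans s≤t t≤r))))
            (o-load p p<m)
          ℓt≤κv : ℓ t + weight ℓ a t p ≤ κ * v p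
          ℓt≤κv = begin
            ℓ t + weight ℓ a t p  ≈⟨ +-congˡ w≈0 ⟩
            ℓ t + 0#  ≈⟨ +-identityʳ (ℓ t) ⟩
            ℓ t  ≤⟨ ≤-trans ℓt≤ℓs ℓs≤Tv ⟩
            T * v p  ≤⟨ Tv≤κv p<m (≤-trans (ℓ≥0 s (ℕ.≤-trans s≤t t≤r)) ℓs≤Tv) ⟩
            κ * v p  ∎

      -- Speeds increase with position, so the large drones form a final segment. All small drones
      -- precede `a t`, and first fit had rejected each of them.
      large-choice⇒blocked : ∀ t → t ℕ.< r → small (a t) ≡ false →
        ∀ p → p ℕ.< m → small p ≡ true → ¬ Fits ℓ v d κ a t p
      large-choice⇒blocked t t<r lg p p<m sm with p ℕ.<? a t
      ... | yes p<at = a-first t t<r p p<at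
      ... | no p≮at = λ _ → small⇒ p sm (begin
        z + z  ≤⟨ large⇒ (a t) lg ⟩
        T * v (a t)    ≤⟨ *-monoˡ-≤ T≥0 (v-increasing (a t) p (ℕ.≮⇒≥ p≮at) p<m) ⟩
        T * v p  ∎)
        where
        -- A large drone has capacity at least 2z ≥ 0, and its speed is positive.
        T≥0 : 0# ≤ T
        T≥0 = *-cancelʳ-≤ (v>0 (a t) (a<m t t<r)) (begin
          0# * v (a t)  ≈⟨ zeroˡ _ ⟩
          0#  ≤⟨ +-nonNegative z≥0 z≥0 ⟩
          z + z  ≤⟨ large⇒ (a t) lg ⟩
          T * v (a t)   ∎)

      -- Only a step where `o` takes a small drone and first fit a large one could break the
      -- inequality. Exactly then all small drones are blocked, so the counts can be compared
      -- afresh.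
      NO≤NA : ∀ t → t ℕ.≤ r → NO t ≤ NA t
      NO≤NA zero    _   = ≤-refl
      NO≤NA (suc t) t<r = step (small (o t)) (small (a t)) ≡.refl ≡.refl
        where
        step : ∀ bo ba → small (o t) ≡ bo → small (a t) ≡ ba → NO (suc t) ≤ NA (suc t)
        step false _ so _ = begin
          NO (suc t)  ≈⟨ weightIn-miss one o small t so ⟩
          NO t  ≤⟨ NO≤NA t (ℕ.<⇒≤ t<r) ⟩
          NA t  ≤⟨ x≤x+y (NA t) (only-≥0 (small (a t)) λ _ → 0≤1) ⟩
          NA (suc t)  ∎
        step true true so sa = begin
          NO (suc t)  ≈⟨ weightIn-hit one o small t so ⟩
          NO t + 1#   ≤⟨ +-monoˡ-≤ 1# (NO≤NA t (ℕ.<⇒≤ t<r)) ⟩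
          NA t + 1#   ≈⟨ weightIn-hit one a small t sa ⟨
          NA (suc t)  ∎
        step true false so sa = begin
          NO (suc t)  ≤⟨ blocked⇒NO≤NA t (ℕ.<⇒≤ t<r) (large-choice⇒blocked t t<r sa) ⟩
          NA t  ≈⟨ weightIn-miss one a small t sa ⟨
          NA (suc t)  ∎

      NO[1+r]≤NA : NO (suc r) ≤ NA r
      NO[1+r]≤NA = blocked⇒NO≤NA r ℕ.≤-refl λ p p<m _ → stuck p p<m

      V-step : ∀ t b S → weightIn ℓ b S (suc t) ≈ weightIn ℓ b S t + ℓ t * only (S (b t)) 1#
      V-step t b S = +-congˡ (trans (only-cong (S (b t)) λ _ → sym (*-identityʳ (ℓ t))) (only-* (S (b t))))

      -- Lowering the common factor from `z` to `y` removes (z - y)M on the left and only (z - y)N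
      -- on the right.
      scale-down : ∀ {X Y M N y z} → y ≤ z → N ≤ M → X + z * M ≤ Y + z * N → X + y * M ≤ Y + y * N
      scale-down {X} {Y} {M} {N} {y} {z} y≤z N≤M le = +-cancelʳ-≤ (e * M) (begin
        X + y * M + e * M
          ≈⟨ solve 4 (λ X y e M → X :+ y :* M :+ e :* M := X :+ (e :+ y) :* M) refl X y e M ⟩
        X + (e + y) * M  ≈⟨ +-congˡ (*-congʳ (x-z+z z y)) ⟩
        X + z * M  ≤⟨ le ⟩
        Y + z * N  ≈⟨ +-congˡ (*-congʳ (x-z+z z y)) ⟨
        Y + (e + y) * N
          ≈⟨ solve 4 (λ X y e M → X :+ (e :+ y) :* M := X :+ y :* M :+ e :* M) refl Y y e N ⟩
        Y + y * N + e * N    ≤⟨ +-monoʳ-≤ (Y + y * N) (*-monoˡ-≤ e≥0 N≤M) ⟩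
        Y + y * N + e * M    ∎)
        where
        e : Carrier
        e = z + - y
        e≥0 : 0# ≤ e
        e≥0 = x+z≤y⇒x≤y-z (≤-respˡ-≈ (sym (+-identityˡ y)) y≤z)

      -- Abel summation with the terms moved across, so that no subtraction occurs: VO - VA ≤ ℓ t
      -- (NO - NA). The last factor is nonpositive by `NO≤NA`, so passing to the smaller length
      -- `ℓ (suc t)` only enlarges the right side.
      summation-by-parts : ∀ t → t ℕ.≤ r → VO t + ℓ t * NA t ≤ VA t + ℓ t * NO t
      summation-by-parts zero    _   = ≤-refl
      summation-by-parts (suc t) t<r =
        scale-down (ℓ-decreasing t (suc t) (ℕ.n≤1+n t) t<r) (NO≤NA (suc t) t<r) (begin
          VO (suc t) + y * (NA t + a₁)
            ≈⟨ +-congʳ (V-step t o small) ⟩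
          VO t + y * o₁ + y * (NA t + a₁)
            ≈⟨ solve 5 (λ X y M a o → X :+ y :* o :+ y :* (M :+ a) := X :+ y :* M :+ y :* (a :+ o))
                 refl (VO t) y (NA t) a₁ o₁ ⟩
          VO t + y * NA t + y * (a₁ + o₁)
            ≤⟨ +-monoˡ-≤ _ (summation-by-parts t (ℕ.<⇒≤ t<r)) ⟩
          VA t + y * NO t + y * (a₁ + o₁)
            ≈⟨ solve 5 (λ Y y N a o → Y :+ y :* N :+ y :* (a :+ o) := Y :+ y :* a :+ y :* (N :+ o))
                 refl (VA t) y (NO t) a₁ o₁ ⟩
          VA t + y * a₁ + y * (NO t + o₁)
            ≈⟨ +-congʳ (V-step t a small) ⟨
          VA (suc t) + y * (NO t + o₁) ∎)
        where
        y a₁ o₁ : Carrier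
        y  = ℓ t
        a₁ = only (small (a t)) 1#
        o₁ = only (small (o t)) 1#

      -- The count bound that is one step ahead, `NO[1+r]≤NA`, pays for parcel `r`, which `o`
      -- delivers and first fit does not.
      small-volume : VO (suc r) ≤ VA r
      small-volume = +-cancelʳ-≤ (z * NA r) (begin
        VO (suc r) + z * NA r  ≈⟨ +-congʳ (V-step r o small) ⟩
        VO r + z * o₁ + z * NA r
          ≈⟨ solve 3 (λ X y M → X :+ y :+ M := X :+ M :+ y) refl (VO r) (z * o₁) (z * NA r) ⟩
        VO r + z * NA r + z * o₁  ≤⟨ +-monoˡ-≤ _ (summation-by-parts r ℕ.≤-refl) ⟩
        VA r + z * NO r + z * o₁
          ≈⟨ solve 4 (λ Y z N o → Y :+ z :* N :+ z :* o := Y :+ z :* (N :+ o)) refl (VA r) z (NO r) o₁ ⟩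
        VA r + z * NO (suc r)  ≤⟨ +-monoʳ-≤ (VA r) (*-monoˡ-≤ z≥0 NO[1+r]≤NA) ⟩
        VA r + z * NA r  ∎)
        where
        o₁ : Carrier
        o₁ = only (small (o r)) 1#

      -- This is the origin of the factor 3/2. Being stuck gives κv ≤ z + w for the load w of first
      -- fit, and largeness gives 2z ≤ Tv, so 2Tv + 2z ≤ 3Tv ≤ 2κv ≤ 2w + 2z. A drone unable to
      -- carry `r` receives nothing from `o`, since all parcels up to `r` are at least as long.
      large-load : ∀ p → p ℕ.< m → large p ≡ true → weight ℓ o (suc r) p ≤ weight ℓ a r p
      large-load p p<m lg with z ≤? d p
      ... | no z≰d with weight-occurs ℓ o (suc r) p
      ...   | inj₁ (s , s<1+r , ≡.refl) = contradiction
        (≤-trans (z≤ℓ s (ℕ.s≤s⁻¹ s<1+r)) (o-feasible s (ℕ.s≤s⁻¹ s<1+r))) z≰d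
      ...   | inj₂ w≈0 = ≤-respˡ-≈ (sym w≈0) (weight-≥0 ℓ a r p λ s s<r → ℓ≥0 s (ℕ.<⇒≤ s<r))
      large-load p p<m lg | yes z≤d = ≤-trans (o-load p p<m) (x+x≤y+y⇒x≤y (+-cancelʳ-≤ (z + z) (begin
        Tv + Tv + (z + z)    ≤⟨ +-monoʳ-≤ (Tv + Tv) (large⇒ p (large⇒¬small (small p) lg)) ⟩
        Tv + Tv + Tv  ≤⟨ 3Tv≤2κv p<m ⟩
        κ * v p + κ * v p    ≤⟨ +-mono-≤ κv≤ κv≤ ⟩
        z + w + (z + w)  ≈⟨ solve 2 (λ z w → z :+ w :+ (z :+ w) := w :+ w :+ (z :+ z)) refl z w ⟩
        w + w + (z + z)  ∎)))
        where
        Tv w : Carrier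
        Tv = T * v p
        w  = weight ℓ a r p
        large⇒¬small : ∀ b → not b ≡ true → b ≡ false
        large⇒¬small false _ = ≡.refl
        κv≤ : κ * v p ≤ z + w
        κv≤ = ≰⇒≥ λ fits → stuck p p<m (z≤d , fits)

      large-volume : weightIn ℓ o large (suc r) ≤ weightIn ℓ a large r
      large-volume = begin
        weightIn ℓ o large (suc r)
          ≈⟨ Σ-weight m ℓ o large (suc r) (λ s s<1+r → o<m s (ℕ.s≤s⁻¹ s<1+r)) ⟨
        Σ< m (λ p → only (large p) (weight ℓ o (suc r) p))
          ≤⟨ Σ-mono m (λ p p<m → only-≤ (large p) (large-load p p<m)) ⟩
        Σ< m (λ p → only (large p) (weight ℓ a r p))
          ≈⟨ Σ-weight m ℓ a large r a<m ⟩
        weightIn ℓ a large r ∎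

    first-fit-stuck : ⊥
    first-fit-stuck = ℓ>0 r ℕ.≤-refl (+-cancelˡ-≤ (Σ< r ℓ) (begin
      Σ< r ℓ + ℓ r  ≈⟨ weightIn-not ℓ o small (suc r) ⟨
      VO (suc r) + weightIn ℓ o large (suc r)  ≤⟨ +-mono-≤ small-volume large-volume ⟩
      VA r + weightIn ℓ a large r  ≈⟨ weightIn-not ℓ a small r ⟩
      Σ< r ℓ  ≈⟨ +-identityʳ (Σ< r ℓ) ⟨
      Σ< r ℓ + 0#  ∎))

first : ∀ {ℓ} {P : ℕ → Set ℓ} (P? : ∀ p → Dec (P p)) m →
  (∃[ q ] q ℕ.< m × P q × (∀ p → p ℕ.< q → ¬ P p)) ⊎ (∀ p → p ℕ.< m → ¬ P p)
first P? zero = inj₂ λ _ ()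
first P? (suc m) with first P? m
... | inj₁ (q , q<m , Pq , least) = inj₁ (q , ℕ.m<n⇒m<1+n q<m , Pq , least)
... | inj₂ none with P? m
...   | yes Pm = inj₁ (m , ℕ.≤-refl , Pm , none)
...   | no ¬Pm = inj₂ λ p p<1+m → [ none p , (λ { ≡.refl → ¬Pm }) ]′ (ℕ.m<1+n⇒m<n∨m≡n p<1+m)

-- Growth of the guess and the comparison with the golden ratio

module Numerals {c ℓ₁ ℓ₂} (F : OrderedField c ℓ₁ ℓ₂) where
  open OrderedField F hiding (zero; sum)
  open OrderedFieldProperties F
  open import Algebra.Solver.Ring.NaturalCoefficients.Default commutativeSemiring
    using (Polynomial)

  -- The value of nat k unfolds to fromℕ k, unlike that of con k.
  nat : ∀ {j} → ℕ → Polynomial j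
  nat zero    = con 0
  nat (suc k) = con 1 :+ nat k

  fromℕ-≥0 : ∀ k → 0# ≤ fromℕ k
  fromℕ-≥0 zero    = ≤-refl
  fromℕ-≥0 (suc k) = +-nonNegative 0≤1 (fromℕ-≥0 k)

  fromℕ>0 : ∀ k → Positive (fromℕ (suc k))
  fromℕ>0 k = positive-≤ 1>0 (x≤x+y 1# (fromℕ-≥0 k))

  fromℕ*-cancel-≤ : ∀ k {x y} → fromℕ (suc k) * x ≤ fromℕ (suc k) * y → x ≤ y
  fromℕ*-cancel-≤ k {x} {y} le =
    *-cancelʳ-≤ (fromℕ>0 k) (≤-respˡ-≈ (*-comm _ x) (≤-respʳ-≈ (*-comm _ y) le))

  half : Carrier → Carrier
  half x = x / 1+1

  -- A sixteenth is taken by four halvings, just as the program takes it, so the computed value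
  -- agrees with this one definitionally.
  grow : Carrier → Carrier
  grow κ = κ + half (half (half (half κ)))

  16*sixteenth : ∀ κ → fromℕ 16 * half (half (half (half κ))) ≈ κ
  16*sixteenth κ = trans
    (solve 1 (λ e → nat 16 :* e :=
      (((e :+ e) :+ (e :+ e)) :+ ((e :+ e) :+ (e :+ e))) :+ (((e :+ e) :+ (e :+ e)) :+ ((e :+ e) :+ (e :+ e))))
      refl (half (half (half (half κ)))))
    (trans (double (double (double (half+half _))))
      (trans (double (double (half+half _))) (trans (double (half+half _)) (half+half κ))))
    where
    double : ∀ {x y} → x ≈ y → x + x ≈ y + y
    double eq = +-cong eq eq

  half-mono : ∀ {x y} → x ≤ y → half x ≤ half y
  half-mono = /-monoˡ-≤ 1+1>0

  sixteenth≥0 : ∀ {κ} → 0# ≤ κ → 0# ≤ half (half (half (half κ)))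
  sixteenth≥0 κ≥0 = 0≤half (0≤half (0≤half (0≤half κ≥0)))

  κ≤grow : ∀ {κ} → 0# ≤ κ → κ ≤ grow κ
  κ≤grow {κ} κ≥0 = x≤x+y κ (sixteenth≥0 κ≥0)

  -- 3/2 · 17/16 ≤ 8/5
  grow-stuck : ∀ {κ T} → 0# ≤ κ → κ + κ ≤ T + T + T → fromℕ 5 * grow κ ≤ fromℕ 8 * T
  grow-stuck {κ} {T} κ≥0 le = fromℕ*-cancel-≤ 2 (begin
    fromℕ 3 * (fromℕ 5 * (κ + e))
      ≈⟨ *-congˡ (*-congˡ (+-congʳ (16*sixteenth κ))) ⟨
    fromℕ 3 * (fromℕ 5 * (fromℕ 16 * e + e))
      -- Counted in units of `e`, the left side is 3 · 5 · 17 = 255, one short of 8 · 32 = 256.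
      ≤⟨ x≤x+y _ (sixteenth≥0 κ≥0) ⟩
    fromℕ 3 * (fromℕ 5 * (fromℕ 16 * e + e)) + e
      ≈⟨ solve 1 (λ e → nat 3 :* (nat 5 :* (nat 16 :* e :+ e)) :+ e
                    := nat 8 :* (nat 16 :* e :+ nat 16 :* e)) refl e ⟩
    fromℕ 8 * (fromℕ 16 * e + fromℕ 16 * e)
      ≈⟨ *-congˡ (+-cong (16*sixteenth κ) (16*sixteenth κ)) ⟩
    fromℕ 8 * (κ + κ)
      ≤⟨ *-monoˡ-≤ (fromℕ-≥0 8) le ⟩
    fromℕ 8 * (T + T + T)
      ≈⟨ solve 1 (λ T → nat 8 :* (T :+ T :+ T) := nat 3 :* (nat 8 :* T)) refl T ⟩
    fromℕ 3 * (fromℕ 8 * T) ∎)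
    where
    e : Carrier
    e = half (half (half (half κ)))

  grow^ : ℕ → Carrier → Carrier
  grow^ zero    κ = κ
  grow^ (suc j) κ = grow^ j (grow κ)

  grow^-+ : ∀ i j κ → grow^ (i ℕ.+ j) κ ≡ grow^ j (grow^ i κ)
  grow^-+ zero    j κ = ≡.refl
  grow^-+ (suc i) j κ = grow^-+ i j (grow κ)

  grow^-mono : ∀ j {x y} → x ≤ y → grow^ j x ≤ grow^ j y
  grow^-mono zero    le = le
  grow^-mono (suc j) le =
    grow^-mono j (+-mono-≤ le (half-mono (half-mono (half-mono (half-mono le)))))

  -- Bernoulli's inequality: every later increment is at least the first, because the value has
  -- grown meanwhile.
  bernoulli : ∀ j {κ} → 0# ≤ κ → κ + fromℕ j * half (half (half (half κ))) ≤ grow^ j κ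
  bernoulli zero    {κ} κ≥0 = ≤-reflexive (trans (+-congˡ (zeroˡ _)) (+-identityʳ κ))
  bernoulli (suc j) {κ} κ≥0 = begin
    κ + (1# + fromℕ j) * e  ≈⟨ solve 3 (λ κ j e → κ :+ (con 1 :+ j) :* e := κ :+ e :+ j :* e) refl κ (fromℕ j) e ⟩
    grow κ + fromℕ j * e
      ≤⟨ +-monoʳ-≤ (grow κ) (*-monoˡ-≤ (fromℕ-≥0 j)
           (half-mono (half-mono (half-mono (half-mono (κ≤grow κ≥0)))))) ⟩
    grow κ + fromℕ j * half (half (half (half (grow κ))))
      ≤⟨ bernoulli j (≤-trans κ≥0 (κ≤grow κ≥0)) ⟩
    grow^ j (grow κ) ∎
    where
    e : Carrier
    e = half (half (half (half κ)))

  grow^16 : ∀ {κ} → 0# ≤ κ → κ + κ ≤ grow^ 16 κ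
  grow^16 {κ} κ≥0 = ≤-respˡ-≈ (+-congˡ (16*sixteenth κ)) (bernoulli 16 κ≥0)

  half^ : ℕ → Carrier → Carrier
  half^ zero    x = x
  half^ (suc k) x = half (half^ k x)

  half^-≥0 : ∀ k {x} → 0# ≤ x → 0# ≤ half^ k x
  half^-≥0 zero    x≥0 = x≥0
  half^-≥0 (suc k) x≥0 = 0≤half (half^-≥0 k x≥0)

  -- A batch of `s` increases makes up for one halving, and monotonicity of `grow^` lets the batches
  -- follow one another.
  x≤grow^[half^] : ∀ s → (∀ {κ} → 0# ≤ κ → κ + κ ≤ grow^ s κ) →
    ∀ k {x} → 0# ≤ x → x ≤ grow^ (k ℕ.* s) (half^ k x)
  x≤grow^[half^] s doubles zero    x≥0 = ≤-refl
  x≤grow^[half^] s doubles (suc k) {x} x≥0 = begin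
    x  ≤⟨ x≤grow^[half^] s doubles k x≥0 ⟩
    grow^ (k ℕ.* s) (half^ k x)
      ≤⟨ grow^-mono (k ℕ.* s) (≤-respˡ-≈ (half+half (half^ k x)) (doubles (0≤half (half^-≥0 k x≥0)))) ⟩
    grow^ (k ℕ.* s) (grow^ s (half (half^ k x)))   ≈⟨ reflexive (grow^-+ s (k ℕ.* s) (half (half^ k x))) ⟨
    grow^ (suc k ℕ.* s) (half^ (suc k) x)  ∎

  x≤grow^[16*half^] : ∀ k {x} → 0# ≤ x → x ≤ grow^ (k ℕ.* 16) (half^ k x)
  x≤grow^[16*half^] k = x≤grow^[half^] 16 (λ κ≥0 → grow^16 κ≥0) k

  fromℕ-+ : ∀ i j → fromℕ (i ℕ.+ j) ≈ fromℕ i + fromℕ j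
  fromℕ-+ zero    j = sym (+-identityˡ _)
  fromℕ-+ (suc i) j = trans (+-congˡ (fromℕ-+ i j)) (sym (+-assoc 1# _ _))

  fromℕ-* : ∀ i j → fromℕ (i ℕ.* j) ≈ fromℕ i * fromℕ j
  fromℕ-* zero    j = sym (zeroˡ _)
  fromℕ-* (suc i) j = trans (fromℕ-+ j (i ℕ.* j))
    (trans (+-cong (sym (*-identityˡ _)) (fromℕ-* i j)) (sym (distribʳ (fromℕ j) 1# (fromℕ i))))

  fromℕ-mono : ∀ {i j} → i ℕ.≤ j → fromℕ i ≤ fromℕ j
  fromℕ-mono {j = j} ℕ.z≤n = fromℕ-≥0 j
  fromℕ-mono (ℕ.s≤s le)    = +-monoʳ-≤ 1# (fromℕ-mono le)

  half^-≤ : ∀ k {x T} → x ≤ fromℕ (2 ℕ.^ k) * T → half^ k x ≤ T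
  half^-≤ zero    {x} {T} le = ≤-respʳ-≈ (trans (*-congʳ (+-identityʳ 1#)) (*-identityˡ T)) le
  half^-≤ (suc k) {x} {T} le = x+x≤y+y⇒x≤y (begin
    half (half^ k x) + half (half^ k x)  ≈⟨ half+half _ ⟩
    half^ k x
      ≤⟨ half^-≤ k (≤-respʳ-≈ (trans (*-congʳ (fromℕ-+ a (a ℕ.+ 0))) (trans (*-congʳ (+-congˡ (fromℕ-+ a 0)))
           (solve 2 (λ a T → (a :+ (a :+ con 0)) :* T := a :* (T :+ T)) refl (fromℕ a) T))) le) ⟩
    T + T ∎)
    where
    a : ℕ
    a = 2 ℕ.^ k

  -- If √5 < 11/5 then 125 = (5 √5)² ≤ 11² = 121.
  8/5≤φ : ∀ {√5} → IsSquareRootOf √5 (fromℕ 5) → fromℕ 8 ≤ fromℕ 5 * ((1# + √5) / fromℕ 2)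
  8/5≤φ {r} (r≥0 , r²≈5) = fromℕ*-cancel-≤ 1 (begin
    fromℕ 2 * fromℕ 8  ≈⟨ trans (sym (fromℕ-* 2 8)) (fromℕ-+ 5 11) ⟩
    fromℕ 5 + fromℕ 11  ≤⟨ +-monoʳ-≤ (fromℕ 5) 11≤5r ⟩
    fromℕ 5 + fromℕ 5 * r  ≈⟨ solve 1 (λ r → nat 5 :+ nat 5 :* r := nat 5 :* (con 1 :+ r)) refl r ⟩
    fromℕ 5 * (1# + r)  ≈⟨ *-congˡ (x/v*v (fromℕ>0 1) (1# + r)) ⟨
    fromℕ 5 * ((1# + r) / fromℕ 2 * fromℕ 2)
      ≈⟨ solve 3 (λ a φ b → a :* (φ :* b) := b :* (a :* φ)) refl (fromℕ 5) ((1# + r) / fromℕ 2) (fromℕ 2) ⟩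
    fromℕ 2 * (fromℕ 5 * ((1# + r) / fromℕ 2)) ∎)
    where
    11≤5r : fromℕ 11 ≤ fromℕ 5 * r
    11≤5r with fromℕ 11 ≤? fromℕ 5 * r
    ... | yes le = le
    ... | no ¬le = contradiction (+-cancelʳ-≤ (fromℕ 121) (begin
      fromℕ 4 + fromℕ 121  ≈⟨ trans (sym (fromℕ-+ 4 121)) (fromℕ-* 25 5) ⟩
      fromℕ 25 * fromℕ 5  ≈⟨ *-congˡ r²≈5 ⟨
      fromℕ 25 * (r * r)  ≈⟨ solve 1 (λ r → nat 25 :* (r :* r) := nat 5 :* r :* (nat 5 :* r)) refl r ⟩
      fromℕ 5 * r * (fromℕ 5 * r)  ≤⟨ *-monoʳ-≤ (*-nonNegative (fromℕ-≥0 5) r≥0) 5r≤11 ⟩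
      fromℕ 11 * (fromℕ 5 * r)  ≤⟨ *-monoˡ-≤ (fromℕ-≥0 11) 5r≤11 ⟩
      fromℕ 11 * fromℕ 11  ≈⟨ sym (fromℕ-* 11 11) ⟩
      fromℕ 121  ≈⟨ +-identityˡ _ ⟨
      0# + fromℕ 121  ∎)) (fromℕ>0 3)
      where
      5r≤11 : fromℕ 5 * r ≤ fromℕ 11
      5r≤11 = ≰⇒≥ ¬le

-- First fit as a function, and a value for which it succeeds

module FirstFit {c ℓ₁ ℓ₂} (F : OrderedField c ℓ₁ ℓ₂)
  (m : ℕ) (ℓ v d : ℕ → OrderedField.Carrier F) where
  open OrderedField F hiding (zero; sum)
  open OrderedFieldProperties F
  open Sums F
  open FirstFitFailure F
  open Numerals F

  module _ (κ : Carrier) where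
    FitsLoad : (ℕ → Carrier) → ℕ → ℕ → Set ℓ₂
    FitsLoad L t p = ℓ t ≤ d p × ℓ t + L p ≤ κ * v p

    fits? : ∀ L t p → Dec (FitsLoad L t p)
    fits? L t p with ℓ t ≤? d p | ℓ t + L p ≤? κ * v p
    ... | yes le | yes le′ = yes (le , le′)
    ... | no ¬le | _       = no λ (le , _) → ¬le le
    ... | yes _  | no ¬le  = no λ (_ , le) → ¬le le

    -- The value m means that no drone fits.
    choose : (ℕ → Carrier) → ℕ → ℕ
    choose L t = [ proj₁ , (λ _ → m) ]′ (first (fits? L t) m)

    -- The loads are the recursive datum and `rank` is read off them: the choice for parcel `t`
    -- depends only on the current loads, so the recursion is structural. A parcel that fits nowhere
    -- is booked at position `m` and changes no load below `m`.
    placedLoad : ℕ → ℕ → Carrier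
    placedLoad zero    p = 0#
    placedLoad (suc t) p = placedLoad t p + only (does (choose (placedLoad t) t ℕ.≟ p)) (ℓ t)

    rank : ℕ → ℕ
    rank t = choose (placedLoad t) t

    placedLoad≡weight : ∀ t p → placedLoad t p ≡ weight ℓ rank t p
    placedLoad≡weight zero    p = ≡.refl
    placedLoad≡weight (suc t) p =
      ≡.cong (_+ only (does (rank t ℕ.≟ p)) (ℓ t)) (placedLoad≡weight t p)

    Fit : ℕ → ℕ → Set ℓ₂
    Fit t p = ℓ t ≤ d p × ℓ t + placedLoad t p ≤ κ * v p

    Fit⇔Fits : ∀ {t p} → (Fit t p → Fits ℓ v d κ rank t p) × (Fits ℓ v d κ rank t p → Fit t p)
    Fit⇔Fits {t} {p} =
      (λ (le , le′) → le , ≡.subst (λ x → ℓ t + x ≤ κ * v p) (placedLoad≡weight t p) le′) ,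
      (λ (le , le′) → le , ≡.subst (λ x → ℓ t + x ≤ κ * v p) (≡.sym (placedLoad≡weight t p)) le′)

    rank-cases : ∀ t →
      (rank t ℕ.< m × Fit t (rank t) × (∀ p → p ℕ.< rank t → ¬ Fit t p)) ⊎
      (rank t ≡ m × (∀ p → p ℕ.< m → ¬ Fit t p))
    rank-cases t with first (fits? (placedLoad t) t) m
    ... | inj₁ (q , q<m , fit , least) = inj₁ (q<m , fit , least)
    ... | inj₂ none = inj₂ (≡.refl , none)

    rank-first : ∀ t {q} → q ℕ.< m → Fit t q → (∀ p → p ℕ.< q → ¬ Fit t p) → rank t ≡ q
    rank-first t {q} q<m fit least with rank-cases t
    ... | inj₂ (_ , none) = contradiction fit (none q q<m)
    ... | inj₁ (_ , fit′ , least′) = ℕ.≤-antisym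
      (ℕ.≮⇒≥ λ q<r → least′ q q<r fit) (ℕ.≮⇒≥ λ r<q → least _ r<q fit′)

    rank-fit : ∀ t → rank t ℕ.< m → Fit t (rank t)
    rank-fit t r<m with rank-cases t
    ... | inj₁ (_ , fit , _) = fit
    ... | inj₂ (eq , _) = contradiction eq (ℕ.<⇒≢ r<m)

    rank-least : ∀ t → rank t ℕ.< m → ∀ p → p ℕ.< rank t → ¬ Fit t p
    rank-least t r<m with rank-cases t
    ... | inj₁ (_ , _ , least) = least
    ... | inj₂ (eq , _) = contradiction eq (ℕ.<⇒≢ r<m)

    placedLoad≤ : 0# ≤ κ → (∀ p → p ℕ.< m → 0# ≤ v p) → ∀ t → (∀ s → s ℕ.< t → rank s ℕ.< m) →
      ∀ p → p ℕ.< m → placedLoad t p ≤ κ * v p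
    placedLoad≤ κ≥0 v≥0 zero    placed p p<m = *-nonNegative κ≥0 (v≥0 p p<m)
    placedLoad≤ κ≥0 v≥0 (suc t) placed p p<m with rank t ℕ.≟ p
    ... | yes ≡.refl = begin
      placedLoad t p + only (does (rank t ℕ.≟ p)) (ℓ t)
        ≈⟨ +-congˡ (only-refl (rank t)) ⟩
      placedLoad t p + ℓ t    ≈⟨ +-comm _ _ ⟩
      ℓ t + placedLoad t p    ≤⟨ proj₂ (rank-fit t p<m) ⟩
      κ * v p  ∎
    ... | no neq = begin
      placedLoad t p + only (does (rank t ℕ.≟ p)) (ℓ t)
        ≈⟨ trans (+-congˡ (only-≢ neq)) (+-identityʳ _) ⟩
      placedLoad t p
        ≤⟨ placedLoad≤ κ≥0 v≥0 t (λ s s<t → placed s (ℕ.m<n⇒m<1+n s<t)) p p<m ⟩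
      κ * v p ∎

  module Fastest (n : ℕ)
    (ℓ>0 : ∀ t → t ℕ.< n → Positive (ℓ t))
    (ℓ-decreasing : ∀ s t → s ℕ.≤ t → t ℕ.< n → ℓ t ≤ ℓ s)
    (v>0 : ∀ p → p ℕ.< m → Positive (v p))
    (fastest : ℕ → ℕ)
    (fastest<m : ∀ t → t ℕ.< n → fastest t ℕ.< m)
    (fastest-feasible : ∀ t → t ℕ.< n → ℓ t ≤ d (fastest t))
    (fastest-max : ∀ t → t ℕ.< n → ∀ p → p ℕ.< m → ℓ t ≤ d p → v p ≤ v (fastest t))
    where

    -- This is the S of the overview.
    soloTime : Carrier
    soloTime = Σ< n (λ t → ℓ t / v (fastest t))

    private
      f>0 : ∀ t → t ℕ.< n → Positive (v (fastest t))
      f>0 t t<n = v>0 (fastest t) (fastest<m t t<n)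

      term≥0 : ∀ t → t ℕ.< n → 0# ≤ ℓ t / v (fastest t)
      term≥0 t t<n = *-nonNegative (positive⇒≥0 (ℓ>0 t t<n)) (0≤v⁻¹ (f>0 t t<n))

    soloTime≥0 : 0# ≤ soloTime
    soloTime≥0 = Σ-≥0 n term≥0

    -- The drone `q` could take all parcels up to `r`. They are no shorter than `r`, so their
    -- fastest drones can carry `r` too and are not faster than `q`; hence each of them costs `q` at
    -- most its solo time.
    fastest-fits : ∀ {κ} → soloTime ≤ κ → ∀ r → r ℕ.< n → Fit κ r (fastest r)
    fastest-fits {κ} soloTime≤κ r r<n = fastest-feasible r r<n , (begin
      ℓ r + placedLoad κ r q  ≈⟨ +-comm _ _ ⟩
      placedLoad κ r q + ℓ r  ≈⟨ +-congʳ (reflexive (placedLoad≡weight κ r q)) ⟩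
      weight ℓ (rank κ) r q + ℓ r
        ≤⟨ +-monoˡ-≤ (ℓ r) (Σ-mono r λ s s<r →
             only≤ (does (rank κ s ℕ.≟ q)) (positive⇒≥0 (ℓ>0 s (ℕ.<-trans s<r r<n)))) ⟩
      Σ< (suc r) ℓ  ≤⟨ Σ-mono (suc r) (λ s s<1+r → faster s (ℕ.s≤s⁻¹ s<1+r)) ⟩
      Σ< (suc r) (λ s → ℓ s / v (fastest s) * v q)
        ≈⟨ Σ-*ʳ (suc r) _ (v q) ⟩
      Σ< (suc r) (λ s → ℓ s / v (fastest s)) * v q
        ≤⟨ *-monoʳ-≤ (positive⇒≥0 (f>0 r r<n)) (≤-trans (Σ-monoˡ r<n term≥0) soloTime≤κ) ⟩
      κ * v q ∎)
      where
      q : ℕ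
      q = fastest r
      only≤ : ∀ b {x} → 0# ≤ x → only b x ≤ x
      only≤ true  _   = ≤-refl
      only≤ false x≥0 = x≥0
      faster : ∀ s → s ℕ.≤ r → ℓ s ≤ ℓ s / v (fastest s) * v q
      faster s s≤r = begin
        ℓ s  ≈⟨ x/v*v (f>0 s s<n) (ℓ s) ⟨
        ℓ s / v (fastest s) * v (fastest s)
          ≤⟨ *-monoˡ-≤ (term≥0 s s<n)
               (fastest-max r r<n (fastest s) (fastest<m s s<n)
                 (≤-trans (ℓ-decreasing s r s≤r r<n) (fastest-feasible s s<n))) ⟩
        ℓ s / v (fastest s) * v q  ∎
        where
        s<n : s ℕ.< n
        s<n = ℕ.≤-<-trans s≤r r<n

    -- Replacing the fastest drone of each parcel by `o t` can only lengthen the delivery. Regrouped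
    -- by drone, the sum has `m` groups of at most `T` each.
    soloTime≤mT : ∀ (o : ℕ → ℕ) T → (∀ t → t ℕ.< n → o t ℕ.< m) → (∀ t → t ℕ.< n → ℓ t ≤ d (o t)) →
      (∀ p → p ℕ.< m → weight ℓ o n p ≤ T * v p) → soloTime ≤ fromℕ m * T
    soloTime≤mT o T o<m o-feasible o-load = begin
      soloTime
        ≤⟨ Σ-mono n (λ t t<n → /-antimonoʳ-≤ (positive⇒≥0 (ℓ>0 t t<n)) (v>0 (o t) (o<m t t<n))
             (fastest-max t t<n (o t) (o<m t t<n) (o-feasible t t<n))) ⟩
      Σ< n (λ t → ℓ t / v (o t))  ≈⟨ Σ-weight m _ o (λ _ → true) n o<m ⟨
      Σ< m (λ p → weight (λ t → ℓ t / v (o t)) o n p)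
        ≤⟨ Σ-mono m (λ p p<m → time≤T p p<m) ⟩
      Σ< m (λ _ → T)  ≈⟨ Σ-const m ⟩
      fromℕ m * T  ∎
      where
      Σ-const : ∀ k → Σ< k (λ _ → T) ≈ fromℕ k * T
      Σ-const zero    = sym (zeroˡ T)
      Σ-const (suc k) = trans (+-congʳ (Σ-const k))
        (solve 2 (λ k T → k :* T :+ T := (con 1 :+ k) :* T) refl (fromℕ k) T)
      time≤T : ∀ p → p ℕ.< m → weight (λ t → ℓ t / v (o t)) o n p ≤ T
      time≤T p p<m = begin
        weight (λ t → ℓ t / v (o t)) o n p
          ≈⟨ Σ-cong n (λ t _ → at-p t) ⟩
        Σ< n (λ t → only (does (o t ℕ.≟ p)) (ℓ t) * v p ⁻¹)
          ≈⟨ Σ-*ʳ n _ (v p ⁻¹) ⟩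
        weight ℓ o n p / v p    ≤⟨ x≤y*v⇒x/v≤y (v>0 p p<m) (o-load p p<m) ⟩
        T  ∎
        where
        only-/ : ∀ b {x} → only b (x / v p) ≈ only b x / v p
        only-/ true  = refl
        only-/ false = sym (zeroˡ _)
        at-p : ∀ t → only (does (o t ℕ.≟ p)) (ℓ t / v (o t)) ≈ only (does (o t ℕ.≟ p)) (ℓ t) / v p
        at-p t with o t ℕ.≟ p
        ... | yes ≡.refl = only-/ (does (o t ℕ.≟ o t))
        ... | no neq = trans
          (only-≢ neq)
          (sym (trans (*-congʳ (only-≢ neq)) (zeroˡ _)))

-- Schedules in terms of sorted positions

record Permutation (N : ℕ) (π : ℕ → ℕ) : Set where
  field
    bounded    : ∀ i → i ℕ.< N → π i ℕ.< N
    injective  : ∀ i j → i ℕ.< N → j ℕ.< N → π i ≡ π j → i ≡ j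
    surjective : ∀ x → x ℕ.< N → ∃[ i ] i ℕ.< N × π i ≡ x

  inverse : ℕ → ℕ
  inverse x with x ℕ.<? N
  ... | yes x<N = proj₁ (surjective x x<N)
  ... | no _    = 0

  inverse< : ∀ x → x ℕ.< N → inverse x ℕ.< N
  inverse< x x<N with x ℕ.<? N
  ... | yes x<N = proj₁ (proj₂ (surjective x x<N))
  ... | no x≮N  = contradiction x<N x≮N

  π-inverse : ∀ x → x ℕ.< N → π (inverse x) ≡ x
  π-inverse x x<N with x ℕ.<? N
  ... | yes x<N = proj₂ (proj₂ (surjective x x<N))
  ... | no x≮N  = contradiction x<N x≮N

  inverse-injective : ∀ x y → x ℕ.< N → y ℕ.< N → inverse x ≡ inverse y → x ≡ y
  inverse-injective x y x<N y<N eq =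
    ≡.trans (≡.sym (π-inverse x x<N)) (≡.trans (≡.cong π eq) (π-inverse y y<N))

padded-toℕ : ∀ {a} {A : Set a} {k} (z : A) (xs : Fin k → A) i → padded z xs (toℕ i) ≡ xs i
padded-toℕ z xs zero    = ≡.refl
padded-toℕ z xs (suc i) = padded-toℕ z (xs ∘ suc) i

padded-fromℕ< : ∀ {a} {A : Set a} {k} (z : A) (xs : Fin k → A) {x} (x<k : x ℕ.< k) →
  padded z xs x ≡ xs (fromℕ< x<k)
padded-fromℕ< z xs x<k =
  ≡.trans (≡.cong (padded z xs) (≡.sym (toℕ-fromℕ< x<k))) (padded-toℕ z xs (fromℕ< x<k))

module Schedules {c ℓ₁ ℓ₂} (F : OrderedField c ℓ₁ ℓ₂) {m n} (I : DWP.Instance F m n) where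
  open OrderedField F hiding (zero)
  open DWP F
  open Instance I
  open OrderedFieldProperties F
  open Sums F
  open import Algebra.Construct.NaturalChoice.Max totalOrder using (x≤x⊔y; x≤y⊔x; ⊔-lub)

  lengthℕ speedℕ batteryℕ : ℕ → Carrier
  lengthℕ  = padded 0# length
  speedℕ   = padded 0# speed
  batteryℕ = padded 0# battery

  lengthℕ>0 : ∀ x → x ℕ.< n → Positive (lengthℕ x)
  lengthℕ>0 x x<n = ≡.subst Positive (≡.sym (padded-fromℕ< 0# length x<n)) (<⇒positive (length>0 _))

  speedℕ>0 : ∀ x → x ℕ.< m → Positive (speedℕ x)
  speedℕ>0 x x<m = ≡.subst Positive (≡.sym (padded-fromℕ< 0# speed x<m)) (<⇒positive (speed>0 _))

  sum≈Σ< : ∀ {k} (xs : Fin k → Carrier) → sum xs ≈ Σ< k (padded 0# xs)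
  sum≈Σ< {zero}  xs = refl
  sum≈Σ< {suc k} xs =
    trans (+-congˡ (sum≈Σ< (xs ∘ suc))) (sym (Σ-head k (padded 0# xs)))

  foldr-max-≥0 : ∀ {k} (xs : Fin k → Carrier) → 0# ≤ Vector.foldr max 0# xs
  foldr-max-≥0 {zero}  xs = ≤-refl
  foldr-max-≥0 {suc k} xs = ≤-trans (foldr-max-≥0 (xs ∘ suc)) (x≤y⊔x _ _)

  x≤foldr-max : ∀ {k} (xs : Fin k → Carrier) i → xs i ≤ Vector.foldr max 0# xs
  x≤foldr-max xs zero    = x≤x⊔y _ _
  x≤foldr-max xs (suc i) = ≤-trans (x≤foldr-max (xs ∘ suc) i) (x≤y⊔x _ _)

  foldr-max-≤ : ∀ {k B} (xs : Fin k → Carrier) → 0# ≤ B → (∀ i → xs i ≤ B) → Vector.foldr max 0# xs ≤ B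
  foldr-max-≤ {zero}  xs B≥0 le = B≥0
  foldr-max-≤ {suc k} xs B≥0 le = ⊔-lub (le zero) (foldr-max-≤ (xs ∘ suc) B≥0 (le ∘ suc))

  schedule : (ℕ → ℕ) → Schedule m n
  schedule out j = Vec.tabulate λ i → does (out (toℕ i) ℕ.≟ toℕ j)

  ∈-schedule : ∀ out i j → i ∈ schedule out j ⇔ out (toℕ i) ≡ toℕ j
  ∈-schedule out i j = mk⇔ to from
    where
    lookup≡ : Vec.lookup (schedule out j) i ≡ does (out (toℕ i) ℕ.≟ toℕ j)
    lookup≡ = lookup∘tabulate _ i
    to : i ∈ schedule out j → out (toℕ i) ≡ toℕ j
    to i∈ with out (toℕ i) ℕ.≟ toℕ j
    ... | yes eq = eq
    ... | no neq = contradiction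
      (≡.trans (≡.sym ([]=⇒lookup i∈)) (≡.trans lookup≡ (eqᵇ-≢ neq))) λ ()
    from : out (toℕ i) ≡ toℕ j → i ∈ schedule out j
    from eq = lookup⇒[]= i _ (≡.trans lookup≡ (dec-true (out (toℕ i) ℕ.≟ toℕ j) eq))

  module Ranked (π δ : ℕ → ℕ) (π-perm : Permutation n π) (δ-perm : Permutation m δ)
    (ℓ-decreasing : ∀ s t → s ℕ.≤ t → t ℕ.< n → lengthℕ (π t) ≤ lengthℕ (π s))
    (v-increasing : ∀ p q → p ℕ.≤ q → q ℕ.< m → speedℕ (δ p) ≤ speedℕ (δ q)) where
    module π = Permutation π-perm
    module δ = Permutation δ-perm

    ℓ v d : ℕ → Carrier
    ℓ t = lengthℕ (π t)
    v p = speedℕ (δ p)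
    d p = batteryℕ (δ p)

    open FirstFit F m ℓ v d
    open FirstFitFailure F

    ℓ>0 : ∀ t → t ℕ.< n → Positive (ℓ t)
    ℓ>0 t t<n = lengthℕ>0 (π t) (π.bounded t t<n)

    v>0 : ∀ p → p ℕ.< m → Positive (v p)
    v>0 p p<m = speedℕ>0 (δ p) (δ.bounded p p<m)

    module _ (g : Schedule m n) (valid : Valid I g) where
      open Valid valid

      T : Carrier
      T = deliveryTime I g

      private
        drone : ℕ → ℕ
        drone x with x ℕ.<? n
        ... | yes x<n = toℕ (proj₁ (assigned (fromℕ< x<n)))
        ... | no _    = 0

        drone-spec : ∀ {x} (x<n : x ℕ.< n) → ∃[ j ] drone x ≡ toℕ j × fromℕ< x<n ∈ g j
        drone-spec {x} x<n with x ℕ.<? n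
        ... | yes x<n′ = _ , ≡.refl , proj₂ (assigned (fromℕ< x<n′))
        ... | no x≮n   = contradiction x<n x≮n

      -- The schedule `g` seen from sorted positions: the rank of the drone that delivers the parcel
      -- at position `t`.
      o : ℕ → ℕ
      o t = δ.inverse (drone (π t))

      private
        o-spec : ∀ {t} (t<n : t ℕ.< n) → ∃[ j ] o t ℕ.< m × δ (o t) ≡ toℕ j × fromℕ< (π.bounded t t<n) ∈ g j
        o-spec {t} t<n with drone-spec (π.bounded t t<n)
        ... | j , eq , i∈ = j , ≡.subst (λ x → δ.inverse x ℕ.< m) (≡.sym eq) (δ.inverse< (toℕ j) (toℕ<n j)) ,
          ≡.trans (≡.cong (λ x → δ (δ.inverse x)) eq) (δ.π-inverse (toℕ j) (toℕ<n j)) , i∈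

      o<m : ∀ t → t ℕ.< n → o t ℕ.< m
      o<m t t<n = proj₁ (proj₂ (o-spec t<n))

      o-feasible : ∀ t → t ℕ.< n → ℓ t ≤ d (o t)
      o-feasible t t<n with o-spec t<n
      ... | j , _ , eq , i∈ = begin
        ℓ t  ≈⟨ reflexive (padded-fromℕ< 0# length (π.bounded t t<n)) ⟩
        length (fromℕ< (π.bounded t t<n))   ≤⟨ feasible i∈ ⟩
        battery j  ≈⟨ reflexive (padded-toℕ 0# battery j) ⟨
        batteryℕ (toℕ j)  ≈⟨ reflexive (≡.cong batteryℕ eq) ⟨
        d (o t)  ∎

      -- Injectivity of `π` bounds the sum over sorted positions by the sum over parcels. The latter
      -- consists of times, and the factor `v p` turns them back into lengths.
      o-load : ∀ p → p ℕ.< m → weight ℓ o n p ≤ T * v p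
      o-load p p<m = begin
        weight ℓ o n p  ≤⟨ Σ-mono n pointwise ⟩
        Σ< n (λ t → h (π t) * v p)  ≈⟨ Σ-*ʳ n _ (v p) ⟩
        Σ< n (λ t → h (π t)) * v p
          ≤⟨ *-monoʳ-≤ vp≥0 (Σ-injection n n π h π.bounded π.injective h≥0) ⟩
        Σ< n h * v p  ≈⟨ *-congʳ (sum≈Σ< share) ⟨
        sum share * v p  ≤⟨ *-monoʳ-≤ vp≥0 (x≤foldr-max (load I g) j) ⟩
        T * v p  ∎
        where
        vp≥0 : 0# ≤ v p
        vp≥0 = positive⇒≥0 (v>0 p p<m)
        j : Fin m
        j = fromℕ< (δ.bounded p p<m)
        share : Fin n → Carrier
        share i = if does (i ∈? g j) then length i / speed j else 0#
        h : ℕ → Carrier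
        h = padded 0# share
        vp≡ : v p ≡ speed j
        vp≡ = padded-fromℕ< 0# speed (δ.bounded p p<m)
        h≥0 : ∀ x → x ℕ.< n → 0# ≤ h x
        h≥0 x x<n = ≡.subst (0# ≤_) (≡.sym (padded-fromℕ< 0# share x<n))
          (only-≥0 (does (fromℕ< x<n ∈? g j)) λ _ → *-nonNegative (proj₁ (length>0 _)) (0≤v⁻¹ (<⇒positive (speed>0 j))))
        pointwise : ∀ t → t ℕ.< n → only (does (o t ℕ.≟ p)) (ℓ t) ≤ h (π t) * v p
        pointwise t t<n with o t ℕ.≟ p
        ... | no neq = ≤-respˡ-≈ (reflexive (≡.sym (≡.cong (λ e → only e (ℓ t)) (eqᵇ-≢ neq))))
          (*-nonNegative (h≥0 (π t) (π.bounded t t<n)) vp≥0)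
        ... | yes ≡.refl with o-spec t<n
        ...   | k , _ , eq , i∈ = ≤-reflexive (begin-equality
          only (does (o t ℕ.≟ o t)) (ℓ t)  ≈⟨ only-refl (o t) ⟩
          ℓ t  ≈⟨ reflexive (padded-fromℕ< 0# length (π.bounded t t<n)) ⟩
          length i  ≈⟨ x/v*v (<⇒positive (speed>0 j)) (length i) ⟨
          length i / speed j * speed j
            ≈⟨ *-cong (reflexive (≡.cong (λ e → only e (length i / speed j))
                 (dec-true (i ∈? g j) (≡.subst (λ k → i ∈ g k) k≡j i∈)))) (reflexive vp≡) ⟨
          share i * v p
            ≈⟨ *-congʳ (reflexive (padded-fromℕ< 0# share (π.bounded t t<n))) ⟨
          h (π t) * v p  ∎)
          where
          i : Fin n
          i = fromℕ< (π.bounded t t<n)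
          k≡j : k ≡ j
          k≡j = toℕ-injective (≡.trans (≡.sym eq) (≡.sym (toℕ-fromℕ< _)))

      -- Totality of the order turns the refutation of 3T ≤ 2κ into the reverse inequality, for the
      -- time of an arbitrary valid `g`.
      stuck⇒ : ∀ κ r → r ℕ.< n → (∀ t → t ℕ.< r → rank κ t ℕ.< m) → rank κ r ≡ m → κ + κ ≤ T + T + T
      stuck⇒ κ r r<n placed stuck = ≰⇒≥ λ 3T≤2κ →
        first-fit-stuck m r ℓ v d κ T (rank κ) o
          (λ t t≤r → ℓ>0 t (ℕ.≤-<-trans t≤r r<n))
          (λ s t s≤t t≤r → ℓ-decreasing s t s≤t (ℕ.≤-<-trans t≤r r<n))
          v>0 v-increasing placed
          (λ t t<r p p<q fits → rank-least κ t (placed t t<r) p p<q (proj₂ (Fit⇔Fits κ) fits))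
          (λ p p<m fits → none p p<m (proj₂ (Fit⇔Fits κ) fits))
          (λ t t≤r → o<m t (ℕ.≤-<-trans t≤r r<n))
          (λ t t≤r → o-feasible t (ℕ.≤-<-trans t≤r r<n))
          (λ p p<m → ≤-trans
            (Σ-monoˡ r<n λ s s<n → only-≥0 (does (o s ℕ.≟ p)) λ _ → positive⇒≥0 (ℓ>0 s s<n))
            (o-load p p<m))
          3T≤2κ
        where
        none : ∀ p → p ℕ.< m → ¬ Fit κ r p
        none with rank-cases κ r
        ... | inj₁ (r<m , _) = contradiction stuck (ℕ.<⇒≢ r<m)
        ... | inj₂ (_ , none) = none

    module _ (κ : Carrier) (κ≥0 : 0# ≤ κ) (placed : ∀ t → t ℕ.< n → rank κ t ℕ.< m)
      (out : ℕ → ℕ) (out-rank : ∀ t → t ℕ.< n → out (π t) ≡ δ (rank κ t)) where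

      private
        out≡ : ∀ i → out (toℕ i) ≡ δ (rank κ (π.inverse (toℕ i)))
        out≡ i = ≡.trans (≡.cong out (≡.sym (π.π-inverse (toℕ i) (toℕ<n i))))
          (out-rank (π.inverse (toℕ i)) (π.inverse< (toℕ i) (toℕ<n i)))

        placed′ : ∀ i → rank κ (π.inverse (toℕ i)) ℕ.< m
        placed′ i = placed (π.inverse (toℕ i)) (π.inverse< (toℕ i) (toℕ<n i))

      schedule-valid : Valid I (schedule out)
      schedule-valid = record
        { assigned = λ i → fromℕ< (δ.bounded _ (placed′ i)) ,
            Equivalence.from (∈-schedule out i _) (≡.trans (out≡ i) (≡.sym (toℕ-fromℕ< _)))
        ; unique   = λ {i} {j} {k} i∈j i∈k → toℕ-injective (≡.trans
            (≡.sym (Equivalence.to (∈-schedule out i j) i∈j)) (Equivalence.to (∈-schedule out i k) i∈k))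
        ; feasible = λ {i} {j} i∈j → begin
            length i  ≈⟨ reflexive (padded-toℕ 0# length i) ⟨
            lengthℕ (toℕ i)  ≈⟨ reflexive (≡.cong lengthℕ (π.π-inverse (toℕ i) (toℕ<n i))) ⟨
            ℓ (π.inverse (toℕ i))  ≤⟨ proj₁ (rank-fit κ _ (placed′ i)) ⟩
            d (rank κ (π.inverse (toℕ i)))  ≈⟨ reflexive (≡.cong batteryℕ (out≡ i)) ⟨
            batteryℕ (out (toℕ i))
              ≈⟨ reflexive (≡.cong batteryℕ (Equivalence.to (∈-schedule out i j) i∈j)) ⟩
            batteryℕ (toℕ j)  ≈⟨ reflexive (padded-toℕ 0# battery j) ⟩
            battery j  ∎
        }

      -- The inverse permutations turn the load of drone `j` into the placed load at its rank, which
      -- first fit has kept within κ times the speed.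
      schedule-time : deliveryTime I (schedule out) ≤ κ
      schedule-time = foldr-max-≤ _ κ≥0 λ j → let
          p = δ.inverse (toℕ j)
          p<m = δ.inverse< (toℕ j) (toℕ<n j)
          vp≡ : v p ≡ speed j
          vp≡ = ≡.trans (≡.cong speedℕ (δ.π-inverse (toℕ j) (toℕ<n j))) (padded-toℕ 0# speed j)
          sj>0 = <⇒positive (speed>0 j)
        in begin
        load I (schedule out) j  ≈⟨ sum≈Σ< (share j) ⟩
        Σ< n (padded 0# (share j))  ≤⟨ Σ-mono n (pointwise j) ⟩
        Σ< n (λ x → term j (π.inverse x))
          ≤⟨ Σ-injection n n π.inverse (term j) π.inverse< π.inverse-injective
               (λ t t<n → *-nonNegative (only-≥0 (does (rank κ t ℕ.≟ p)) λ _ → positive⇒≥0 (ℓ>0 t t<n)) (0≤v⁻¹ sj>0)) ⟩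
        Σ< n (term j)  ≈⟨ Σ-*ʳ n _ _ ⟩
        weight ℓ (rank κ) n p / speed j  ≈⟨ *-congʳ (reflexive (placedLoad≡weight κ n p)) ⟨
        placedLoad κ n p / speed j
          ≤⟨ x≤y*v⇒x/v≤y sj>0 (≡.subst (λ x → placedLoad κ n p ≤ κ * x) vp≡
               (placedLoad≤ κ κ≥0 (λ q q<m → positive⇒≥0 (v>0 q q<m)) n placed p p<m)) ⟩
        κ  ∎
        where
        share : Fin m → Fin n → Carrier
        share j i = if does (i ∈? schedule out j) then length i / speed j else 0#
        term : Fin m → ℕ → Carrier
        term j t = only (does (rank κ t ℕ.≟ δ.inverse (toℕ j))) (ℓ t) / speed j
        pointwise : ∀ j x → x ℕ.< n → padded 0# (share j) x ≤ term j (π.inverse x)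
        pointwise j x x<n = begin
          padded 0# (share j) x  ≈⟨ reflexive (padded-fromℕ< 0# (share j) x<n) ⟩
          only (does (i ∈? schedule out j)) (length i / speed j)
            ≈⟨ reflexive (≡.cong (λ e → only e (length i / speed j))
                 (does-⇔ (mk⇔ to from) (i ∈? schedule out j) (rank κ t ℕ.≟ p))) ⟩
          only (does (rank κ t ℕ.≟ p)) (length i / speed j)
            ≈⟨ only-/ (does (rank κ t ℕ.≟ p)) ⟩
          only (does (rank κ t ℕ.≟ p)) (length i) / speed j
            ≈⟨ *-congʳ (reflexive (≡.cong (only (does (rank κ t ℕ.≟ p))) ℓt≡)) ⟨
          term j t ∎
          where
          i : Fin n
          i = fromℕ< x<n
          t p : ℕ
          t = π.inverse x
          p = δ.inverse (toℕ j)
          only-/ : ∀ b {y} → only b (y / speed j) ≈ only b y / speed j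
          only-/ true  = refl
          only-/ false = sym (zeroˡ _)
          ℓt≡ : ℓ t ≡ length i
          ℓt≡ = ≡.trans (≡.cong lengthℕ (π.π-inverse x x<n)) (padded-fromℕ< 0# length x<n)
          out-i : out (toℕ i) ≡ δ (rank κ t)
          out-i = ≡.trans (out≡ i) (≡.cong (λ y → δ (rank κ (π.inverse y))) (toℕ-fromℕ< x<n))
          t<n : t ℕ.< n
          t<n = π.inverse< x x<n
          δp : δ p ≡ toℕ j
          δp = δ.π-inverse (toℕ j) (toℕ<n j)
          to : i ∈ schedule out j → rank κ t ≡ p
          to i∈ = δ.injective _ _ (placed t t<n) (δ.inverse< (toℕ j) (toℕ<n j))
            (≡.trans (≡.sym out-i) (≡.trans (Equivalence.to (∈-schedule out i j) i∈) (≡.sym δp)))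
          from : rank κ t ≡ p → i ∈ schedule out j
          from eq = Equivalence.from (∈-schedule out i j) (≡.trans out-i (≡.trans (≡.cong δ eq) δp))

-- Reasoning about programs with time budgets

does-true : ∀ {a} {A : Set a} (a? : Dec A) → does a? ≡ true → A
does-true (yes a) _ = a

does-false : ∀ {a} {A : Set a} (a? : Dec A) → does a? ≡ false → ¬ A
does-false (no ¬a) _ = ¬a

-- Boolean membership lets all side conditions on concrete lists of arrays be settled by `refl`.
_∈ᵇ_ : ℕ → List ℕ → Bool
a ∈ᵇ []       = false
a ∈ᵇ (b ∷ bs) = does (b ℕ.≟ a) ∨ a ∈ᵇ bs

_⊆ᵇ_ : List ℕ → List ℕ → Bool
[]       ⊆ᵇ bs = true
(a ∷ as) ⊆ᵇ bs = a ∈ᵇ bs ∧ as ⊆ᵇ bs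

∉-⊆ : ∀ as {bs} → as ⊆ᵇ bs ≡ true → ∀ a → a ∈ᵇ bs ≡ false → a ∈ᵇ as ≡ false
∉-⊆ []       sub a a∉ = ≡.refl
∉-⊆ (b ∷ as) {bs} sub a a∉ with b ℕ.≟ a | b ∈ᵇ bs in eq
∉-⊆ (b ∷ as) sub a a∉ | yes ≡.refl | true = contradiction (≡.trans (≡.sym eq) a∉) λ ()
∉-⊆ (b ∷ as) sub a a∉ | no neq     | true =
  ≡.trans (≡.cong (_∨ a ∈ᵇ as) (dec-false (b ℕ.≟ a) neq)) (∉-⊆ as sub a a∉)

module _ {a} {A : Set a} where
  _[_↦_] : (ℕ → A) → ℕ → A → ℕ → A
  (f [ k ↦ x ]) l = if does (k ℕ.≟ l) then x else f l

  ↦-at : ∀ (f : ℕ → A) k x → (f [ k ↦ x ]) k ≡ x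
  ↦-at f k x = ≡.cong (λ e → if e then x else f k) (dec-true (k ℕ.≟ k) ≡.refl)

  ↦-off : ∀ (f : ℕ → A) {k l} x → k ≢ l → (f [ k ↦ x ]) l ≡ f l
  ↦-off f {k} {l} x k≢l = ≡.cong (λ e → if e then x else f l) (dec-false (k ℕ.≟ l) k≢l)

module Runs {c ℓ₁ ℓ₂} (F : OrderedField c ℓ₁ ℓ₂) where
  open OrderedField F using (Carrier)
  open RealRAM F public

  Run : ∀ {a} → Program → State → ℕ → (State → Set a) → Set _
  Run p s B Q = ∃[ s′ ] ∃[ t ] ⟨ p , s ⟩⇓⟨ s′ , t ⟩ × t ℕ.≤ B × Q s′

  run-mono : ∀ {a b p s B B′} {P : State → Set a} {Q : State → Set b} →
    B ℕ.≤ B′ → (∀ s → P s → Q s) → Run p s B P → Run p s B′ Q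
  run-mono B≤B′ P⇒Q (s′ , t , d , t≤B , Ps′) = s′ , t , d , ℕ.≤-trans t≤B B≤B′ , P⇒Q s′ Ps′

  run-map : ∀ {a b p s B} {P : State → Set a} {Q : State → Set b} →
    (∀ s → P s → Q s) → Run p s B P → Run p s B Q
  run-map = run-mono ℕ.≤-refl

  run-skip : ∀ {a s} {Q : State → Set a} → Q s → Run skip s 1 Q
  run-skip Qs = _ , _ , ⇓-skip , ℕ.≤-refl , Qs

  setᴺ : State → ArrayName → ℕ → ℕ → State
  setᴺ s a k x = state (ints s [ a , k ≔ x ]) (reals s)

  setᴿ : State → ArrayName → ℕ → Carrier → State
  setᴿ s a k x = state (ints s) (reals s [ a , k ≔ x ])

  run-writeᴺ : ∀ {q b e e′ s} {Q : State → Set q} → Q (setᴺ s b (⟦ e ⟧ᴺ s) (⟦ e′ ⟧ᴺ s)) →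
    Run (writeᴺ b e e′) s (1 ℕ.+ costᴺ e ℕ.+ costᴺ e′) Q
  run-writeᴺ Qs = _ , _ , ⇓-writeᴺ , ℕ.≤-refl , Qs

  run-writeᴿ : ∀ {q b e e′ s} {Q : State → Set q} → Q (setᴿ s b (⟦ e ⟧ᴺ s) (⟦ e′ ⟧ᴿ s)) →
    Run (writeᴿ b e e′) s (1 ℕ.+ costᴺ e ℕ.+ costᴿ e′) Q
  run-writeᴿ Qs = _ , _ , ⇓-writeᴿ , ℕ.≤-refl , Qs

  infixr 2 _>>_
  _>>_ : ∀ {a b p q s B B′} {P : State → Set a} {Q : State → Set b} →
    Run p s B P → (∀ {s′} → P s′ → Run q s′ B′ Q) → Run (p ⨾ q) s (B ℕ.+ B′) Q
  (s₁ , t₁ , d₁ , t₁≤B , Ps₁) >> k with k Ps₁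
  ... | s₂ , t₂ , d₂ , t₂≤B′ , Qs₂ = s₂ , _ , ⇓-seq d₁ d₂ , ℕ.+-mono-≤ t₁≤B t₂≤B′ , Qs₂

  run-writeᴺ-⨾ : ∀ {q b e e′ p s B} {Q : State → Set q} →
    Run p (setᴺ s b (⟦ e ⟧ᴺ s) (⟦ e′ ⟧ᴺ s)) B Q →
    Run (writeᴺ b e e′ ⨾ p) s (1 ℕ.+ costᴺ e ℕ.+ costᴺ e′ ℕ.+ B) Q
  run-writeᴺ-⨾ (s′ , t , d , t≤B , Qs′) =
    s′ , _ , ⇓-seq ⇓-writeᴺ d , ℕ.+-monoʳ-≤ _ t≤B , Qs′

  run-writeᴿ-⨾ : ∀ {q b e e′ p s B} {Q : State → Set q} →
    Run p (setᴿ s b (⟦ e ⟧ᴺ s) (⟦ e′ ⟧ᴿ s)) B Q →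
    Run (writeᴿ b e e′ ⨾ p) s (1 ℕ.+ costᴺ e ℕ.+ costᴿ e′ ℕ.+ B) Q
  run-writeᴿ-⨾ (s′ , t , d , t≤B , Qs′) =
    s′ , _ , ⇓-seq ⇓-writeᴿ d , ℕ.+-monoʳ-≤ _ t≤B , Qs′

  -- Charging both branches keeps maxima out of the budgets and costs at most a factor of 2.
  run-branch : ∀ {a b p q s B B′} {Q : State → Set a} →
    (⟦ b ⟧ᴮ s ≡ true → Run p s B Q) → (⟦ b ⟧ᴮ s ≡ false → Run q s B′ Q) →
    Run (branch b p q) s (1 ℕ.+ costᴮ b ℕ.+ (B ℕ.+ B′)) Q
  run-branch {b = b} {p} {q} {s} {B} {B′} {Q} onTrue onFalse = go (⟦ b ⟧ᴮ s) ≡.refl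
    where
    go : ∀ v → ⟦ b ⟧ᴮ s ≡ v → Run (branch b p q) s (1 ℕ.+ costᴮ b ℕ.+ (B ℕ.+ B′)) Q
    go true eq with onTrue eq
    ... | s′ , t , d , t≤B , Qs′ = s′ , _ , ⇓-branch-true eq d ,
      ℕ.+-monoʳ-≤ (1 ℕ.+ costᴮ b) (ℕ.≤-trans t≤B (ℕ.m≤m+n B B′)) , Qs′
    go false eq with onFalse eq
    ... | s′ , t , d , t≤B , Qs′ = s′ , _ , ⇓-branch-false eq d ,
      ℕ.+-monoʳ-≤ (1 ℕ.+ costᴮ b) (ℕ.≤-trans t≤B (ℕ.m≤n+m B′ B)) , Qs′

  -- The index `r` is the variant, a bound on the remaining iterations; `suc r` also pays for the
  -- final failing test.
  run-while : ∀ {a q b body B} (Inv : ℕ → State → Set a) {Q : State → Set q} →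
    (∀ r s → Inv r s → (⟦ b ⟧ᴮ s ≡ false × Q s) ⊎
      (⟦ b ⟧ᴮ s ≡ true × ∃[ r′ ] r ≡ suc r′ × Run body s B (Inv r′))) →
    ∀ r s → Inv r s → Run (while b body) s (suc r ℕ.* (1 ℕ.+ costᴮ b ℕ.+ B)) Q
  run-while {b = b} {B = B} Inv step r s inv with step r s inv
  ... | inj₁ (eq , Qs) = s , _ , ⇓-while-false eq ,
    ℕ.≤-trans (ℕ.m≤m+n (1 ℕ.+ costᴮ b) B) (ℕ.m≤m+n (1 ℕ.+ costᴮ b ℕ.+ B) _) , Qs
  ... | inj₂ (eq , r′ , ≡.refl , s₁ , t₁ , d₁ , t₁≤B , inv′) with run-while Inv step r′ s₁ inv′
  ...   | s₂ , t₂ , d₂ , t₂≤ , Qs₂ = s₂ , _ , ⇓-while-true eq d₁ d₂ ,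
    ℕ.+-mono-≤ (ℕ.+-monoʳ-≤ (1 ℕ.+ costᴮ b) t₁≤B) t₂≤ , Qs₂

  -- is and rs name the arrays that may differ between the two states.
  record Frame (is rs : List ArrayName) (s s′ : State) : Set c where
    constructor frame
    field
      ints-≡  : ∀ a → a ∈ᵇ is ≡ false → ints s′ a ≡ ints s a
      reals-≡ : ∀ a → a ∈ᵇ rs ≡ false → reals s′ a ≡ reals s a

  open Frame public

  frame-refl : ∀ {is rs s} → Frame is rs s s
  frame-refl = frame (λ _ _ → ≡.refl) (λ _ _ → ≡.refl)

  frame-trans : ∀ {is rs s s′ s″} → Frame is rs s s′ → Frame is rs s′ s″ → Frame is rs s s″
  frame-trans f g = frame
    (λ a a∉ → ≡.trans (ints-≡ g a a∉) (ints-≡ f a a∉))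
    (λ a a∉ → ≡.trans (reals-≡ g a a∉) (reals-≡ f a a∉))

  frame-⊆ : ∀ {is is′ rs rs′ s s′} → is ⊆ᵇ is′ ≡ true → rs ⊆ᵇ rs′ ≡ true →
    Frame is rs s s′ → Frame is′ rs′ s s′
  frame-⊆ {is} {rs = rs} sub sub′ f = frame
    (λ a a∉ → ints-≡ f a (∉-⊆ is sub a a∉)) (λ a a∉ → reals-≡ f a (∉-⊆ rs sub′ a a∉))

  private
    ∉-≢ : ∀ as {a b} → b ∈ᵇ as ≡ true → a ∈ᵇ as ≡ false → b ≢ a
    ∉-≢ as b∈ a∉ ≡.refl = contradiction (≡.trans (≡.sym b∈) a∉) λ ()

  frame-setᴺ : ∀ {is rs s s′} b k x → b ∈ᵇ is ≡ true → Frame is rs s s′ → Frame is rs s (setᴺ s′ b k x)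
  frame-setᴺ {is} {s′ = s′} b k x b∈ f = frame
    (λ a a∉ → ≡.trans
      (≡.cong (λ e l → if e ∧ does (k ℕ.≟ l) then x else ints s′ a l) (dec-false (b ℕ.≟ a) (∉-≢ is b∈ a∉)))
      (ints-≡ f a a∉))
    (reals-≡ f)

  frame-setᴿ : ∀ {is rs s s′} b k x → b ∈ᵇ rs ≡ true → Frame is rs s s′ → Frame is rs s (setᴿ s′ b k x)
  frame-setᴿ {rs = rs} {s′ = s′} b k x b∈ f = frame (ints-≡ f)
    (λ a a∉ → ≡.trans
      (≡.cong (λ e l → if e ∧ does (k ℕ.≟ l) then x else reals s′ a l) (dec-false (b ℕ.≟ a) (∉-≢ rs b∈ a∉)))
      (reals-≡ f a a∉))

-- Memory layout and the programs on the tree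

outA widthA sizeA indexA posA nodeA orderA porderA flagA shiftA : ArrayName
outA    = 2
widthA  = 3
sizeA   = 4
indexA  = 5
posA    = 6
nodeA   = 7
orderA  = 8
porderA = 9
flagA   = 10
shiftA  = 11

treeA keyA κA slackA : ArrayName
treeA  = 3
keyA   = 4
κA     = 5
slackA = 6

%_ : ArrayName → IntExp
% a = readᴺ a (litᴺ 0)

%ᴿ_ : ArrayName → RealExp
%ᴿ a = readᴿ a (litᴺ 0)

infix 8 %_ %ᴿ_
infix 2 _≔ᴺ_ _≔ᴿ_

_≔ᴺ_ : ArrayName → IntExp → Program
a ≔ᴺ e = writeᴺ a (litᴺ 0) e

_≔ᴿ_ : ArrayName → RealExp → Program
a ≔ᴿ e = writeᴿ a (litᴺ 0) e

forEach : IntExp → Program → Program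
forEach e body =
  (indexA ≔ᴺ litᴺ 0) ⨾
  while (notᴮ (e ≤ᴺ % indexA)) (body ⨾ (indexA ≔ᴺ % indexA +ᴺ litᴺ 1))

-- Node k of the complete binary tree has the children k + k and k + k + 1, and
-- leaf q is node width + q; inner nodes hold the maximum of their children.

updateLoop : Program
updateLoop =
  while (litᴺ 2 ≤ᴺ % nodeA)
    ((nodeA ≔ᴺ halfᴺ (% nodeA)) ⨾
     branch (readᴿ treeA (% nodeA +ᴺ % nodeA) ≤ᴿ readᴿ treeA (% nodeA +ᴺ % nodeA +ᴺ litᴺ 1))
       (writeᴿ treeA (% nodeA) (readᴿ treeA (% nodeA +ᴺ % nodeA +ᴺ litᴺ 1)))
       (writeᴿ treeA (% nodeA) (readᴿ treeA (% nodeA +ᴺ % nodeA))))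

update : Program
update =
  (nodeA ≔ᴺ % widthA +ᴺ % posA) ⨾
  writeᴿ treeA (% nodeA) (%ᴿ keyA) ⨾
  updateLoop

-- If the left maximum does not reach the key, the right one must, provided that the current node
-- does.
findFirstLoop : Program
findFirstLoop =
  while (notᴮ (% widthA ≤ᴺ % nodeA))
    ((nodeA ≔ᴺ % nodeA +ᴺ % nodeA) ⨾
     branch (%ᴿ keyA ≤ᴿ readᴿ treeA (% nodeA)) skip (nodeA ≔ᴺ % nodeA +ᴺ litᴺ 1))

findFirst : Program
findFirst = (nodeA ≔ᴺ litᴺ 1) ⨾ findFirstLoop ⨾ (posA ≔ᴺ % nodeA ∸ᴺ % widthA)

-- The width becomes the least power of two that is at least `size`. All `width + width` cells are
-- reset, because an earlier tree may have left values there.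
clearTree : IntExp → Program
clearTree size =
  (sizeA ≔ᴺ size) ⨾
  (widthA ≔ᴺ litᴺ 1) ⨾
  while (notᴮ (% sizeA ≤ᴺ % widthA)) (widthA ≔ᴺ % widthA +ᴺ % widthA) ⨾
  forEach (% widthA +ᴺ % widthA) (writeᴿ treeA (% indexA) 0ᴿ)

setLeaves : Program → Program
setLeaves key = forEach (% sizeA) (key ⨾ (posA ≔ᴺ % indexA) ⨾ update)

-- Searching for the value of the root finds a leaf that attains the maximum. Keys are positive, so
-- overwriting that leaf with 0 takes it out of the competition.
selectionSort : Program
selectionSort = forEach (% sizeA)
  ((keyA ≔ᴿ readᴿ treeA (litᴺ 1)) ⨾
   findFirst ⨾
   writeᴺ orderA (% indexA) (% posA) ⨾
   (keyA ≔ᴿ 0ᴿ) ⨾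
   update)

halves : ∀ k → k ≡ ℕ.⌊ k /2⌋ ℕ.+ ℕ.⌊ k /2⌋ ⊎ k ≡ ℕ.⌊ k /2⌋ ℕ.+ ℕ.⌊ k /2⌋ ℕ.+ 1
halves zero          = inj₁ ≡.refl
halves (suc zero)    = inj₂ ≡.refl
halves (suc (suc k)) with halves k
... | inj₁ eq = inj₁ (≡.cong suc (≡.trans (≡.cong suc eq) (≡.sym (ℕ.+-suc _ _))))
... | inj₂ eq = inj₂ (≡.cong suc (≡.trans (≡.cong suc eq) (≡.cong (ℕ._+ 1) (≡.sym (ℕ.+-suc _ _)))))

half-double : ∀ k → ℕ.⌊ k ℕ.+ k /2⌋ ≡ k
half-double zero    = ≡.refl
half-double (suc k) = ≡.trans (≡.cong (λ x → ℕ.⌊ suc x /2⌋) (ℕ.+-suc k k)) (≡.cong suc (half-double k))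

half-double+1 : ∀ k → ℕ.⌊ k ℕ.+ k ℕ.+ 1 /2⌋ ≡ k
half-double+1 zero    = ≡.refl
half-double+1 (suc k) = ≡.trans (≡.cong (λ x → ℕ.⌊ suc (x ℕ.+ 1) /2⌋) (ℕ.+-suc k k)) (≡.cong suc (half-double+1 k))

k+k<2^ : ∀ {k} e → k ℕ.< 2 ℕ.^ e → k ℕ.+ k ℕ.+ 1 ℕ.< 2 ℕ.^ suc e
k+k<2^ {k} e k<2^e = ≡.subst₂ ℕ._≤_
  (≡.cong suc (≡.trans (ℕ.+-suc k k) (ℕ.+-comm 1 (k ℕ.+ k))))
  (≡.cong (2 ℕ.^ e ℕ.+_) (≡.sym (ℕ.+-identityʳ _)))
  (ℕ.+-mono-≤ k<2^e k<2^e)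

half<2^ : ∀ {k} e → k ℕ.< 2 ℕ.^ suc e → ℕ.⌊ k /2⌋ ℕ.< 2 ℕ.^ e
half<2^ {k} e k<2^ = ℕ.≰⇒> λ le → ℕ.<⇒≱ k<2^ (ℕ.≤-trans
  (≡.subst (ℕ._≤ ℕ.⌊ k /2⌋ ℕ.+ ℕ.⌊ k /2⌋) (≡.cong (2 ℕ.^ e ℕ.+_) (≡.sym (ℕ.+-identityʳ _)))
    (ℕ.+-mono-≤ le le))
  ([ (λ eq → ℕ.≤-reflexive (≡.sym eq)) ,
     (λ eq → ℕ.≤-trans (ℕ.m≤m+n _ 1) (ℕ.≤-reflexive (≡.sym eq))) ]′ (halves k)))

1≤half : ∀ {k} → 2 ℕ.≤ k → 1 ℕ.≤ ℕ.⌊ k /2⌋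
1≤half (ℕ.s≤s (ℕ.s≤s _)) = ℕ.s≤s ℕ.z≤n

-- In all cost functions, H is the height of the tree; K is the cost of computing
-- a key and e that of evaluating the size.
updateCost : ℕ → ℕ
updateCost H = 12 ℕ.+ suc H ℕ.* 46

findCost : ℕ → ℕ
findCost H = 3 ℕ.+ (suc H ℕ.* 28 ℕ.+ 7)

module ForEach {c ℓ₁ ℓ₂} (F : OrderedField c ℓ₁ ℓ₂) where
  open Runs F

  next : State → State
  next s = setᴺ s indexA 0 (ints s indexA 0 ℕ.+ 1)

  -- The invariant for `suc k` is demanded of `next s′`, the state after the increment, because
  -- invariants speak of the whole state including the counter.
  run-forEach : ∀ {a e body B} N (Inv : ℕ → State → Set a) s →
    (∀ k s → Inv k s → ⟦ e ⟧ᴺ s ≡ N) →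
    (∀ k s → k ℕ.< N → ints s indexA 0 ≡ k → Inv k s →
      Run body s B (λ s′ → ints s′ indexA 0 ≡ k × Inv (suc k) (next s′))) →
    Inv 0 (setᴺ s indexA 0 0) →
    Run (forEach e body) s (3 ℕ.+ suc N ℕ.* (5 ℕ.+ costᴺ e ℕ.+ (B ℕ.+ 6))) (Inv N)
  run-forEach {e = e} {body} {B} N Inv s size step inv =
    run-writeᴺ-⨾ (run-mono (ℕ.≤-reflexive (≡.cong (suc N ℕ.*_) cost≡)) (λ _ q → q)
      (run-while Inv′ step′ N (setᴺ s indexA 0 0) (0 , ≡.refl , ≡.refl , inv)))
    where
    Inv′ : ℕ → State → Set _
    Inv′ r s = ∃[ k ] k ℕ.+ r ≡ N × ints s indexA 0 ≡ k × Inv k s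
    cost≡ : 1 ℕ.+ costᴮ (notᴮ (e ≤ᴺ % indexA)) ℕ.+ (B ℕ.+ 6) ≡ 5 ℕ.+ costᴺ e ℕ.+ (B ℕ.+ 6)
    cost≡ = ≡.cong (λ x → 3 ℕ.+ x ℕ.+ (B ℕ.+ 6)) (ℕ.+-comm (costᴺ e) 2)
    step′ : ∀ r s → Inv′ r s → (⟦ notᴮ (e ≤ᴺ % indexA) ⟧ᴮ s ≡ false × Inv N s) ⊎
      (⟦ notᴮ (e ≤ᴺ % indexA) ⟧ᴮ s ≡ true × ∃[ r′ ] r ≡ suc r′ ×
        Run (body ⨾ (indexA ≔ᴺ % indexA +ᴺ litᴺ 1)) s (B ℕ.+ 6) (Inv′ r′))
    step′ zero s (k , k+0≡N , i≡k , inv) with ≡.trans (≡.sym (ℕ.+-identityʳ k)) k+0≡N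
    ... | ≡.refl = inj₁ (≡.cong not (dec-true (⟦ e ⟧ᴺ s ℕ.≤? ints s indexA 0)
      (ℕ.≤-reflexive (≡.trans (size k s inv) (≡.sym i≡k)))) , inv)
    step′ (suc r) s (k , k+1+r≡N , i≡k , inv) = inj₂
      ( ≡.cong not (dec-false (⟦ e ⟧ᴺ s ℕ.≤? ints s indexA 0)
          (ℕ.<⇒≱ (≡.subst₂ ℕ._<_ (≡.sym i≡k) (≡.sym (size k s inv)) k<N)))
      , r , ≡.refl
      , (step k s k<N i≡k inv >> λ (i≡k′ , inv′) → run-writeᴺ
          (suc k , ≡.trans (≡.sym (ℕ.+-suc k r)) k+1+r≡N ,
            ≡.trans (ℕ.+-comm _ 1) (≡.cong suc i≡k′) , inv′)))
      where
      k<N : k ℕ.< N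
      k<N = ≡.subst (k ℕ.<_) k+1+r≡N (ℕ.m<m+n k (ℕ.s≤s ℕ.z≤n))

-- Updating the tree and searching in it

module Trees {c ℓ₁ ℓ₂} (F : OrderedField c ℓ₁ ℓ₂) where
  open OrderedField F hiding (zero; sum)
  open OrderedFieldProperties F
  open Runs F
  open ForEach F

  record NodeOK (tr : ℕ → Carrier) (k : ℕ) : Set (c ⊔ ℓ₂) where
    constructor node-ok
    field
      left≤  : tr (k ℕ.+ k) ≤ tr k
      right≤ : tr (k ℕ.+ k ℕ.+ 1) ≤ tr k
      attain : tr k ≡ tr (k ℕ.+ k) ⊎ tr k ≡ tr (k ℕ.+ k ℕ.+ 1)
  open NodeOK public

  -- While an update climbs, the only node that may be wrong is the parent of the node written last.
  TreeExcept : ℕ → ℕ → (ℕ → Carrier) → Set (c ⊔ ℓ₂)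
  TreeExcept j H tr = ∀ k → 1 ℕ.≤ k → k ℕ.< 2 ℕ.^ H → k ≢ j → NodeOK tr k

  Tree : ℕ → (ℕ → Carrier) → Set (c ⊔ ℓ₂)
  Tree H tr = ∀ k → 1 ℕ.≤ k → k ℕ.< 2 ℕ.^ H → NodeOK tr k

  node-untouched : ∀ {tr j x k} → NodeOK tr k → j ≢ k → k ≢ ℕ.⌊ j /2⌋ → NodeOK (tr [ j ↦ x ]) k
  node-untouched {tr} {j} {x} {k} ok j≢k k≢ = node-ok
    (≡.subst₂ _≤_ (≡.sym l≡) (≡.sym k≡) (left≤ ok))
    (≡.subst₂ _≤_ (≡.sym r≡) (≡.sym k≡) (right≤ ok))
    (≡.subst₂ (λ y z → (tr [ j ↦ x ]) k ≡ y ⊎ (tr [ j ↦ x ]) k ≡ z) (≡.sym l≡) (≡.sym r≡)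
      (≡.subst (λ y → y ≡ tr (k ℕ.+ k) ⊎ y ≡ tr (k ℕ.+ k ℕ.+ 1)) (≡.sym k≡) (attain ok)))
    where
    k≡ : (tr [ j ↦ x ]) k ≡ tr k
    k≡ = ↦-off tr x j≢k
    l≡ : (tr [ j ↦ x ]) (k ℕ.+ k) ≡ tr (k ℕ.+ k)
    l≡ = ↦-off tr x λ eq → k≢ (≡.sym (≡.trans (≡.cong ℕ.⌊_/2⌋ eq) (half-double k)))
    r≡ : (tr [ j ↦ x ]) (k ℕ.+ k ℕ.+ 1) ≡ tr (k ℕ.+ k ℕ.+ 1)
    r≡ = ↦-off tr x λ eq → k≢ (≡.sym (≡.trans (≡.cong ℕ.⌊_/2⌋ eq) (half-double+1 k)))

  node-refreshed : ∀ {tr h y} → 1 ℕ.≤ h → tr (h ℕ.+ h) ≤ y → tr (h ℕ.+ h ℕ.+ 1) ≤ y →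
    y ≡ tr (h ℕ.+ h) ⊎ y ≡ tr (h ℕ.+ h ℕ.+ 1) → NodeOK (tr [ h ↦ y ]) h
  node-refreshed {tr} {h} {y} 1≤h le le′ att = node-ok
    (≡.subst₂ _≤_ (≡.sym l≡) (≡.sym h≡) le)
    (≡.subst₂ _≤_ (≡.sym r≡) (≡.sym h≡) le′)
    (≡.subst₂ (λ a b → (tr [ h ↦ y ]) h ≡ a ⊎ (tr [ h ↦ y ]) h ≡ b) (≡.sym l≡) (≡.sym r≡)
      (≡.subst (λ a → a ≡ tr (h ℕ.+ h) ⊎ a ≡ tr (h ℕ.+ h ℕ.+ 1)) (≡.sym h≡) att))
    where
    h<h+h : h ℕ.< h ℕ.+ h
    h<h+h = ℕ.m<m+n h 1≤h
    h≡ : (tr [ h ↦ y ]) h ≡ y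
    h≡ = ↦-at tr h y
    l≡ : (tr [ h ↦ y ]) (h ℕ.+ h) ≡ tr (h ℕ.+ h)
    l≡ = ↦-off tr y (ℕ.<⇒≢ h<h+h)
    r≡ : (tr [ h ↦ y ]) (h ℕ.+ h ℕ.+ 1) ≡ tr (h ℕ.+ h ℕ.+ 1)
    r≡ = ↦-off tr y (ℕ.<⇒≢ (ℕ.<-≤-trans h<h+h (ℕ.m≤m+n _ 1)))

  node≤parent : ∀ H {tr} → Tree H tr → ∀ k → 2 ℕ.≤ k → k ℕ.< 2 ℕ.^ suc H → tr k ≤ tr ℕ.⌊ k /2⌋
  node≤parent H {tr} tree k 2≤k k< with halves k | tree ℕ.⌊ k /2⌋ (1≤half 2≤k) (half<2^ H k<)
  ... | inj₁ eq | ok = ≤-trans (≡⇒≤ (≡.cong tr eq)) (left≤ ok)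
  ... | inj₂ eq | ok = ≤-trans (≡⇒≤ (≡.cong tr eq)) (right≤ ok)

  leaf< : ∀ H {q} → q ℕ.< 2 ℕ.^ H → 2 ℕ.^ H ℕ.+ q ℕ.< 2 ℕ.^ suc H
  leaf< H q< = ℕ.+-monoʳ-< (2 ℕ.^ H) (≡.subst (_ ℕ.<_) (≡.sym (ℕ.+-identityʳ _)) q<)

  -- The proof climbs from parent to parent; the level `e` of node `k` serves as the structural
  -- measure.
  node≤root : ∀ H {tr} → Tree H tr → ∀ e k → 2 ℕ.^ e ℕ.≤ k → k ℕ.< 2 ℕ.^ suc e → e ℕ.≤ H → tr k ≤ tr 1
  node≤root H {tr} tree zero k 1≤k k<2 _ = ≡⇒≤ (≡.cong tr (ℕ.≤-antisym (ℕ.s≤s⁻¹ k<2) 1≤k))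
  node≤root H tree (suc e) k le k< e<H = ≤-trans
    (node≤parent H tree k (ℕ.≤-trans (ℕ.*-monoʳ-≤ 2 (ℕ.m^n>0 2 e)) le)
      (ℕ.<-≤-trans k< (ℕ.^-monoʳ-≤ 2 (ℕ.s≤s e<H))))
    (node≤root H tree e ℕ.⌊ k /2⌋ (ℕ.≮⇒≥ λ lt → ℕ.<⇒≱ (lem lt) le) (half<2^ (suc e) k<) (ℕ.<⇒≤ e<H))
    where
    lem : ℕ.⌊ k /2⌋ ℕ.< 2 ℕ.^ e → k ℕ.< 2 ℕ.^ suc e
    lem lt with halves k | k+k<2^ e lt
    ... | inj₁ eq | b = ≡.subst (ℕ._< _) (≡.sym eq) (ℕ.≤-<-trans (ℕ.m≤m+n _ 1) b)
    ... | inj₂ eq | b = ≡.subst (ℕ._< _) (≡.sym eq) b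

  leaf≤root : ∀ H {tr} → Tree H tr → ∀ q → q ℕ.< 2 ℕ.^ H → tr (2 ℕ.^ H ℕ.+ q) ≤ tr 1
  leaf≤root H tree q q< = node≤root H tree H _ (ℕ.m≤m+n _ q) (leaf< H q<) ℕ.≤-refl

  record Updated (H p : ℕ) (s s′ : State) : Set (c ⊔ ℓ₂) where
    field
      framed : Frame (nodeA ∷ []) (treeA ∷ []) s s′
      tree   : Tree H (reals s′ treeA)
      leaf-p : reals s′ treeA (2 ℕ.^ H ℕ.+ p) ≡ reals s keyA 0
      leaf-q : ∀ q → q ≢ p → reals s′ treeA (2 ℕ.^ H ℕ.+ q) ≡ reals s treeA (2 ℕ.^ H ℕ.+ q)

  run-update : ∀ {s} H p → ints s widthA 0 ≡ 2 ℕ.^ H → ints s posA 0 ≡ p → p ℕ.< 2 ℕ.^ H →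
    Tree H (reals s treeA) → Run update s (updateCost H) (Updated H p s)
  run-update {s} H p w≡ p≡ p< tree =
    run-writeᴺ-⨾ (run-writeᴿ-⨾ (run-while Inv step H s₁
      (ℕ.≤-refl , frame-setᴿ treeA n₀ _ ≡.refl (frame-setᴺ nodeA 0 n₀ ≡.refl frame-refl) ,
       1≤n₀ , ≡.subst (ℕ._< 2 ℕ.^ suc H) (≡.sym n₀≡) (leaf< H p<) , excepted , at , off)))
    where
    n₀ : ℕ
    n₀ = ints s widthA 0 ℕ.+ ints s posA 0
    n₀≡ : n₀ ≡ 2 ℕ.^ H ℕ.+ p
    n₀≡ = ≡.cong₂ ℕ._+_ w≡ p≡
    s₁ : State
    s₁ = setᴿ (setᴺ s nodeA 0 n₀) treeA n₀ (reals s keyA 0)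
    1≤n₀ : 1 ℕ.≤ n₀
    1≤n₀ = ≡.subst (1 ℕ.≤_) (≡.sym n₀≡) (ℕ.≤-trans (ℕ.m^n>0 2 H) (ℕ.m≤m+n _ p))
    Inv : ℕ → State → Set (c ⊔ ℓ₂)
    -- The current node is below 2^(r+1), so it has at most `r` proper ancestors left to refresh.
    Inv r s′ = r ℕ.≤ H × Frame (nodeA ∷ []) (treeA ∷ []) s s′ ×
      1 ℕ.≤ ints s′ nodeA 0 × ints s′ nodeA 0 ℕ.< 2 ℕ.^ suc r ×
      TreeExcept ℕ.⌊ ints s′ nodeA 0 /2⌋ H (reals s′ treeA) ×
      reals s′ treeA (2 ℕ.^ H ℕ.+ p) ≡ reals s keyA 0 ×
      (∀ q → q ≢ p → reals s′ treeA (2 ℕ.^ H ℕ.+ q) ≡ reals s treeA (2 ℕ.^ H ℕ.+ q))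
    tr₀ tr₁ : ℕ → Carrier
    tr₀ = reals s treeA
    tr₁ = reals s₁ treeA
    at : tr₁ (2 ℕ.^ H ℕ.+ p) ≡ reals s keyA 0
    at = ≡.trans (≡.cong tr₁ (≡.sym n₀≡)) (↦-at tr₀ n₀ _)
    off : ∀ q → q ≢ p → tr₁ (2 ℕ.^ H ℕ.+ q) ≡ tr₀ (2 ℕ.^ H ℕ.+ q)
    off q q≢p = ↦-off tr₀ _ λ eq →
      q≢p (≡.sym (ℕ.+-cancelˡ-≡ (2 ℕ.^ H) p q (≡.trans (≡.sym n₀≡) eq)))
    excepted : TreeExcept ℕ.⌊ n₀ /2⌋ H tr₁
    -- Writing to node n₀ affects only n₀ and its parent.
    excepted k 1≤k k<2^H = node-untouched (tree k 1≤k k<2^H) λ n₀≡k → ℕ.<⇒≱ k<2^H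
      (≡.subst (2 ℕ.^ H ℕ.≤_) (≡.trans (≡.sym n₀≡) n₀≡k) (ℕ.m≤m+n _ p))
    step : ∀ r s′ → Inv r s′ → (⟦ litᴺ 2 ≤ᴺ % nodeA ⟧ᴮ s′ ≡ false × Updated H p s s′) ⊎
      (⟦ litᴺ 2 ≤ᴺ % nodeA ⟧ᴮ s′ ≡ true × ∃[ r′ ] r ≡ suc r′ × Run _ s′ 41 (Inv r′))
    step r s′ (r<H , fr , 1≤j , j<2^ , ok , at , off) with 2 ℕ.≤? ints s′ nodeA 0
    ... | no 2≰j = inj₁ (dec-false (2 ℕ.≤? ints s′ nodeA 0) 2≰j , record
      { framed = fr ; leaf-p = at ; leaf-q = off
      -- At node 1 the exempt parent is 0, which is no node, so the whole tree is in order.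
      ; tree = λ k 1≤k k<2^H → ok k 1≤k k<2^H λ k≡ → ℕ.<⇒≢ 1≤k
          (≡.sym (≡.trans k≡ (≡.cong ℕ.⌊_/2⌋ (ℕ.≤-antisym (ℕ.s≤s⁻¹ (ℕ.≰⇒> 2≰j)) 1≤j)))) })
    step zero    s′ (r<H , fr , 1≤j , j<2 , ok , at , off) | yes 2≤j = contradiction 2≤j (ℕ.<⇒≱ j<2)
    step (suc r) s′ (r<H , fr , 1≤j , j<2^ , ok , at , off) | yes 2≤j = inj₂
      (dec-true (2 ℕ.≤? ints s′ nodeA 0) 2≤j , r , ≡.refl ,
        run-writeᴺ-⨾ (run-branch
          (λ le → run-writeᴿ (write (does-true (_ ≤? _) le) ≤-refl (inj₂ ≡.refl)))
          (λ gt → run-writeᴿ (write ≤-refl (≰⇒≥ (does-false (_ ≤? _) gt)) (inj₁ ≡.refl)))))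
      where
      h : ℕ
      h = ℕ.⌊ ints s′ nodeA 0 /2⌋
      tr : ℕ → Carrier
      tr = reals s′ treeA
      1≤h : 1 ℕ.≤ h
      1≤h = 1≤half 2≤j
      h<2^H : h ℕ.< 2 ℕ.^ H
      h<2^H = ℕ.<-≤-trans (half<2^ (suc r) j<2^) (ℕ.^-monoʳ-≤ 2 r<H)
      write : ∀ {y} → tr (h ℕ.+ h) ≤ y → tr (h ℕ.+ h ℕ.+ 1) ≤ y →
        y ≡ tr (h ℕ.+ h) ⊎ y ≡ tr (h ℕ.+ h ℕ.+ 1) → Inv r (setᴿ (setᴺ s′ nodeA 0 h) treeA h y)
      write {y} le le′ att =
        ℕ.<⇒≤ r<H , frame-setᴿ treeA h y ≡.refl (frame-setᴺ nodeA 0 h ≡.refl fr) ,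
        1≤h , half<2^ (suc r) j<2^ , ok′ ,
        ≡.trans (leaf p) at , λ q q≢p → ≡.trans (leaf q) (off q q≢p)
        where
        ok′ : TreeExcept ℕ.⌊ h /2⌋ H (tr [ h ↦ y ])
        ok′ k 1≤k k< k≢ with h ℕ.≟ k
        ... | yes ≡.refl = node-refreshed 1≤h le le′ att
        ... | no h≢k = node-untouched (ok k 1≤k k< λ eq → h≢k (≡.sym eq)) h≢k k≢
        leaf : ∀ q → (tr [ h ↦ y ]) (2 ℕ.^ H ℕ.+ q) ≡ tr (2 ℕ.^ H ℕ.+ q)
        leaf q = ↦-off tr y (ℕ.<⇒≢ (ℕ.<-≤-trans h<2^H (ℕ.m≤m+n _ q)))

  record FoundFirst (H : ℕ) (s s′ : State) : Set (c ⊔ ℓ₂) where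
    field
      framed : Frame (nodeA ∷ posA ∷ []) [] s s′
      pos<   : ints s′ posA 0 ℕ.< 2 ℕ.^ H
      fits   : reals s keyA 0 ≤ reals s treeA (2 ℕ.^ H ℕ.+ ints s′ posA 0)
      least  : ∀ q → q ℕ.< ints s′ posA 0 → ¬ reals s keyA 0 ≤ reals s treeA (2 ℕ.^ H ℕ.+ q)

  -- Invariant: the current node reaches the key and no node to its left on the same level does. A
  -- node further left on the next level has its parent further left, and that parent bounds it. By
  -- `attain`, one child of the current node reaches the key.
  run-findFirst : ∀ {s} H → ints s widthA 0 ≡ 2 ℕ.^ H → Tree H (reals s treeA) →
    reals s keyA 0 ≤ reals s treeA 1 → Run findFirst s (findCost H) (FoundFirst H s)
  run-findFirst {s} H w≡ tree x≤root =
    run-writeᴺ-⨾ (run-while Inv step H (setᴺ s nodeA 0 1)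
      (0 , ≡.refl , frame-setᴺ nodeA 0 1 ≡.refl frame-refl , ℕ.≤-refl , ℕ.≤-refl , x≤root ,
       λ k 1≤k k<1 → contradiction 1≤k (ℕ.<⇒≱ k<1))
    >> λ {s′} (fr , p , p< , j≡ , x≤ , least) → run-writeᴺ
      let pos≡ : ints s′ nodeA 0 ℕ.∸ ints s′ widthA 0 ≡ p
          pos≡ = ≡.trans (≡.cong₂ ℕ._∸_ j≡ (≡.trans (≡.cong (λ f → f 0) (ints-≡ fr widthA ≡.refl)) w≡))
            (ℕ.m+n∸m≡n (2 ℕ.^ H) p)
      in record
      { framed = frame-setᴺ posA 0 _ ≡.refl (frame-⊆ ≡.refl ≡.refl fr)
      ; pos<   = ≡.subst (ℕ._< 2 ℕ.^ H) (≡.sym pos≡) p<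
      ; fits   = ≡.subst (λ q → x ≤ tr (2 ℕ.^ H ℕ.+ q)) (≡.sym pos≡) x≤
      ; least  = λ q q< → least q (≡.subst (q ℕ.<_) pos≡ q<)
      })
    where
    x : Carrier
    x = reals s keyA 0
    tr : ℕ → Carrier
    tr = reals s treeA
    Inv : ℕ → State → Set (c ⊔ ℓ₂)
    Inv r s′ = ∃[ e ] e ℕ.+ r ≡ H × Frame (nodeA ∷ []) [] s s′ ×
      2 ℕ.^ e ℕ.≤ ints s′ nodeA 0 × ints s′ nodeA 0 ℕ.< 2 ℕ.^ suc e ×
      x ≤ tr (ints s′ nodeA 0) × (∀ k → 2 ℕ.^ e ℕ.≤ k → k ℕ.< ints s′ nodeA 0 → ¬ x ≤ tr k)
    Found : State → Set (c ⊔ ℓ₂)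
    Found s′ = Frame (nodeA ∷ []) [] s s′ × ∃[ p ] p ℕ.< 2 ℕ.^ H × ints s′ nodeA 0 ≡ 2 ℕ.^ H ℕ.+ p ×
      x ≤ tr (2 ℕ.^ H ℕ.+ p) × (∀ q → q ℕ.< p → ¬ x ≤ tr (2 ℕ.^ H ℕ.+ q))
    W≡ : ∀ {s′} → Frame (nodeA ∷ []) [] s s′ → ints s′ widthA 0 ≡ 2 ℕ.^ H
    W≡ fr = ≡.trans (≡.cong (λ f → f 0) (ints-≡ fr widthA ≡.refl)) w≡
    2^suc : ∀ e → 2 ℕ.^ suc e ≡ 2 ℕ.^ e ℕ.+ 2 ℕ.^ e
    2^suc e = ≡.cong (2 ℕ.^ e ℕ.+_) (ℕ.+-identityʳ _)
    step : ∀ r s′ → Inv r s′ → (⟦ notᴮ (% widthA ≤ᴺ % nodeA) ⟧ᴮ s′ ≡ false × Found s′) ⊎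
      (⟦ notᴮ (% widthA ≤ᴺ % nodeA) ⟧ᴮ s′ ≡ true × ∃[ r′ ] r ≡ suc r′ × Run _ s′ 21 (Inv r′))
    step zero s′ (e , e+0≡H , fr , le , lt , x≤ , least)
      with ≡.trans (≡.sym (ℕ.+-identityʳ e)) e+0≡H
    ... | ≡.refl = inj₁
      ( ≡.cong not (dec-true (_ ℕ.≤? ints s′ nodeA 0) (ℕ.≤-trans (ℕ.≤-reflexive (W≡ fr)) le))
      , fr , ints s′ nodeA 0 ℕ.∸ 2 ℕ.^ H
      , ℕ.+-cancelˡ-< (2 ℕ.^ H) _ _ (≡.subst₂ ℕ._<_ j≡ (2^suc H) lt)
      , j≡ , ≡.subst (λ j → x ≤ tr j) j≡ x≤
      , λ q q< → least _ (ℕ.m≤m+n _ q)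
          (≡.subst (2 ℕ.^ H ℕ.+ q ℕ.<_) (≡.sym j≡) (ℕ.+-monoʳ-< (2 ℕ.^ H) q<)) )
      where
      j≡ : ints s′ nodeA 0 ≡ 2 ℕ.^ H ℕ.+ (ints s′ nodeA 0 ℕ.∸ 2 ℕ.^ H)
      j≡ = ≡.sym (ℕ.m+[n∸m]≡n le)
    step (suc r) s′ (e , e+r≡H , fr , le , lt , x≤ , least) = inj₂
      ( ≡.cong not (dec-false (_ ℕ.≤? ints s′ nodeA 0) λ W≤j → ℕ.<⇒≱ j<2^H
          (ℕ.≤-trans (ℕ.≤-reflexive (≡.sym (W≡ fr))) W≤j))
      , r , ≡.refl
      , run-writeᴺ-⨾ (run-branch
          (λ x≤l → run-skip (suc e , e+r≡H′ , frame-setᴺ nodeA 0 (j ℕ.+ j) ≡.refl fr ,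
            j+j≥ , ℕ.≤-<-trans (ℕ.m≤m+n _ 1) j+j+1< ,
            ≡.subst₂ _≤_ x≡ (≡.cong (λ f → f (j ℕ.+ j)) tr≡) (does-true (_ ≤? _) x≤l) , least₁))
          (λ x≰l → let x≰ = λ le → does-false (_ ≤? _) x≰l
                             (≡.subst₂ _≤_ (≡.sym x≡) (≡.sym (≡.cong (λ f → f (j ℕ.+ j)) tr≡)) le)
            in run-writeᴺ (suc e , e+r≡H′ ,
              frame-setᴺ nodeA 0 (j ℕ.+ j ℕ.+ 1) ≡.refl (frame-setᴺ nodeA 0 (j ℕ.+ j) ≡.refl fr) ,
              ℕ.≤-trans j+j≥ (ℕ.m≤m+n _ 1) , j+j+1< , right x≰ , least₂ x≰))) )
      where
      j : ℕ
      j = ints s′ nodeA 0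
      tr≡ : reals s′ treeA ≡ tr
      tr≡ = reals-≡ fr treeA ≡.refl
      x≡ : reals s′ keyA 0 ≡ x
      x≡ = ≡.cong (λ f → f 0) (reals-≡ fr keyA ≡.refl)
      e+r≡H′ : suc e ℕ.+ r ≡ H
      e+r≡H′ = ≡.trans (≡.sym (ℕ.+-suc e r)) e+r≡H
      e<H : e ℕ.< H
      e<H = ≡.subst (e ℕ.<_) e+r≡H (ℕ.m<m+n e (ℕ.s≤s ℕ.z≤n))
      j<2^H : j ℕ.< 2 ℕ.^ H
      j<2^H = ℕ.<-≤-trans lt (ℕ.^-monoʳ-≤ 2 e<H)
      ok : NodeOK tr j
      ok = tree j (ℕ.≤-trans (ℕ.m^n>0 2 e) le) j<2^H
      j+j≥ : 2 ℕ.^ suc e ℕ.≤ j ℕ.+ j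
      j+j≥ = ≡.subst (ℕ._≤ j ℕ.+ j) (≡.sym (2^suc e)) (ℕ.+-mono-≤ le le)
      j+j+1< : j ℕ.+ j ℕ.+ 1 ℕ.< 2 ℕ.^ suc (suc e)
      j+j+1< = k+k<2^ (suc e) lt
      least₁ : ∀ k → 2 ℕ.^ suc e ℕ.≤ k → k ℕ.< j ℕ.+ j → ¬ x ≤ tr k
      least₁ k k≥ k< x≤trk = least ℕ.⌊ k /2⌋ h≥ h<
        (≤-trans x≤trk (node≤parent H tree k (ℕ.≤-trans (ℕ.*-monoʳ-≤ 2 (ℕ.m^n>0 2 e)) k≥)
          (ℕ.<-trans k< (ℕ.≤-<-trans (ℕ.m≤m+n _ 1)
            (ℕ.<-≤-trans j+j+1< (ℕ.^-monoʳ-≤ 2 (ℕ.s≤s e<H)))))))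
        where
        h≥ : 2 ℕ.^ e ℕ.≤ ℕ.⌊ k /2⌋
        h≥ = ≡.subst (ℕ._≤ ℕ.⌊ k /2⌋) (half-double (2 ℕ.^ e))
          (ℕ.⌊n/2⌋-mono (ℕ.≤-trans (ℕ.≤-reflexive (≡.sym (2^suc e))) k≥))
        h< : ℕ.⌊ k /2⌋ ℕ.< j
        h< = ℕ.≰⇒> λ j≤h → ℕ.<⇒≱ k< (ℕ.≤-trans (ℕ.+-mono-≤ j≤h j≤h)
          ([ (λ eq → ℕ.≤-reflexive (≡.sym eq)) ,
             (λ eq → ℕ.≤-trans (ℕ.m≤m+n _ 1) (ℕ.≤-reflexive (≡.sym eq))) ]′ (halves k)))
      right : ¬ x ≤ tr (j ℕ.+ j) → x ≤ tr (j ℕ.+ j ℕ.+ 1)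
      right x≰ with attain ok
      ... | inj₁ eq = contradiction (≡.subst (x ≤_) eq x≤) x≰
      ... | inj₂ eq = ≡.subst (x ≤_) eq x≤
      least₂ : ¬ x ≤ tr (j ℕ.+ j) → ∀ k → 2 ℕ.^ suc e ℕ.≤ k → k ℕ.< j ℕ.+ j ℕ.+ 1 → ¬ x ≤ tr k
      least₂ x≰ k k≥ k< with ℕ.m≤n⇒m<n∨m≡n (ℕ.s≤s⁻¹ (≡.subst (k ℕ.<_) (ℕ.+-comm (j ℕ.+ j) 1) k<))
      ... | inj₁ k<j+j  = least₁ k k≥ k<j+j
      ... | inj₂ ≡.refl = x≰

-- Clearing the tree, filling it and sorting with it

n<2^[1+⌊log₂n⌋] : ∀ n → n ℕ.< 2 ℕ.^ suc ⌊log₂ n ⌋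
n<2^[1+⌊log₂n⌋] = <-rec _ bound
  where
  bound : ∀ n → (∀ {k} → k ℕ.< n → k ℕ.< 2 ℕ.^ suc ⌊log₂ k ⌋) → n ℕ.< 2 ℕ.^ suc ⌊log₂ n ⌋
  bound zero          rec = ℕ.m^n>0 2 (suc ⌊log₂ 0 ⌋)
  bound (suc zero)    rec = ℕ.s≤s (ℕ.s≤s ℕ.z≤n)
  bound n@(suc (suc k)) rec = ℕ.≤-<-trans n≤ (≡.subst (λ e → h ℕ.+ h ℕ.+ 1 ℕ.< 2 ℕ.^ suc e) log≡
    (k+k<2^ (suc ⌊log₂ h ⌋) (rec (ℕ.⌊n/2⌋<n (suc k)))))
    where
    h : ℕ
    h = ℕ.⌊ n /2⌋
    log≡ : suc ⌊log₂ h ⌋ ≡ ⌊log₂ n ⌋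
    log≡ = ≡.trans (≡.cong suc (⌊log₂⌊n/2⌋⌋≡⌊log₂n⌋∸1 n))
      (ℕ.m+[n∸m]≡n (⌊log₂⌋-mono-≤ {2} {n} (ℕ.s≤s (ℕ.s≤s ℕ.z≤n))))
    n≤ : n ℕ.≤ h ℕ.+ h ℕ.+ 1
    n≤ = [ (λ eq → ℕ.≤-trans (ℕ.≤-reflexive eq) (ℕ.m≤m+n _ 1)) , ℕ.≤-reflexive ]′ (halves n)

search-⊎ : ∀ {a b} {A : ℕ → Set a} {B : ℕ → Set b} N → (∀ x → x ℕ.< N → A x ⊎ B x) →
  (∃[ x ] x ℕ.< N × A x) ⊎ (∀ x → x ℕ.< N → B x)
search-⊎ zero    dec = inj₂ λ _ ()
search-⊎ (suc N) dec with search-⊎ N (λ x x<N → dec x (ℕ.m<n⇒m<1+n x<N)) | dec N ℕ.≤-refl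
... | inj₁ (x , x<N , Ax) | _      = inj₁ (x , ℕ.m<n⇒m<1+n x<N , Ax)
... | inj₂ _              | inj₁ A = inj₁ (N , ℕ.≤-refl , A)
... | inj₂ all            | inj₂ B = inj₂ λ x x<1+N →
  [ all x , (λ { ≡.refl → B }) ]′ (ℕ.m<1+n⇒m<n∨m≡n x<1+N)

-- By the pigeonhole principle two of the `N` values would share a preimage and so coincide.
not-all-hit : ∀ {k N} (π : ℕ → ℕ) → k ℕ.< N → ¬ (∀ x → x ℕ.< N → ∃[ i ] i ℕ.< k × π i ≡ x)
not-all-hit {k} {N} π k<N hit with pigeonhole k<N (λ x → fromℕ< (proj₁ (proj₂ (hit (toℕ x) (toℕ<n x)))))
... | x , y , x<y , eq = ℕ.<⇒≢ x<y (≡.trans (≡.sym (proj₂ (proj₂ (hit _ (toℕ<n x)))))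
  (≡.trans (≡.cong π (fromℕ<-injective _ _ _ _ eq)) (proj₂ (proj₂ (hit _ (toℕ<n y))))))

-- A missed value `x`, added to the `N` values of `π`, would give `N + 1` distinct elements of
-- `Fin N`.
injective⇒hit : ∀ N (π : ℕ → ℕ) → (∀ i → i ℕ.< N → π i ℕ.< N) →
  (∀ i j → i ℕ.< N → j ℕ.< N → π i ≡ π j → i ≡ j) →
  ∀ x → x ℕ.< N → ¬ (∀ i → i ℕ.< N → π i ≢ x)
injective⇒hit N π π< inj x x<N miss with pigeonhole ℕ.≤-refl f
  where
  f : Fin (suc N) → Fin N
  f zero    = fromℕ< x<N
  f (suc i) = fromℕ< (π< (toℕ i) (toℕ<n i))
... | zero  , suc j , _ , eq = miss (toℕ j) (toℕ<n j) (≡.sym (fromℕ<-injective _ _ _ _ eq))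
... | suc i , suc j , i<j , eq =
  ℕ.<⇒≢ (ℕ.s≤s⁻¹ i<j) (inj (toℕ i) (toℕ j) (toℕ<n i) (toℕ<n j) (fromℕ<-injective _ _ _ _ eq))

clearCost : ℕ → ℕ → ℕ
clearCost e N = 2 ℕ.+ e ℕ.+ (3 ℕ.+ (suc (suc ⌊log₂ N ⌋) ℕ.* 14 ℕ.+
  (3 ℕ.+ suc (N ℕ.+ N ℕ.+ 1 ℕ.+ (N ℕ.+ N ℕ.+ 1)) ℕ.* 20)))

setLeavesCost : ℕ → ℕ → ℕ → ℕ
setLeavesCost N H K = 3 ℕ.+ suc N ℕ.* (7 ℕ.+ (K ℕ.+ (4 ℕ.+ updateCost H) ℕ.+ 6))

selectionSortCost : ℕ → ℕ → ℕ
selectionSortCost N H =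
  3 ℕ.+ suc N ℕ.* (7 ℕ.+ (4 ℕ.+ (findCost H ℕ.+ (5 ℕ.+ (3 ℕ.+ updateCost H))) ℕ.+ 6))

module TreePrograms {c ℓ₁ ℓ₂} (F : OrderedField c ℓ₁ ℓ₂) where
  open OrderedField F hiding (zero; sum)
  open OrderedFieldProperties F
  open Runs F
  open ForEach F
  open Trees F

  leaf : ℕ → State → ℕ → Carrier
  leaf H s q = reals s treeA (2 ℕ.^ H ℕ.+ q)

  record Sized (N H : ℕ) (s : State) : Set where
    constructor sized
    field
      size≡  : ints s sizeA 0 ≡ N
      width≡ : ints s widthA 0 ≡ 2 ℕ.^ H
      fits   : N ℕ.≤ 2 ℕ.^ H
  open Sized public

  sized-frame : ∀ {is rs N H s s′} → sizeA ∈ᵇ is ≡ false → widthA ∈ᵇ is ≡ false →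
    Frame is rs s s′ → Sized N H s → Sized N H s′
  sized-frame size∉ width∉ fr (sized e e′ le) = sized
    (≡.trans (≡.cong (λ f → f 0) (ints-≡ fr sizeA size∉)) e)
    (≡.trans (≡.cong (λ f → f 0) (ints-≡ fr widthA width∉)) e′) le

  record Cleared (N : ℕ) (s s′ : State) : Set (c ⊔ ℓ₂) where
    field
      height  : ℕ
      height≤ : height ℕ.≤ suc ⌊log₂ N ⌋
      framed  : Frame (sizeA ∷ widthA ∷ indexA ∷ []) (treeA ∷ []) s s′
      size    : Sized N height s′
      tree    : Tree height (reals s′ treeA)
      empty   : ∀ q → q ℕ.< 2 ℕ.^ height → leaf height s′ q ≡ 0#

  -- The invariant keeps the width at most 2N + 1, which makes clearing linear in `N`. The summand 1
  -- is for `N = 0`, where the width is still 1.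
  run-clearTree : ∀ {s} e N → ⟦ e ⟧ᴺ s ≡ N → Run (clearTree e) s (clearCost (costᴺ e) N) (Cleared N s)
  run-clearTree {s} e N e≡ =
    run-writeᴺ-⨾ (run-writeᴺ-⨾ (run-while Inv step B (setᴺ (setᴺ s sizeA 0 (⟦ e ⟧ᴺ s)) widthA 0 1)
      (0 , ≡.refl , frame-setᴺ widthA 0 1 ≡.refl (frame-setᴺ sizeA 0 _ ≡.refl frame-refl) , e≡ ,
       ≡.refl , ℕ.m≤n+m 1 (N ℕ.+ N))
    >> λ {s₁} (h , h≤B , fr , size≡ , width≡ , 2^h≤ , N≤) → run-mono (reset≤ 2^h≤) (λ _ q → q)
      (reset h h≤B s₁ fr (sized size≡ width≡ N≤))))
    where
    B : ℕ
    B = suc ⌊log₂ N ⌋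
    Inv : ℕ → State → Set c
    Inv r s′ = ∃[ h ] h ℕ.+ r ≡ B × Frame (sizeA ∷ widthA ∷ []) [] s s′ ×
      ints s′ sizeA 0 ≡ N × ints s′ widthA 0 ≡ 2 ℕ.^ h × 2 ℕ.^ h ℕ.≤ N ℕ.+ N ℕ.+ 1
    Done : State → Set c
    Done s′ = ∃[ h ] h ℕ.≤ B × Frame (sizeA ∷ widthA ∷ []) [] s s′ ×
      ints s′ sizeA 0 ≡ N × ints s′ widthA 0 ≡ 2 ℕ.^ h × 2 ℕ.^ h ℕ.≤ N ℕ.+ N ℕ.+ 1 × N ℕ.≤ 2 ℕ.^ h
    step : ∀ r s′ → Inv r s′ → (⟦ notᴮ (% sizeA ≤ᴺ % widthA) ⟧ᴮ s′ ≡ false × Done s′) ⊎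
      (⟦ notᴮ (% sizeA ≤ᴺ % widthA) ⟧ᴮ s′ ≡ true × ∃[ r′ ] r ≡ suc r′ × Run _ s′ 7 (Inv r′))
    step r s′ (h , h+r≡B , fr , size≡ , width≡ , 2^h≤) with N ℕ.≤? 2 ℕ.^ h
    ... | yes N≤ = inj₁
      ( ≡.cong not (dec-true (_ ℕ.≤? ints s′ widthA 0) (≡.subst₂ ℕ._≤_ (≡.sym size≡) (≡.sym width≡) N≤))
      , h , ≡.subst (h ℕ.≤_) h+r≡B (ℕ.m≤m+n h r) , fr , size≡ , width≡ , 2^h≤ , N≤)
    step zero s′ (h , h+0≡B , _) | no N≰ = contradiction
      (≡.subst (λ e → N ℕ.≤ 2 ℕ.^ e) (≡.trans (≡.sym h+0≡B) (ℕ.+-identityʳ h)) (ℕ.<⇒≤ (n<2^[1+⌊log₂n⌋] N))) N≰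
    step (suc r) s′ (h , h+r≡B , fr , size≡ , width≡ , 2^h≤) | no N≰ = inj₂
      ( ≡.cong not (dec-false (_ ℕ.≤? ints s′ widthA 0) (λ le → N≰ (≡.subst₂ ℕ._≤_ size≡ width≡ le)))
      , r , ≡.refl
      , run-writeᴺ (suc h , ≡.trans (≡.sym (ℕ.+-suc h r)) h+r≡B , frame-setᴺ widthA 0 _ ≡.refl fr , size≡ ,
          ≡.trans (≡.cong₂ ℕ._+_ width≡ width≡) (≡.sym 2^suc) ,
          ≡.subst (ℕ._≤ N ℕ.+ N ℕ.+ 1) (≡.sym 2^suc)
            (ℕ.≤-trans (ℕ.+-mono-≤ (ℕ.<⇒≤ 2^h<N) (ℕ.<⇒≤ 2^h<N)) (ℕ.m≤m+n _ 1))) )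
      where
      2^h<N : 2 ℕ.^ h ℕ.< N
      2^h<N = ℕ.≰⇒> N≰
      2^suc : 2 ℕ.^ suc h ≡ 2 ℕ.^ h ℕ.+ 2 ℕ.^ h
      2^suc = ≡.cong (2 ℕ.^ h ℕ.+_) (ℕ.+-identityʳ _)
    reset≤ : ∀ {w} → w ℕ.≤ N ℕ.+ N ℕ.+ 1 → 3 ℕ.+ suc (w ℕ.+ w) ℕ.* 20 ℕ.≤
      3 ℕ.+ suc (N ℕ.+ N ℕ.+ 1 ℕ.+ (N ℕ.+ N ℕ.+ 1)) ℕ.* 20
    reset≤ w≤ = ℕ.+-monoʳ-≤ 3 (ℕ.*-monoˡ-≤ 20 (ℕ.s≤s (ℕ.+-mono-≤ w≤ w≤)))
    reset : ∀ h → h ℕ.≤ B → ∀ s₁ → Frame (sizeA ∷ widthA ∷ []) [] s s₁ → Sized N h s₁ →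
      Run (forEach (% widthA +ᴺ % widthA) (writeᴿ treeA (% indexA) 0ᴿ)) s₁ (3 ℕ.+ suc (2 ℕ.^ h ℕ.+ 2 ℕ.^ h) ℕ.* 20) (Cleared N s)
    reset h h≤B s₁ fr sz = run-map (λ s′ (fr′ , zeros) → record
      { height = h ; height≤ = h≤B
      ; framed = frame-trans (frame-⊆ ≡.refl ≡.refl fr) (frame-⊆ ≡.refl ≡.refl fr′)
      ; size   = sized-frame ≡.refl ≡.refl fr′ sz
      ; tree   = λ k _ k< → zero-ok zeros k (≡.subst (k ℕ.+ k ℕ.+ 1 ℕ.<_) (≡.cong (2 ℕ.^ h ℕ.+_) (ℕ.+-identityʳ _)) (k+k<2^ h k<))
      ; empty  = λ q q< → zeros _ (ℕ.+-monoʳ-< (2 ℕ.^ h) q<) })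
      (run-forEach {e = % widthA +ᴺ % widthA} (2 ℕ.^ h ℕ.+ 2 ℕ.^ h) Zeros s₁
        (λ k s′ (fr′ , _) → let w≡ = width≡ (sized-frame {H = h} ≡.refl ≡.refl fr′ sz) in ≡.cong₂ ℕ._+_ w≡ w≡)
        (λ { k s′ k< ≡.refl (fr′ , zeros) → run-writeᴿ (≡.refl ,
             frame-setᴺ indexA 0 _ ≡.refl (frame-setᴿ treeA k 0# ≡.refl fr′) ,
             extend (reals s′ treeA) k zeros) })
        (frame-setᴺ indexA 0 0 ≡.refl frame-refl , λ _ ()))
      where
      Zeros : ℕ → State → Set c
      Zeros k s′ = Frame (indexA ∷ []) (treeA ∷ []) s₁ s′ × (∀ j → j ℕ.< k → reals s′ treeA j ≡ 0#)
      extend : ∀ tr k → (∀ j → j ℕ.< k → tr j ≡ 0#) → ∀ j → j ℕ.< suc k → (tr [ k ↦ 0# ]) j ≡ 0#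
      extend tr k zeros j j<1+k with ℕ.m<1+n⇒m<n∨m≡n j<1+k
      ... | inj₁ j<k    = ≡.trans (↦-off tr 0# (ℕ.>⇒≢ j<k)) (zeros j j<k)
      ... | inj₂ ≡.refl = ↦-at tr k 0#
      zero-ok : ∀ {tr M} → (∀ j → j ℕ.< M → tr j ≡ 0#) → ∀ k → k ℕ.+ k ℕ.+ 1 ℕ.< M → NodeOK tr k
      zero-ok {tr} {M} zeros k k< = node-ok
        (≡⇒≤ (≡.trans l≡ (≡.sym k≡))) (≡⇒≤ (≡.trans (zeros _ k<) (≡.sym k≡)))
        (inj₁ (≡.trans k≡ (≡.sym l≡)))
        where
        l≡ : tr (k ℕ.+ k) ≡ 0#
        l≡ = zeros _ (ℕ.≤-<-trans (ℕ.m≤m+n _ 1) k<)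
        k≡ : tr k ≡ 0#
        k≡ = zeros _ (ℕ.≤-<-trans (ℕ.≤-trans (ℕ.m≤m+n k k) (ℕ.m≤m+n _ 1)) k<)

  record LeavesSet {a} (N H : ℕ) (P : ℕ → Carrier → Set a) (s s′ : State) : Set (c ⊔ ℓ₂ ⊔ a) where
    field
      framed : Frame (indexA ∷ posA ∷ nodeA ∷ []) (treeA ∷ keyA ∷ []) s s′
      tree   : Tree H (reals s′ treeA)
      set    : ∀ i → i ℕ.< N → P i (leaf H s′ i)
      unset  : ∀ i → N ℕ.≤ i → leaf H s′ i ≡ leaf H s i

  -- Keys are specified by a relation `P`, since the minimum stored in a leaf by an attempt is
  -- characterised by its order properties and not by an equation.
  run-setLeaves : ∀ {a s key K N H} (P : ℕ → Carrier → Set a) → Sized N H s → Tree H (reals s treeA) →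
    (∀ i s₁ → i ℕ.< N → Frame (indexA ∷ posA ∷ nodeA ∷ []) (treeA ∷ keyA ∷ []) s s₁ → ints s₁ indexA 0 ≡ i →
      Run key s₁ K (λ s₂ → Frame [] (keyA ∷ []) s₁ s₂ × P i (reals s₂ keyA 0))) →
    Run (setLeaves key) s (setLeavesCost N H K) (LeavesSet N H P s)
  run-setLeaves {s = s} {key} {K} {N} {H} P sz tree₀ run-key =
    run-map (λ s′ (fr , tree , set , unset) → record
      { framed = fr ; tree = tree ; set = set ; unset = unset })
    (run-forEach {e = % sizeA} N Inv s
      (λ k s′ (fr , _) → size≡ (sized-frame {H = H} ≡.refl ≡.refl fr sz))
      body
      (frame-setᴺ indexA 0 0 ≡.refl frame-refl , tree₀ , (λ _ ()) , λ _ _ → ≡.refl))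
    where
    Inv : ℕ → State → Set _
    Inv k s′ = Frame (indexA ∷ posA ∷ nodeA ∷ []) (treeA ∷ keyA ∷ []) s s′ × Tree H (reals s′ treeA) ×
      (∀ i → i ℕ.< k → P i (leaf H s′ i)) × (∀ i → k ℕ.≤ i → leaf H s′ i ≡ leaf H s i)
    body : ∀ k s₁ → k ℕ.< N → ints s₁ indexA 0 ≡ k → Inv k s₁ →
      Run (key ⨾ (posA ≔ᴺ % indexA) ⨾ update) s₁ (K ℕ.+ (4 ℕ.+ updateCost H))
        (λ s′ → ints s′ indexA 0 ≡ k × Inv (suc k) (next s′))
    body k s₁ k<N i≡k (fr₁ , tree₁ , set₁ , unset₁) =
      run-key k s₁ k<N fr₁ i≡k >> λ {s₂} (fr₂ , Pk) → run-writeᴺ-⨾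
        (let i≡ : ints s₂ indexA 0 ≡ k
             i≡ = ≡.trans (≡.cong (λ f → f 0) (ints-≡ fr₂ indexA ≡.refl)) i≡k
             fr′ = frame-trans fr₁ (frame-⊆ ≡.refl ≡.refl fr₂)
             tree≡ = reals-≡ fr₂ treeA ≡.refl
         in run-map (λ s₃ u → let open Updated u in
           ≡.trans (≡.cong (λ f → f 0) (ints-≡ framed indexA ≡.refl)) i≡ ,
           frame-setᴺ indexA 0 _ ≡.refl
             (frame-trans fr′ (frame-trans (frame-setᴺ posA 0 _ ≡.refl frame-refl) (frame-⊆ ≡.refl ≡.refl framed))) ,
           tree ,
           (λ i i<1+k → [ (λ i<k → ≡.subst (P i)
               (≡.sym (≡.trans (leaf-q i (ℕ.<⇒≢ i<k)) (≡.cong (λ f → f (2 ℕ.^ H ℕ.+ i)) tree≡))) (set₁ i i<k)) ,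
             (λ { ≡.refl → ≡.subst (P k) (≡.sym leaf-p) Pk }) ]′ (ℕ.m<1+n⇒m<n∨m≡n i<1+k)) ,
           (λ i k<i → ≡.trans (leaf-q i (ℕ.>⇒≢ k<i))
             (≡.trans (≡.cong (λ f → f (2 ℕ.^ H ℕ.+ i)) tree≡) (unset₁ i (ℕ.<⇒≤ k<i)))))
         (run-update H k (width≡ (sized-frame {N = N} ≡.refl ≡.refl fr′ sz)) i≡ (ℕ.<-≤-trans k<N (fits sz))
           (≡.subst (Tree H) (≡.sym tree≡) tree₁)))

  module Selection (N H : ℕ) (N≤ : N ℕ.≤ 2 ℕ.^ H) (key : ℕ → Carrier)
    (key>0 : ∀ x → x ℕ.< N → Positive (key x)) where

    -- A leaf with value 0 is either removed or padding. The field `smaller` is what lets the next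
    -- maximum extend the decreasing sequence.
    record Selected (k : ℕ) (π : ℕ → ℕ) (lf : ℕ → Carrier) : Set (c ⊔ ℓ₂) where
      field
        bounded    : ∀ i → i ℕ.< k → π i ℕ.< N
        emptied    : ∀ i → i ℕ.< k → lf (π i) ≡ 0#
        injective  : ∀ i j → i ℕ.< k → j ℕ.< k → π i ≡ π j → i ≡ j
        waiting    : ∀ x → x ℕ.< N → lf x ≡ key x × (∀ i → i ℕ.< k → π i ≢ x) ⊎ (∃[ i ] i ℕ.< k × π i ≡ x)
        beyond     : ∀ x → N ℕ.≤ x → x ℕ.< 2 ℕ.^ H → lf x ≡ 0#
        decreasing : ∀ i j → i ℕ.≤ j → j ℕ.< k → key (π j) ≤ key (π i)
        smaller    : ∀ i → i ℕ.< k → ∀ x → x ℕ.< 2 ℕ.^ H → lf x ≤ key (π i)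

    nothing-selected : ∀ π lf → (∀ x → x ℕ.< N → lf x ≡ key x) →
      (∀ x → N ℕ.≤ x → x ℕ.< 2 ℕ.^ H → lf x ≡ 0#) → Selected 0 π lf
    nothing-selected π lf eq beyond = record
      { bounded = λ _ () ; emptied = λ _ () ; injective = λ _ _ () ; waiting = λ x x<N → inj₁ (eq x x<N , λ _ ())
      ; beyond = beyond ; decreasing = λ _ _ _ () ; smaller = λ _ () }

    -- With fewer than `N` items taken, some positive key is still in the tree. Hence the maximal
    -- leaf `q` is positive, so it is neither padding nor removed, and the item is new.
    select : ∀ {k π lf} π′ lf′ {q root} → k ℕ.< N → Selected k π lf → q ℕ.< 2 ℕ.^ H →
      (∀ x → x ℕ.< 2 ℕ.^ H → lf x ≤ root) → root ≤ lf q →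
      (∀ i → i ≢ k → π′ i ≡ π i) → π′ k ≡ q → (∀ x → x ≢ q → lf′ x ≡ lf x) → lf′ q ≡ 0# →
      Selected (suc k) π′ lf′
    select {k} {π} {lf} π′ lf′ {q} {root} k<N S q< ≤root root≤ π-old π-new lf-old lf-new = result (waiting-q)
      where
      open Selected S
      some-positive : ∃[ x ] x ℕ.< N × lf x ≡ key x × (∀ i → i ℕ.< k → π i ≢ x)
      some-positive with search-⊎ N waiting
      ... | inj₁ found = found
      ... | inj₂ all   = contradiction all (not-all-hit π k<N)
      lfq>0 : Positive (lf q)
      lfq>0 with some-positive
      ... | x , x<N , eq , _ = positive-≤ (key>0 x x<N) (≤-trans
        (≤-trans (≡⇒≤ (≡.sym eq)) (≤root x (ℕ.<-≤-trans x<N N≤))) root≤)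
      not-empty : lf q ≢ 0#
      not-empty eq = lfq>0 (≡⇒≤ eq)
      q<N : q ℕ.< N
      q<N = ℕ.≰⇒> λ N≤q → not-empty (beyond q N≤q q<)
      waiting-q : lf q ≡ key q × (∀ i → i ℕ.< k → π i ≢ q)
      waiting-q with waiting q q<N
      ... | inj₁ w = w
      ... | inj₂ (i , i<k , ≡.refl) = contradiction (emptied i i<k) not-empty
      old : ∀ {i} → i ℕ.< k → π′ i ≡ π i
      old i<k = π-old _ (ℕ.<⇒≢ i<k)
      lf′≤ : ∀ x {y} → 0# ≤ y → lf x ≤ y → lf′ x ≤ y
      lf′≤ x 0≤y le with x ℕ.≟ q
      ... | yes ≡.refl = ≤-trans (≡⇒≤ lf-new) 0≤y
      ... | no x≢q     = ≤-trans (≡⇒≤ (lf-old x x≢q)) le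
      result : lf q ≡ key q × (∀ i → i ℕ.< k → π i ≢ q) → Selected (suc k) π′ lf′
      result (lfq≡ , q-new) = record
        { bounded = λ i i< → [ (λ i<k → ≡.subst (ℕ._< N) (≡.sym (old i<k)) (bounded i i<k)) ,
            (λ { ≡.refl → ≡.subst (ℕ._< N) (≡.sym π-new) q<N }) ]′ (ℕ.m<1+n⇒m<n∨m≡n i<)
        ; emptied = λ i i< → [ (λ i<k → ≡.trans (≡.cong lf′ (old i<k))
              (≡.trans (lf-old (π i) (q-new i i<k)) (emptied i i<k))) ,
            (λ { ≡.refl → ≡.trans (≡.cong lf′ π-new) lf-new }) ]′ (ℕ.m<1+n⇒m<n∨m≡n i<)
        ; injective = inj′
        ; waiting = waiting′
        ; beyond = λ x N≤x x< → ≡.trans (lf-old x (λ { ≡.refl → ℕ.<⇒≱ q<N N≤x })) (beyond x N≤x x<)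
        ; decreasing = λ i j i≤j j< → decreasing′ i j i≤j (ℕ.m<1+n⇒m<n∨m≡n j<)
        ; smaller = λ i i< x x< → lf′≤ x (positive⇒≥0 (key′>0 i (ℕ.m<1+n⇒m<n∨m≡n i<)))
            ([ (λ i<k → ≤-trans (smaller i i<k x x<) (≡⇒≤ (≡.cong key (≡.sym (old i<k))))) ,
               (λ { ≡.refl → ≤-trans (≤root x x<) (≤-trans root≤
                  (≡⇒≤ (≡.trans lfq≡ (≡.cong key (≡.sym π-new))))) }) ]′ (ℕ.m<1+n⇒m<n∨m≡n i<))
        }
        where
        key′>0 : ∀ i → i ℕ.< k ⊎ i ≡ k → Positive (key (π′ i))
        key′>0 i (inj₁ i<k)    = ≡.subst (λ x → Positive (key x)) (≡.sym (old i<k)) (key>0 _ (bounded i i<k))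
        key′>0 i (inj₂ ≡.refl) = ≡.subst (λ x → Positive (key x)) (≡.sym π-new) (key>0 _ q<N)
        inj′ : ∀ i j → i ℕ.< suc k → j ℕ.< suc k → π′ i ≡ π′ j → i ≡ j
        inj′ i j i< j< eq with ℕ.m<1+n⇒m<n∨m≡n i< | ℕ.m<1+n⇒m<n∨m≡n j<
        ... | inj₁ i<k | inj₁ j<k =
          injective i j i<k j<k (≡.trans (≡.sym (old i<k)) (≡.trans eq (old j<k)))
        ... | inj₁ i<k | inj₂ ≡.refl = contradiction (≡.trans (≡.sym (old i<k)) (≡.trans eq π-new)) (q-new i i<k)
        ... | inj₂ ≡.refl | inj₁ j<k = contradiction (≡.trans (≡.sym (old j<k)) (≡.trans (≡.sym eq) π-new)) (q-new j j<k)
        ... | inj₂ i≡k | inj₂ j≡k = ≡.trans i≡k (≡.sym j≡k)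
        waiting′ : ∀ x → x ℕ.< N → lf′ x ≡ key x × (∀ i → i ℕ.< suc k → π′ i ≢ x) ⊎ (∃[ i ] i ℕ.< suc k × π′ i ≡ x)
        waiting′ x x<N with x ℕ.≟ q | waiting x x<N
        ... | yes ≡.refl | _ = inj₂ (k , ℕ.≤-refl , π-new)
        ... | no x≢q | inj₂ (i , i<k , eq) = inj₂ (i , ℕ.m<n⇒m<1+n i<k , ≡.trans (old i<k) eq)
        ... | no x≢q | inj₁ (eq , miss) = inj₁ (≡.trans (lf-old x x≢q) eq , λ i i< eq′ →
          [ (λ i<k → miss i i<k (≡.trans (≡.sym (old i<k)) eq′)) ,
            (λ { ≡.refl → x≢q (≡.trans (≡.sym eq′) π-new) }) ]′ (ℕ.m<1+n⇒m<n∨m≡n i<))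
        decreasing′ : ∀ i j → i ℕ.≤ j → j ℕ.< k ⊎ j ≡ k → key (π′ j) ≤ key (π′ i)
        decreasing′ i j i≤j (inj₁ j<k) = ≡.subst₂ _≤_
          (≡.cong key (≡.sym (old j<k))) (≡.cong key (≡.sym (old (ℕ.≤-<-trans i≤j j<k)))) (decreasing i j i≤j j<k)
        decreasing′ i j i≤j (inj₂ ≡.refl) with ℕ.m≤n⇒m<n∨m≡n i≤j
        ... | inj₂ ≡.refl = ≤-refl
        ... | inj₁ i<k = ≡.subst₂ _≤_
          (≡.trans lfq≡ (≡.cong key (≡.sym π-new))) (≡.cong key (≡.sym (old i<k))) (smaller i i<k q q<)

    all-selected : ∀ {π lf} → Selected N π lf → Permutation N π
    all-selected {π} S = record
      { bounded = bounded ; injective = injective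
      ; surjective = λ x x<N → [ (λ (_ , miss) → ⊥-elim (injective⇒hit N π bounded injective x x<N miss)) ,
          (λ hit → hit) ]′ (waiting x x<N) }
      where open Selected S

    record SortedBy (s s′ : State) : Set (c ⊔ ℓ₂) where
      field
        framed     : Frame (indexA ∷ posA ∷ nodeA ∷ orderA ∷ []) (treeA ∷ keyA ∷ []) s s′
        tree       : Tree H (reals s′ treeA)
        order      : Permutation N (ints s′ orderA)
        decreasing : ∀ i j → i ℕ.≤ j → j ℕ.< N →
          key (ints s′ orderA j) ≤ key (ints s′ orderA i)
        beyond     : ∀ x → N ℕ.≤ x → x ℕ.< 2 ℕ.^ H → leaf H s′ x ≡ 0#

    run-selectionSort : ∀ {s} → Sized N H s → Tree H (reals s treeA) →
      (∀ x → x ℕ.< N → leaf H s x ≡ key x) → (∀ x → N ℕ.≤ x → x ℕ.< 2 ℕ.^ H → leaf H s x ≡ 0#) →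
      Run selectionSort s (selectionSortCost N H) (SortedBy s)
    run-selectionSort {s} sz tree₀ leaves beyond₀ =
      run-map (λ s′ (fr , tree , S) → record
        { framed = fr ; tree = tree ; order = all-selected S
        ; decreasing = Selected.decreasing S ; beyond = Selected.beyond S })
      (run-forEach {e = % sizeA} N Inv s
        (λ k s′ (fr , _) → size≡ (sized-frame {H = H} ≡.refl ≡.refl fr sz))
        body
        (frame-setᴺ indexA 0 0 ≡.refl frame-refl , tree₀ , nothing-selected _ _ leaves beyond₀))
      where
      Is Rs : List ArrayName
      Is = indexA ∷ posA ∷ nodeA ∷ orderA ∷ []
      Rs = treeA ∷ keyA ∷ []
      Inv : ℕ → State → Set (c ⊔ ℓ₂)
      Inv k s′ = Frame Is Rs s s′ × Tree H (reals s′ treeA) × Selected k (ints s′ orderA) (leaf H s′)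
      body : ∀ k s₁ → k ℕ.< N → ints s₁ indexA 0 ≡ k → Inv k s₁ →
        Run _ s₁ (4 ℕ.+ (findCost H ℕ.+ (5 ℕ.+ (3 ℕ.+ updateCost H))))
          (λ s′ → ints s′ indexA 0 ≡ k × Inv (suc k) (next s′))
      body k s₁ k<N i≡k (fr₁ , tree₁ , S₁) = run-writeᴿ-⨾
        (run-findFirst H (width≡ (sized-frame {N = N} ≡.refl ≡.refl fr₁ sz)) tree₁ ≤-refl >> λ {s₃} found →
          let module Found = FoundFirst found
              fr₃ = frame-trans fr₁ (frame-trans (frame-setᴿ keyA 0 (reals s₁ treeA 1) ≡.refl frame-refl)
                      (frame-⊆ {is′ = Is} ≡.refl ≡.refl Found.framed))
              i≡ = ≡.trans (≡.cong (λ f → f 0) (ints-≡ Found.framed indexA ≡.refl)) i≡k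
              order≡ = ints-≡ Found.framed orderA ≡.refl
              tree≡ = reals-≡ Found.framed treeA ≡.refl
              q = ints s₃ posA 0
          in run-writeᴺ-⨾ (run-writeᴿ-⨾ (run-map (λ s₆ updated →
            let open Updated updated
                π′≡ : ints s₆ orderA ≡ ints s₃ orderA [ ints s₃ indexA 0 ↦ q ]
                π′≡ = ints-≡ framed orderA ≡.refl
            in ≡.trans (≡.cong (λ f → f 0) (ints-≡ framed indexA ≡.refl)) i≡ ,
              frame-setᴺ indexA 0 _ ≡.refl (frame-trans fr₃ (frame-trans
                (frame-setᴿ keyA 0 0# ≡.refl (frame-setᴺ orderA (ints s₃ indexA 0) q ≡.refl frame-refl))
                (frame-⊆ ≡.refl ≡.refl framed))) ,
              tree ,
              select (ints s₆ orderA) (leaf H s₆) {q} {reals s₁ treeA 1} k<N S₁ Found.pos<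
                (λ x x< → leaf≤root H tree₁ x x<) Found.fits
                (λ i i≢k → ≡.trans (≡.cong (λ f → f i) π′≡)
                  (≡.trans (↦-off (ints s₃ orderA) q (λ eq → i≢k (≡.trans (≡.sym eq) i≡)))
                    (≡.cong (λ f → f i) order≡)))
                (≡.trans (≡.cong (λ f → f k) π′≡)
                  (≡.trans (≡.cong (λ j → (ints s₃ orderA [ j ↦ q ]) k) i≡) (↦-at (ints s₃ orderA) k q)))
                (λ x x≢q → ≡.trans (leaf-q x x≢q) (≡.cong (λ f → f (2 ℕ.^ H ℕ.+ x)) tree≡))
                leaf-p)
            (run-update H q (width≡ (sized-frame {N = N} ≡.refl ≡.refl fr₃ sz)) ≡.refl Found.pos<
              (≡.subst (Tree H) (≡.sym tree≡) tree₁)))))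

-- Drones ordered from the slowest, and bounds for the guess

module _ (m : ℕ) where
  mirror : ℕ → ℕ
  mirror p = m ℕ.∸ 1 ℕ.∸ p

  mirror< : ∀ {p} → p ℕ.< m → mirror p ℕ.< m
  mirror< {p} p<m = ℕ.≤-<-trans (ℕ.m∸n≤m (m ℕ.∸ 1) p) (≡.subst (m ℕ.∸ 1 ℕ.<_) (ℕ.m+[n∸m]≡n 1≤m) (ℕ.n<1+n _))
    where
    1≤m : 1 ℕ.≤ m
    1≤m = ℕ.≤-trans (ℕ.s≤s ℕ.z≤n) p<m

  mirror-involutive : ∀ {p} → p ℕ.< m → mirror (mirror p) ≡ p
  mirror-involutive p<m = ℕ.m∸[m∸n]≡n (ℕ.∸-monoˡ-≤ 1 p<m)

  mirror-antimono : ∀ {p q} → p ℕ.≤ q → mirror q ℕ.≤ mirror p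
  mirror-antimono = ℕ.∸-monoʳ-≤ (m ℕ.∸ 1)

  mirror-permutation : ∀ {σ} → Permutation m σ → Permutation m (λ p → σ (mirror p))
  mirror-permutation {σ} perm = record
    { bounded    = λ p p<m → bounded _ (mirror< p<m)
    ; injective  = λ p q p<m q<m eq → ≡.trans (≡.sym (mirror-involutive p<m))
        (≡.trans (≡.cong mirror (injective _ _ (mirror< p<m) (mirror< q<m) eq)) (mirror-involutive q<m))
    ; surjective = λ x x<m → let (i , i<m , eq) = surjective x x<m in
        mirror i , mirror< i<m , ≡.trans (≡.cong σ (mirror-involutive i<m)) eq }
    where open Permutation perm

module Sorted {c ℓ₁ ℓ₂} (F : OrderedField c ℓ₁ ℓ₂) {m n} (I : DWP.Instance F m n)
  (π σ : ℕ → ℕ) (π-perm : Permutation n π) (σ-perm : Permutation m σ)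
  (π-decreasing : ∀ s t → s ℕ.≤ t → t ℕ.< n →
    OrderedField._≤_ F (Schedules.lengthℕ F I (π t)) (Schedules.lengthℕ F I (π s)))
  (σ-decreasing : ∀ p q → p ℕ.≤ q → q ℕ.< m →
    OrderedField._≤_ F (Schedules.speedℕ F I (σ q)) (Schedules.speedℕ F I (σ p)))
  where
  open OrderedField F hiding (zero; sum)
  open OrderedFieldProperties F
  open DWP F
  open Instance I
  open Schedules F I public
  open Numerals F

  δ : ℕ → ℕ
  δ p = σ (mirror m p)

  open Ranked π δ π-perm (mirror-permutation m σ-perm) π-decreasing
    (λ p q p≤q q<m → σ-decreasing _ _ (mirror-antimono m p≤q) (mirror< m (ℕ.≤-<-trans p≤q q<m))) public
  open FirstFit F m ℓ v d public

  -- Here `q` counts the drones from the fastest, following `σ`, whereas ranks follow `δ` and count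
  -- from the slowest.
  Carries : ℕ → ℕ → Set ℓ₂
  Carries t q = ℓ t ≤ batteryℕ (σ q)

  some-carries : ∀ t → t ℕ.< n → ∃[ q ] q ℕ.< m × Carries t q
  some-carries t t<n with capable
  ... | j , all with Permutation.surjective σ-perm (toℕ j) (toℕ<n j)
  ...   | q , q<m , eq = q , q<m , ≡.subst₂ _≤_
    (≡.sym (padded-fromℕ< 0# length (π.bounded t t<n)))
    (≡.trans (≡.sym (padded-toℕ 0# battery j)) (≡.cong batteryℕ (≡.sym eq)))
    (all _)

  carrier : ℕ → ℕ
  carrier t = [ proj₁ , (λ _ → m) ]′ (first (λ q → ℓ t ≤? batteryℕ (σ q)) m)

  carrier-spec : ∀ t → t ℕ.< n →
    carrier t ℕ.< m × Carries t (carrier t) × (∀ q → q ℕ.< carrier t → ¬ Carries t q)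
  carrier-spec t t<n with first (λ q → ℓ t ≤? batteryℕ (σ q)) m
  ... | inj₁ (q , q<m , le , least) = q<m , le , least
  ... | inj₂ none = let (q , q<m , le) = some-carries t t<n in contradiction le (none q q<m)

  carrier-unique : ∀ t → t ℕ.< n → ∀ q → Carries t q → (∀ p → p ℕ.< q → ¬ Carries t p) → carrier t ≡ q
  carrier-unique t t<n q le least with carrier-spec t t<n
  ... | _ , le′ , least′ = ℕ.≤-antisym (ℕ.≮⇒≥ λ lt → least′ q lt le) (ℕ.≮⇒≥ λ lt → least _ lt le′)

  fastest : ℕ → ℕ
  fastest t = mirror m (carrier t)

  δ-fastest : ∀ t → t ℕ.< n → δ (fastest t) ≡ σ (carrier t)
  δ-fastest t t<n = ≡.cong σ (mirror-involutive m (proj₁ (carrier-spec t t<n)))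

  open Fastest n ℓ>0 π-decreasing v>0 fastest
    (λ t t<n → mirror< m (proj₁ (carrier-spec t t<n)))
    (λ t t<n → ≡.subst (λ x → ℓ t ≤ batteryℕ x) (≡.sym (δ-fastest t t<n)) (proj₁ (proj₂ (carrier-spec t t<n))))
    (λ t t<n p p<m le → ≡.subst (λ x → v p ≤ speedℕ x) (≡.sym (δ-fastest t t<n))
      (σ-decreasing _ _ (ℕ.≮⇒≥ λ lt → proj₂ (proj₂ (carrier-spec t t<n)) _ lt le) (mirror< m p<m))) public

  -- The approximation ratio 8/5 against all valid schedules, cleared of denominators. The search
  -- maintains it for the current `κ`.
  record Bounded (κ : Carrier) : Set ℓ₂ where
    constructor bounding
    field
      bound : ∀ g → Valid I g → fromℕ 5 * κ ≤ fromℕ 8 * deliveryTime I g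

  deliveryTime≥0 : ∀ g → 0# ≤ deliveryTime I g
  deliveryTime≥0 g = foldr-max-≥0 (load I g)

  -- As 2^k ≥ m and the solo time is at most m times any delivery time, `k` halvings bring it down
  -- to at most that time.
  start-bounded : ∀ k → m ℕ.≤ 2 ℕ.^ k → Bounded (half^ k soloTime)
  start-bounded k m≤2^k = bounding λ g valid → begin
    fromℕ 5 * half^ k soloTime
      ≤⟨ *-monoˡ-≤ (fromℕ-≥0 5) (half^-≤ k (≤-trans
           (soloTime≤mT (o g valid) (T g valid) (o<m g valid) (o-feasible g valid) (o-load g valid))
           (*-monoʳ-≤ (deliveryTime≥0 g) (fromℕ-mono m≤2^k)))) ⟩
    fromℕ 5 * deliveryTime I g
      ≤⟨ *-monoʳ-≤ (deliveryTime≥0 g) (fromℕ-mono {5} {8} (ℕ.m≤m+n 5 3)) ⟩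
    fromℕ 8 * deliveryTime I g ∎

  grow-bounded : ∀ {κ r} → 0# ≤ κ → r ℕ.< n → (∀ t → t ℕ.< r → rank κ t ℕ.< m) → rank κ r ≡ m →
    Bounded (grow κ)
  grow-bounded κ≥0 r<n placed stuck = bounding λ g valid → grow-stuck κ≥0 (stuck⇒ g valid _ _ r<n placed stuck)

  not-stuck : ∀ {κ} → soloTime ≤ κ → ∀ r → r ℕ.< n → rank κ r ≢ m
  not-stuck {κ} solo≤κ r r<n eq with rank-cases κ r
  ... | inj₁ (r<m , _) = ℕ.<⇒≢ r<m eq
  ... | inj₂ (_ , none) = none (fastest r) (mirror< m (proj₁ (carrier-spec r r<n))) (fastest-fits solo≤κ r r<n)

  rank-none : ∀ {κ t} → (∀ p → p ℕ.< m → ¬ Fit κ t p) → rank κ t ≡ m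
  rank-none {κ} {t} none with rank-cases κ t
  ... | inj₁ (r<m , fit , _) = contradiction fit (none _ r<m)
  ... | inj₂ (eq , _) = eq

-- The phases of the algorithm

sortBy : IntExp → Program → Program
sortBy size key = clearTree size ⨾ setLeaves key ⨾ selectionSort

-- Sorting lists the drones fastest first, whereas first fit wants the slowest
-- drone in the first leaf.
droneAt : IntExp → IntExp
droneAt p = readᴺ orderA (% sizeA ∸ᴺ litᴺ 1 ∸ᴺ p)

halfᴿ : RealExp → RealExp
halfᴿ e = e /ᴿ (1ᴿ +ᴿ 1ᴿ)

-- The order is copied to `porderA` because sorting the drones overwrites `orderA`.
sortParcels : Program
sortParcels =
  sortBy (% 1) (keyA ≔ᴿ readᴿ 0 (% indexA)) ⨾
  forEach (% 1) (writeᴺ porderA (% indexA) (readᴺ orderA (% indexA)))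

sortDrones : Program
sortDrones = sortBy (% 0) (keyA ≔ᴿ readᴿ 1 (% indexA))

-- The leaves hold the batteries with the fastest drone first, so the first leaf that reaches a
-- length belongs to the fastest suitable drone.
estimate : Program
estimate =
  setLeaves (keyA ≔ᴿ readᴿ 2 (readᴺ orderA (% indexA))) ⨾
  (κA ≔ᴿ 0ᴿ) ⨾
  forEach (% 1)
    ((keyA ≔ᴿ readᴿ 0 (readᴺ porderA (% indexA))) ⨾
     findFirst ⨾
     (κA ≔ᴿ %ᴿ κA +ᴿ %ᴿ keyA /ᴿ readᴿ 1 (readᴺ orderA (% posA))))

-- One halving of `κ` per binary digit of m divides it by a power of two in the range from m + 1 to
-- 2m.
scaleDown : Program
scaleDown =
  (shiftA ≔ᴺ % 0) ⨾
  while (litᴺ 1 ≤ᴺ % shiftA) ((shiftA ≔ᴺ halfᴺ (% shiftA)) ⨾ (κA ≔ᴿ halfᴿ (%ᴿ κA)))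

setKey : IntExp → Program
setKey p = branch (readᴿ slackA p ≤ᴿ readᴿ 2 (droneAt p))
  (keyA ≔ᴿ readᴿ slackA p)
  (keyA ≔ᴿ readᴿ 2 (droneAt p))

-- The root tells whether any drone fits. After a placement only one leaf changes, as only one drone
-- has lost slack.
place : Program
place =
  (keyA ≔ᴿ readᴿ 0 (readᴺ porderA (% indexA))) ⨾
  branch (%ᴿ keyA ≤ᴿ readᴿ treeA (litᴺ 1))
    (findFirst ⨾
     writeᴺ outA (readᴺ porderA (% indexA)) (droneAt (% posA)) ⨾
     writeᴿ slackA (% posA) (readᴿ slackA (% posA) -ᴿ %ᴿ keyA) ⨾
     setKey (% posA) ⨾
     update)
    (flagA ≔ᴺ litᴺ 1)

attempt : Program
attempt =
  forEach (% 0) (writeᴿ slackA (% indexA) (%ᴿ κA *ᴿ readᴿ 1 (droneAt (% indexA)))) ⨾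
  setLeaves (setKey (% indexA)) ⨾
  (flagA ≔ᴺ litᴺ 0) ⨾
  forEach (% 1) (branch (% flagA ≤ᴺ litᴺ 0) place skip)

growIfStuck : Program
growIfStuck = branch (litᴺ 1 ≤ᴺ % flagA) (κA ≔ᴿ %ᴿ κA +ᴿ halfᴿ (halfᴿ (halfᴿ (halfᴿ (%ᴿ κA))))) skip

search : Program
search = (flagA ≔ᴺ litᴺ 1) ⨾ while (litᴺ 1 ≤ᴺ % flagA) (attempt ⨾ growIfStuck)

algorithm : Program
algorithm = sortParcels ⨾ sortDrones ⨾ estimate ⨾ scaleDown ⨾ search

-- Costs and correctness of the sorting phases

permutation-cong : ∀ {N π π′} → (∀ i → i ℕ.< N → π′ i ≡ π i) → Permutation N π → Permutation N π′
permutation-cong {N} {π} {π′} eq perm = record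
  { bounded    = λ i i<N → ≡.subst (ℕ._< N) (≡.sym (eq i i<N)) (bounded i i<N)
  ; injective  = λ i j i<N j<N e → injective i j i<N j<N (≡.trans (≡.sym (eq i i<N)) (≡.trans e (eq j j<N)))
  ; surjective = λ x x<N → let (i , i<N , e) = surjective x x<N in i , i<N , ≡.trans (eq i i<N) e }
  where open Permutation perm

updateCost-mono : ∀ {H H′} → H ℕ.≤ H′ → updateCost H ℕ.≤ updateCost H′
updateCost-mono le = ℕ.+-monoʳ-≤ 12 (ℕ.*-monoˡ-≤ 46 (ℕ.s≤s le))

findCost-mono : ∀ {H H′} → H ℕ.≤ H′ → findCost H ℕ.≤ findCost H′
findCost-mono le = ℕ.+-monoʳ-≤ 3 (ℕ.+-monoˡ-≤ 7 (ℕ.*-monoˡ-≤ 28 (ℕ.s≤s le)))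

setLeavesCost-mono : ∀ {H H′} N K → H ℕ.≤ H′ → setLeavesCost N H K ℕ.≤ setLeavesCost N H′ K
setLeavesCost-mono N K le = ℕ.+-monoʳ-≤ 3 (ℕ.*-monoʳ-≤ (suc N)
  (ℕ.+-monoʳ-≤ 7 (ℕ.+-monoˡ-≤ 6 (ℕ.+-monoʳ-≤ K (ℕ.+-monoʳ-≤ 4 (updateCost-mono le))))))

selectionSortCost-mono : ∀ {H H′} N → H ℕ.≤ H′ → selectionSortCost N H ℕ.≤ selectionSortCost N H′
selectionSortCost-mono N le = ℕ.+-monoʳ-≤ 3 (ℕ.*-monoʳ-≤ (suc N) (ℕ.+-monoʳ-≤ 7 (ℕ.+-monoˡ-≤ 6 (ℕ.+-monoʳ-≤ 4
  (ℕ.+-mono-≤ (findCost-mono le) (ℕ.+-monoʳ-≤ 5 (ℕ.+-monoʳ-≤ 3 (updateCost-mono le))))))))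

sortByCost : ℕ → ℕ → ℕ → ℕ
sortByCost e N K = clearCost e N ℕ.+
  (setLeavesCost N (suc ⌊log₂ N ⌋) K ℕ.+ selectionSortCost N (suc ⌊log₂ N ⌋))

module Sorting {c ℓ₁ ℓ₂} (F : OrderedField c ℓ₁ ℓ₂) where
  open OrderedField F hiding (zero; sum)
  open OrderedFieldProperties F
  open Runs F
  open ForEach F
  open Trees F
  open TreePrograms F

  at0 : ∀ {a} {A : Set a} {f g : ℕ → A} → f ≡ g → ∀ i → f i ≡ g i
  at0 eq i = ≡.cong (λ f → f i) eq

  record SortDone (N : ℕ) (key : ℕ → Carrier) (s s′ : State) : Set (c ⊔ ℓ₂) where
    field
      height     : ℕ
      height≤    : height ℕ.≤ suc ⌊log₂ N ⌋
      framed     : Frame (sizeA ∷ widthA ∷ indexA ∷ posA ∷ nodeA ∷ orderA ∷ []) (treeA ∷ keyA ∷ []) s s′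
      size       : Sized N height s′
      tree       : Tree height (reals s′ treeA)
      order      : Permutation N (ints s′ orderA)
      decreasing : ∀ i j → i ℕ.≤ j → j ℕ.< N → key (ints s′ orderA j) ≤ key (ints s′ orderA i)
      beyond     : ∀ x → N ℕ.≤ x → x ℕ.< 2 ℕ.^ height → leaf height s′ x ≡ 0#

  run-sortBy : ∀ {s key K} e N (keyOf : ℕ → Carrier) → ⟦ e ⟧ᴺ s ≡ N → (∀ x → x ℕ.< N → Positive (keyOf x)) →
    (∀ i s₁ → i ℕ.< N → Frame (sizeA ∷ widthA ∷ indexA ∷ posA ∷ nodeA ∷ []) (treeA ∷ keyA ∷ []) s s₁ →
      ints s₁ indexA 0 ≡ i → Run key s₁ K (λ s₂ → Frame [] (keyA ∷ []) s₁ s₂ × reals s₂ keyA 0 ≡ keyOf i)) →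
    Run (sortBy e key) s (sortByCost (costᴺ e) N K) (SortDone N keyOf s)
  run-sortBy {s} {key} {K} e N keyOf e≡ key>0 run-key =
    run-clearTree e N e≡ >> λ {s₁} cleared → let module C = Cleared cleared in
    run-mono (ℕ.+-mono-≤ (setLeavesCost-mono N K C.height≤) (selectionSortCost-mono N C.height≤)) (λ _ q → q)
      (run-setLeaves (λ i x → x ≡ keyOf i) C.size C.tree
        (λ i s₂ i<N fr i≡ → run-key i s₂ i<N
          (frame-trans (frame-⊆ ≡.refl ≡.refl C.framed) (frame-⊆ ≡.refl ≡.refl fr)) i≡)
      >> λ {s₂} leaves → let module L = LeavesSet leaves
                             sz = sized-frame ≡.refl ≡.refl L.framed C.size
                             open Selection N C.height (Sized.fits C.size) keyOf key>0 in
      run-map (λ s₃ sorted → let module S = SortedBy sorted in record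
        { height = C.height ; height≤ = C.height≤
        ; framed = frame-trans (frame-⊆ ≡.refl ≡.refl C.framed)
            (frame-trans (frame-⊆ ≡.refl ≡.refl L.framed) (frame-⊆ ≡.refl ≡.refl S.framed))
        ; size = sized-frame ≡.refl ≡.refl S.framed sz
        ; tree = S.tree ; order = S.order ; decreasing = S.decreasing ; beyond = S.beyond })
      (run-selectionSort sz L.tree L.set
        (λ x N≤x x< → ≡.trans (L.unset x N≤x) (C.empty x x<))))

sortParcelsCost : ℕ → ℕ
sortParcelsCost n = sortByCost 2 n 5 ℕ.+ (3 ℕ.+ suc n ℕ.* 19)

sortDronesCost : ℕ → ℕ
sortDronesCost m = sortByCost 2 m 5

estimateCost : ℕ → ℕ → ℕ → ℕ
estimateCost m n H = setLeavesCost m H 6 ℕ.+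
  (3 ℕ.+ (3 ℕ.+ suc n ℕ.* (7 ℕ.+ (6 ℕ.+ (findCost H ℕ.+ 12) ℕ.+ 6))))

-- The same number also bounds the height of the tree over the drones.
halvings≤ : ℕ → ℕ
halvings≤ m = suc ⌊log₂ m ⌋

scaleDownCost : ℕ → ℕ
scaleDownCost m = 4 ℕ.+ suc (halvings≤ m) ℕ.* 18

placeCost : ℕ → ℕ
placeCost H = 6 ℕ.+ (6 ℕ.+ (findCost H ℕ.+ (12 ℕ.+ (9 ℕ.+ (30 ℕ.+ updateCost H))) ℕ.+ 3))

attemptCost : ℕ → ℕ → ℕ → ℕ
attemptCost m n H = 3 ℕ.+ suc m ℕ.* 28 ℕ.+ (setLeavesCost m H 30 ℕ.+
  (3 ℕ.+ (3 ℕ.+ suc n ℕ.* (7 ℕ.+ (5 ℕ.+ (placeCost H ℕ.+ 1) ℕ.+ 6)))))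

-- Sixteen increases per halving and the initial value make `halvings≤ m * 16 + 1` attempts; the
-- other `suc` is for the last loop test.
searchCost : ℕ → ℕ → ℕ
searchCost m A = 3 ℕ.+ suc (suc (halvings≤ m ℕ.* 16)) ℕ.* (5 ℕ.+ (A ℕ.+ 29))

module Phases {c ℓ₁ ℓ₂} (F : OrderedField c ℓ₁ ℓ₂) {m n} (I : DWP.Instance F m n) where
  open OrderedField F hiding (zero; sum)
  open OrderedFieldProperties F
  open Runs F
  open ForEach F
  open Trees F
  open TreePrograms F
  open Sorting F
  open Schedules F I using (lengthℕ; speedℕ; batteryℕ; lengthℕ>0; speedℕ>0)

  record Inputs (s : State) : Set c where
    constructor inputs
    field
      m≡ : ints s 0 0 ≡ m
      n≡ : ints s 1 0 ≡ n
      lengths≡   : reals s 0 ≡ lengthℕ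
      speeds≡    : reals s 1 ≡ speedℕ
      batteries≡ : reals s 2 ≡ batteryℕ

  inputs-frame : ∀ {is rs s s′} → 0 ∈ᵇ is ≡ false → 1 ∈ᵇ is ≡ false →
    0 ∈ᵇ rs ≡ false → 1 ∈ᵇ rs ≡ false → 2 ∈ᵇ rs ≡ false → Frame is rs s s′ → Inputs s → Inputs s′
  inputs-frame i0 i1 r0 r1 r2 fr (inputs m≡ n≡ l≡ s≡ b≡) = inputs
    (≡.trans (at0 (ints-≡ fr 0 i0) 0) m≡) (≡.trans (at0 (ints-≡ fr 1 i1) 0) n≡)
    (≡.trans (reals-≡ fr 0 r0) l≡) (≡.trans (reals-≡ fr 1 r1) s≡) (≡.trans (reals-≡ fr 2 r2) b≡)

  record ParcelsSorted (s : State) : Set (c ⊔ ℓ₂) where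
    field
      given      : Inputs s
      order      : Permutation n (ints s porderA)
      decreasing : ∀ i j → i ℕ.≤ j → j ℕ.< n → lengthℕ (ints s porderA j) ≤ lengthℕ (ints s porderA i)

  run-sortParcels : ∀ {s} → Inputs s → Run sortParcels s (sortParcelsCost n) ParcelsSorted
  run-sortParcels {s} given =
    run-sortBy (% 1) n lengthℕ (Inputs.n≡ given) lengthℕ>0
      (λ { i s₁ i<n fr ≡.refl → run-writeᴿ (frame-setᴿ keyA 0 _ ≡.refl frame-refl ,
        at0 (Inputs.lengths≡ (inputs-frame ≡.refl ≡.refl ≡.refl ≡.refl ≡.refl fr given)) i) })
    >> λ {s₁} sorted → let
        module S = SortDone sorted
        given₁ = inputs-frame ≡.refl ≡.refl ≡.refl ≡.refl ≡.refl S.framed given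
        Copied : ℕ → State → Set c
        Copied k s′ = Frame (indexA ∷ porderA ∷ []) [] s₁ s′ ×
          (∀ i → i ℕ.< k → ints s′ porderA i ≡ ints s₁ orderA i)
      in run-map (λ s′ (fr , copied) → record
        { given = inputs-frame ≡.refl ≡.refl ≡.refl ≡.refl ≡.refl fr given₁
        ; order = permutation-cong copied S.order
        ; decreasing = λ i j i≤j j<n → ≡.subst₂ (λ a b → lengthℕ a ≤ lengthℕ b)
            (≡.sym (copied j j<n)) (≡.sym (copied i (ℕ.≤-<-trans i≤j j<n))) (S.decreasing i j i≤j j<n) })
      (run-forEach {e = % 1} n Copied s₁
        (λ k s′ (fr , _) → Inputs.n≡ (inputs-frame ≡.refl ≡.refl ≡.refl ≡.refl ≡.refl fr given₁))
        (λ { k s′ k<n ≡.refl (fr , copied) → run-writeᴺ (≡.refl ,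
          frame-setᴺ indexA 0 _ ≡.refl (frame-setᴺ porderA k _ ≡.refl fr) ,
          λ i i<1+k → [ (λ i<k → ≡.trans (↦-off (ints s′ porderA) _ (ℕ.>⇒≢ i<k)) (copied i i<k)) ,
            (λ { ≡.refl → ≡.trans (↦-at (ints s′ porderA) k _) (at0 (ints-≡ fr orderA ≡.refl) k) }) ]′
            (ℕ.m<1+n⇒m<n∨m≡n i<1+k)) })
        (frame-setᴺ indexA 0 0 ≡.refl frame-refl , λ _ ()))

  run-sortDrones : ∀ {s} → Inputs s →
    Run sortDrones s (sortDronesCost m) (λ s′ → SortDone m speedℕ s s′ × Inputs s′)
  run-sortDrones {s} given = run-map
    (λ s′ sorted → sorted , inputs-frame ≡.refl ≡.refl ≡.refl ≡.refl ≡.refl (SortDone.framed sorted) given)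
    (run-sortBy (% 0) m speedℕ (Inputs.m≡ given) speedℕ>0
      (λ { i s₁ i<m fr ≡.refl → run-writeᴿ (frame-setᴿ keyA 0 _ ≡.refl frame-refl ,
        at0 (Inputs.speeds≡ (inputs-frame ≡.refl ≡.refl ≡.refl ≡.refl ≡.refl fr given)) i) }))

-- Correctness of the estimate, the attempts and the search

module Scheduling {c ℓ₁ ℓ₂} (F : OrderedField c ℓ₁ ℓ₂) {m n} (I : DWP.Instance F m n)
  (π σ : ℕ → ℕ) (π-perm : Permutation n π) (σ-perm : Permutation m σ)
  (π-decreasing : ∀ s t → s ℕ.≤ t → t ℕ.< n →
    OrderedField._≤_ F (Schedules.lengthℕ F I (π t)) (Schedules.lengthℕ F I (π s)))
  (σ-decreasing : ∀ p q → p ℕ.≤ q → q ℕ.< m →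
    OrderedField._≤_ F (Schedules.speedℕ F I (σ q)) (Schedules.speedℕ F I (σ p)))
  (H : ℕ)
  where
  open OrderedField F hiding (zero; sum)
  open OrderedFieldProperties F
  open Sums F
  open Numerals F
  open Runs F
  open ForEach F
  open Trees F
  open TreePrograms F
  open Sorting F
  open Phases F I
  open Sorted F I π σ π-perm σ-perm π-decreasing σ-decreasing

  Is Rs : List ArrayName
  Is = outA ∷ indexA ∷ posA ∷ nodeA ∷ flagA ∷ shiftA ∷ []
  Rs = treeA ∷ keyA ∷ κA ∷ slackA ∷ []

  record Ready (s : State) : Set c where
    constructor ready
    field
      given  : Inputs s
      size   : Sized m H s
      porder : ints s porderA ≡ π
      order  : ints s orderA ≡ σ
    open Inputs given public

  ready-frame : ∀ {is rs s s′} → is ⊆ᵇ Is ≡ true → rs ⊆ᵇ Rs ≡ true → Frame is rs s s′ → Ready s → Ready s′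
  ready-frame is⊆ rs⊆ fr₀ (ready given size porder order) = ready
    (inputs-frame ≡.refl ≡.refl ≡.refl ≡.refl ≡.refl fr given)
    (sized-frame ≡.refl ≡.refl fr size)
    (≡.trans (ints-≡ fr porderA ≡.refl) porder) (≡.trans (ints-≡ fr orderA ≡.refl) order)
    where fr = frame-⊆ {is′ = Is} {rs′ = Rs} is⊆ rs⊆ fr₀

  record TreeReady (s : State) : Set (c ⊔ ℓ₂) where
    constructor tree-ready
    field
      tree   : Tree H (reals s treeA)
      beyond : ∀ x → m ℕ.≤ x → x ℕ.< 2 ℕ.^ H → leaf H s x ≡ 0#
  open TreeReady public

  -- Padding leaves hold 0, which lies below every positive `x`, so a search never ends in one of
  -- them.
  found< : ∀ {s q x} → TreeReady s → Positive x → q ℕ.< 2 ℕ.^ H → x ≤ leaf H s q → q ℕ.< m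
  found< tr x>0 q< x≤ = ℕ.≰⇒> λ m≤q → x>0 (≤-trans x≤ (≡⇒≤ (beyond tr _ m≤q q<)))

  run-estimate : ∀ {s} → Ready s → TreeReady s →
    Run estimate s (estimateCost m n H) (λ s′ → Ready s′ × TreeReady s′ × reals s′ κA 0 ≡ soloTime)
  run-estimate {s} rdy tr =
    run-setLeaves (λ i x → x ≡ batteryℕ (σ i)) (Ready.size rdy) (tree tr)
      (λ { i s₁ i<m fr ≡.refl → let rdy₁ = ready-frame ≡.refl ≡.refl fr rdy in
        run-writeᴿ (frame-setᴿ keyA 0 _ ≡.refl frame-refl ,
          ≡.trans (at0 (Ready.batteries≡ rdy₁) _) (≡.cong batteryℕ (at0 (Ready.order rdy₁) i))) })
    >> λ {s₁} leaves → let
        module L = LeavesSet leaves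
        rdy₁ = ready-frame ≡.refl ≡.refl L.framed rdy
        tr₁ : TreeReady s₁
        tr₁ = tree-ready L.tree λ x m≤x x< → ≡.trans (L.unset x m≤x) (beyond tr x m≤x x<)
      in run-writeᴿ-⨾ (run-map
        (λ s′ (fr , sum≡) → ready-frame ≡.refl ≡.refl fr rdy₁ ,
          tree-ready (≡.subst (Tree H) (≡.sym (reals-≡ fr treeA ≡.refl)) (tree tr₁))
            (λ x m≤x x< → ≡.trans (at0 (reals-≡ fr treeA ≡.refl) _) (beyond tr₁ x m≤x x<)) ,
          sum≡)
        (run-forEach {e = % 1} n (Summed s₁) (setᴿ s₁ κA 0 0#)
          (λ k s′ (fr , _) → Ready.n≡ (ready-frame ≡.refl ≡.refl fr rdy₁))
          (body s₁ rdy₁ tr₁ L.set)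
          (frame-setᴺ indexA 0 0 ≡.refl (frame-setᴿ κA 0 0# ≡.refl frame-refl) , ≡.refl)))
    where
    Summed : State → ℕ → State → Set c
    Summed s₁ k s′ = Frame (indexA ∷ posA ∷ nodeA ∷ []) (keyA ∷ κA ∷ []) s₁ s′ ×
      reals s′ κA 0 ≡ Σ< k (λ t → ℓ t / v (fastest t))
    body : ∀ s₁ → Ready s₁ → TreeReady s₁ → (∀ i → i ℕ.< m → leaf H s₁ i ≡ batteryℕ (σ i)) →
      ∀ k s₂ → k ℕ.< n → ints s₂ indexA 0 ≡ k → Summed s₁ k s₂ →
      Run _ s₂ (6 ℕ.+ (findCost H ℕ.+ 12)) (λ s′ → ints s′ indexA 0 ≡ k × Summed s₁ (suc k) (next s′))
    body s₁ rdy₁ tr₁ leaf≡ k s₂ k<n ≡.refl (fr₂ , sum≡) = run-writeᴿ-⨾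
      (run-findFirst H (width≡ (Ready.size rdy₂)) (≡.subst (Tree H) (≡.sym tree≡) (tree tr₁))
        -- Some drone carries parcel `k`, by `capable`, and its leaf is at most the root; so the
        -- search will succeed.
        (≡.subst₂ _≤_ (≡.sym x≡) (≡.sym (at0 tree≡ 1))
          (≤-trans (proj₁ (proj₂ spec)) (≤-respˡ-≈ (reflexive (leaf≡ _ (proj₁ spec)))
            (leaf≤root H (tree tr₁) _ (ℕ.<-≤-trans (proj₁ spec) (Sized.fits (Ready.size rdy₁)))))))
      >> λ {s₃} found → let
          module Found = FoundFirst found
          q = ints s₃ posA 0
          rdy₃ = ready-frame ≡.refl ≡.refl Found.framed (ready-frame ≡.refl ≡.refl
                   (frame-setᴿ {[]} {keyA ∷ []} keyA 0 x ≡.refl frame-refl) rdy₂)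
          q-fits : ℓ k ≤ leaf H s₁ q
          q-fits = ≡.subst₂ _≤_ x≡ (at0 tree≡ _) Found.fits
          q<m : q ℕ.< m
          q<m = found< tr₁ (ℓ>0 k k<n) Found.pos< q-fits
          q≡ : carrier k ≡ q
          q≡ = carrier-unique k k<n q (≡.subst (ℓ k ≤_) (leaf≡ q q<m) q-fits)
            (λ p p<q le → Found.least p p<q (≡.subst₂ _≤_ (≡.sym x≡)
              (≡.sym (≡.trans (at0 tree≡ _) (leaf≡ p (ℕ.<-trans p<q q<m)))) le))
        in run-writeᴿ
          ( at0 (ints-≡ Found.framed indexA ≡.refl) 0
          , frame-setᴺ indexA 0 _ ≡.refl (frame-setᴿ κA 0 _ ≡.refl (frame-trans fr₂ (frame-trans
              (frame-setᴿ keyA 0 x ≡.refl frame-refl) (frame-⊆ ≡.refl ≡.refl Found.framed))))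
          , ≡.cong₂ _+_ (≡.trans (at0 (reals-≡ Found.framed κA ≡.refl) 0) sum≡)
              (≡.cong₂ _/_ (≡.trans (at0 (reals-≡ Found.framed keyA ≡.refl) 0) x≡)
                (≡.trans (at0 (Ready.speeds≡ rdy₃) _) (≡.cong speedℕ
                  (≡.trans (at0 (Ready.order rdy₃) q)
                    (≡.trans (≡.cong σ (≡.sym q≡)) (≡.sym (δ-fastest k k<n)))))))))
      where
      rdy₂ = ready-frame ≡.refl ≡.refl fr₂ rdy₁
      tree≡ : reals s₂ treeA ≡ reals s₁ treeA
      tree≡ = reals-≡ fr₂ treeA ≡.refl
      x : Carrier
      x = reals s₂ 0 (ints s₂ porderA k)
      x≡ : x ≡ ℓ k
      x≡ = ≡.trans (at0 (Ready.lengths≡ rdy₂) _) (≡.cong lengthℕ (at0 (Ready.porder rdy₂) k))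
      spec = carrier-spec k k<n

  tree-ready-frame : ∀ {is rs s s′} → treeA ∈ᵇ rs ≡ false → Frame is rs s s′ → TreeReady s → TreeReady s′
  tree-ready-frame tree∉ fr tr = tree-ready
    (≡.subst (Tree H) (≡.sym (reals-≡ fr treeA tree∉)) (tree tr))
    (λ x m≤x x< → ≡.trans (at0 (reals-≡ fr treeA tree∉) _) (beyond tr x m≤x x<))

  ScaledDown : State → Set (c ⊔ ℓ₂)
  ScaledDown s′ = Ready s′ × TreeReady s′ ×
    ∃[ k ] k ℕ.≤ (halvings≤ m) × m ℕ.≤ 2 ℕ.^ k × reals s′ κA 0 ≡ half^ k soloTime

  -- After `k` halvings the shift is m / 2^k rounded down. Of this the invariant keeps m < 2^k
  -- (shift + 1), which yields m < 2^k once the shift is 0. The bound 2^r on the shift makes `r` a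
  -- variant.
  run-scaleDown : ∀ {s} → Ready s → TreeReady s → reals s κA 0 ≡ soloTime →
    Run scaleDown s (scaleDownCost m) ScaledDown
  run-scaleDown {s} rdy tr κ≡ = run-writeᴺ-⨾ (run-map
    (λ s′ (k , k≤ , m≤ , fr , κ≡) → ready-frame ≡.refl ≡.refl fr rdy , tree-ready-frame ≡.refl fr tr , k , k≤ , m≤ , κ≡)
    (run-while Inv step (halvings≤ m) (setᴺ s shiftA 0 (ints s 0 0))
      (0 , ≡.refl , frame-setᴺ shiftA 0 _ ≡.refl frame-refl ,
       ≡.subst (ℕ._< 2 ℕ.^ (halvings≤ m)) (≡.sym (Ready.m≡ rdy)) (n<2^[1+⌊log₂n⌋] m) ,
       ℕ.s≤s (ℕ.≤-reflexive (≡.trans (≡.sym (Ready.m≡ rdy)) (≡.sym (ℕ.+-identityʳ _)))) , κ≡)))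
    where
    Inv : ℕ → State → Set c
    Inv r s′ = ∃[ k ] k ℕ.+ r ≡ (halvings≤ m) × Frame (shiftA ∷ []) (κA ∷ []) s s′ ×
      ints s′ shiftA 0 ℕ.< 2 ℕ.^ r × m ℕ.< 2 ℕ.^ k ℕ.* suc (ints s′ shiftA 0) × reals s′ κA 0 ≡ half^ k soloTime
    Done : State → Set c
    Done s′ = ∃[ k ] k ℕ.≤ (halvings≤ m) × m ℕ.≤ 2 ℕ.^ k × Frame (shiftA ∷ []) (κA ∷ []) s s′ ×
      reals s′ κA 0 ≡ half^ k soloTime
    step : ∀ r s′ → Inv r s′ → (⟦ litᴺ 1 ≤ᴺ % shiftA ⟧ᴮ s′ ≡ false × Done s′) ⊎
      (⟦ litᴺ 1 ≤ᴺ % shiftA ⟧ᴮ s′ ≡ true × ∃[ r′ ] r ≡ suc r′ × Run _ s′ 13 (Inv r′))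
    step r s′ (k , k+r≡ , fr , x< , m< , κ≡) with 1 ℕ.≤? ints s′ shiftA 0
    ... | no x≱1 = inj₁ (dec-false (1 ℕ.≤? ints s′ shiftA 0) x≱1 , k ,
      ≡.subst (k ℕ.≤_) k+r≡ (ℕ.m≤m+n k r) ,
      ≡.subst (m ℕ.≤_) (≡.trans (≡.cong (λ x → 2 ℕ.^ k ℕ.* suc x) (ℕ.n<1⇒n≡0 (ℕ.≰⇒> x≱1))) (ℕ.*-identityʳ _)) (ℕ.<⇒≤ m<) ,
      fr , κ≡)
    step zero    s′ (k , k+r≡ , fr , x< , m< , κ≡) | yes x≥1 = contradiction x≥1 (ℕ.<⇒≱ x<)
    step (suc r) s′ (k , k+r≡ , fr , x< , m< , κ≡) | yes x≥1 = inj₂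
      (dec-true (1 ℕ.≤? ints s′ shiftA 0) x≥1 , r , ≡.refl ,
       run-writeᴺ-⨾ (run-writeᴿ (suc k , ≡.trans (≡.sym (ℕ.+-suc k r)) k+r≡ ,
         frame-setᴿ κA 0 _ ≡.refl (frame-setᴺ shiftA 0 h ≡.refl fr) ,
         half<2^ r x< , ℕ.<-≤-trans m< doubled , ≡.cong half κ≡)))
      where
      h : ℕ
      h = ℕ.⌊ ints s′ shiftA 0 /2⌋
      x≤ : suc (ints s′ shiftA 0) ℕ.≤ 2 ℕ.* suc h
      x≤ = ℕ.≤-trans (ℕ.s≤s ([ (λ eq → ℕ.≤-trans (ℕ.≤-reflexive eq) (ℕ.m≤m+n _ 1)) , ℕ.≤-reflexive ]′ (halves (ints s′ shiftA 0))))
        (ℕ.≤-reflexive (≡.cong suc (≡.trans (ℕ.+-assoc h h 1)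
          (≡.cong (h ℕ.+_) (≡.trans (ℕ.+-comm h 1) (≡.sym (ℕ.+-identityʳ (suc h))))))))
      doubled : 2 ℕ.^ k ℕ.* suc (ints s′ shiftA 0) ℕ.≤ 2 ℕ.^ suc k ℕ.* suc h
      doubled = ℕ.≤-trans (ℕ.*-monoʳ-≤ (2 ℕ.^ k) x≤) (ℕ.≤-reflexive
        (≡.trans (≡.sym (ℕ.*-assoc (2 ℕ.^ k) 2 (suc h))) (≡.cong (ℕ._* suc h) (ℕ.*-comm (2 ℕ.^ k) 2))))

  record IsMin (x a b : Carrier) : Set (c ⊔ ℓ₂) where
    constructor is-min
    field
      ≤left    : x ≤ a
      ≤right   : x ≤ b
      greatest : ∀ {y} → y ≤ a → y ≤ b → y ≤ x

  run-setKey : ∀ {s} a → Ready s → Run (setKey (% a)) s 30 (λ s′ → Frame [] (keyA ∷ []) s s′ ×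
    IsMin (reals s′ keyA 0) (reals s slackA (ints s a 0)) (d (ints s a 0)))
  run-setKey {s} a rdy = run-branch
    (λ le → run-writeᴿ (frame-setᴿ keyA 0 _ ≡.refl frame-refl ,
      is-min ≤-refl (≤-respʳ-≈ (reflexive d≡) (does-true (_ ≤? _) le)) (λ y≤a _ → y≤a)))
    (λ gt → run-writeᴿ (frame-setᴿ keyA 0 _ ≡.refl frame-refl ,
      is-min (≰⇒≥ (does-false (_ ≤? _) gt)) (≡⇒≤ d≡)
        (λ _ y≤b → ≤-respʳ-≈ (reflexive (≡.sym d≡)) y≤b)))
    where
    d≡ : reals s 2 (⟦ droneAt (% a) ⟧ᴺ s) ≡ d (ints s a 0)
    d≡ = ≡.trans (at0 (Ready.batteries≡ rdy) _) (≡.cong batteryℕ (≡.trans (at0 (Ready.order rdy) _)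
      (≡.cong (λ x → σ (x ℕ.∸ 1 ℕ.∸ ints s a 0)) (Sized.size≡ (Ready.size rdy)))))

  -- The slack is what the load leaves of κv, stated additively. With a leaf being the minimum of
  -- slack and battery, `ℓ k ≤ lf p` is equivalent to `Fit κ k p`, so a search in the tree carries
  -- out first fit.
  record Placed (κ : Carrier) (k : ℕ) (out : ℕ → ℕ) (slack lf : ℕ → Carrier) : Set (c ⊔ ℓ₁ ⊔ ℓ₂) where
    field
      placed  : ∀ t → t ℕ.< k → rank κ t ℕ.< m
      output  : ∀ t → t ℕ.< k → out (π t) ≡ δ (rank κ t)
      slack≈  : ∀ p → p ℕ.< m → slack p + placedLoad κ k p ≈ κ * v p
      leaf-ok : ∀ p → p ℕ.< m → IsMin (lf p) (slack p) (d p)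

    leaf⇒fit : ∀ p → p ℕ.< m → ℓ k ≤ lf p → Fit κ k p
    leaf⇒fit p p<m le = ≤-trans le (IsMin.≤right (leaf-ok p p<m)) ,
      ≤-respʳ-≈ (slack≈ p p<m) (+-monoˡ-≤ _ (≤-trans le (IsMin.≤left (leaf-ok p p<m))))

    fit⇒leaf : ∀ p → p ℕ.< m → Fit κ k p → ℓ k ≤ lf p
    fit⇒leaf p p<m (le , le′) = IsMin.greatest (leaf-ok p p<m)
      (+-cancelʳ-≤ _ (≤-respʳ-≈ (sym (slack≈ p p<m)) le′)) le

  place-next : ∀ {κ k out slack lf} out′ slack′ lf′ {q x} → k ℕ.< n → Placed κ k out slack lf →
    q ℕ.< m → rank κ k ≡ q → x ≡ ℓ k →
    (∀ t → t ≢ π k → out′ t ≡ out t) → out′ (π k) ≡ δ q →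
    (∀ p → p ≢ q → slack′ p ≡ slack p) → slack′ q ≡ slack q - x →
    (∀ p → p ≢ q → lf′ p ≡ lf p) → IsMin (lf′ q) (slack′ q) (d q) →
    Placed κ (suc k) out′ slack′ lf′
  place-next {κ} {k} {out} {slack} {lf} out′ slack′ lf′ {q} k<n P q<m rank≡ ≡.refl
    out-old out-new slack-old slack-new lf-old lf-new = record
    { placed  = λ t t< → [ placed t , (λ { ≡.refl → ≡.subst (ℕ._< m) (≡.sym rank≡) q<m }) ]′ (ℕ.m<1+n⇒m<n∨m≡n t<)
    ; output  = λ t t< → [ (λ t<k → ≡.trans (out-old (π t) λ eq →
          ℕ.<⇒≢ t<k (π.injective t k (ℕ.<-trans t<k k<n) k<n eq)) (output t t<k)) ,
        (λ { ≡.refl → ≡.trans out-new (≡.cong δ (≡.sym rank≡)) }) ]′ (ℕ.m<1+n⇒m<n∨m≡n t<)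
    ; slack≈  = slack≈′
    ; leaf-ok = leaf-ok′
    }
    where
    open Placed P
    slack≈′ : ∀ p → p ℕ.< m → slack′ p + placedLoad κ (suc k) p ≈ κ * v p
    slack≈′ p p<m with p ℕ.≟ q
    ... | no p≢q = begin-equality
      slack′ p + (placedLoad κ k p + only (does (rank κ k ℕ.≟ p)) (ℓ k))
        ≈⟨ +-cong (reflexive (slack-old p p≢q)) (trans (+-congˡ (only-≢ λ eq → p≢q (≡.trans (≡.sym eq) rank≡))) (+-identityʳ _)) ⟩
      slack p + placedLoad κ k p  ≈⟨ slack≈ p p<m ⟩
      κ * v p  ∎
    ... | yes ≡.refl = begin-equality
      slack′ p + (placedLoad κ k p + only (does (rank κ k ℕ.≟ p)) (ℓ k))
        ≈⟨ +-cong (reflexive slack-new) (+-congˡ (reflexive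
             (≡.cong (λ e → only e (ℓ k)) (≡.trans (≡.cong (λ r → does (r ℕ.≟ p)) rank≡) (eqᵇ-refl p))))) ⟩
      slack p - ℓ k + (placedLoad κ k p + ℓ k)
        ≈⟨ solve 4 (λ s n L x → s :+ n :+ (L :+ x) := s :+ n :+ x :+ L) refl (slack p) (- ℓ k) (placedLoad κ k p) (ℓ k) ⟩
      slack p - ℓ k + ℓ k + placedLoad κ k p  ≈⟨ +-congʳ (x-z+z (slack p) (ℓ k)) ⟩
      slack p + placedLoad κ k p  ≈⟨ slack≈ p p<m ⟩
      κ * v p  ∎
    leaf-ok′ : ∀ p → p ℕ.< m → IsMin (lf′ p) (slack′ p) (d p)
    leaf-ok′ p p<m with p ℕ.≟ q
    ... | yes ≡.refl = lf-new
    ... | no p≢q = ≡.subst₂ (λ x y → IsMin x y (d p)) (≡.sym (lf-old p p≢q)) (≡.sym (slack-old p p≢q)) (leaf-ok p p<m)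

  Stuck : Carrier → Set
  Stuck κ = ∃[ r ] r ℕ.< n × (∀ t → t ℕ.< r → rank κ t ℕ.< m) × rank κ r ≡ m

  AIs ARs : List ArrayName
  AIs = outA ∷ indexA ∷ posA ∷ nodeA ∷ flagA ∷ []
  ARs = treeA ∷ keyA ∷ slackA ∷ []

  Status : Carrier → ℕ → State → Set (c ⊔ ℓ₁ ⊔ ℓ₂)
  Status κ k s = (ints s flagA 0 ≡ 0 × Placed κ k (ints s outA) (reals s slackA) (leaf H s)) ⊎
    (ints s flagA 0 ≡ 1 × Stuck κ)

  Attempted : Carrier → State → ℕ → State → Set (c ⊔ ℓ₁ ⊔ ℓ₂)
  Attempted κ s k s′ = Frame AIs ARs s s′ × TreeReady s′ × Status κ k s′

  -- By the equivalence of leaves and fits, the first leaf reaching the length is the first drone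
  -- that fits. A root below the length excludes all drones, because it bounds every leaf.
  run-place : ∀ {κ s k s₁} → Ready s → Frame AIs ARs s s₁ → TreeReady s₁ → k ℕ.< n → ints s₁ indexA 0 ≡ k →
    ints s₁ flagA 0 ≡ 0 → Placed κ k (ints s₁ outA) (reals s₁ slackA) (leaf H s₁) →
    Run place s₁ (placeCost H) (λ s′ → ints s′ indexA 0 ≡ k × Attempted κ s (suc k) (next s′))
  run-place {κ} {s} {k} {s₁} rdy fr₁ tr₁ k<n ≡.refl flag≡ P = run-writeᴿ-⨾ (run-branch
    (λ le → run-findFirst H (width≡ (Ready.size rdy₁)) (tree tr₁) (does-true (_ ≤? _) le)
      >> λ {s₃} found → let
          module Found = FoundFirst found
          fr₃ = frame-trans fr₂ (frame-⊆ {is′ = AIs} {rs′ = ARs} ≡.refl ≡.refl Found.framed)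
          rdy₃ = ready-frame ≡.refl ≡.refl fr₃ rdy
          q = ints s₃ posA 0
          i≡ = at0 (ints-≡ Found.framed indexA ≡.refl) 0
          key≡ = ≡.trans (at0 (reals-≡ Found.framed keyA ≡.refl) 0) x≡
          tree≡ = reals-≡ Found.framed treeA ≡.refl
          slack≡ = reals-≡ Found.framed slackA ≡.refl
          out≡ = ints-≡ Found.framed outA ≡.refl
          q-fits = ≡.subst (_≤ leaf H s₁ q) x≡ Found.fits
          q<m = found< tr₁ (ℓ>0 k k<n) Found.pos< q-fits
          rank≡ = rank-first κ k q<m (Placed.leaf⇒fit P q q<m q-fits) λ p p<q fit →
            Found.least p p<q (≡.subst (_≤ leaf H s₁ p) (≡.sym x≡) (Placed.fit⇒leaf P p (ℕ.<-trans p<q q<m) fit))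
          parcel = ints s₃ porderA (ints s₃ indexA 0)
          parcel≡ : parcel ≡ π k
          parcel≡ = ≡.trans (at0 (Ready.porder rdy₃) _) (≡.cong π i≡)
          drone = ints s₃ orderA (ints s₃ sizeA 0 ℕ.∸ 1 ℕ.∸ q)
          drone≡ : drone ≡ δ q
          drone≡ = ≡.trans (at0 (Ready.order rdy₃) _)
            (≡.cong (λ x → σ (x ℕ.∸ 1 ℕ.∸ q)) (Sized.size≡ (Ready.size rdy₃)))
          slack′ = reals s₃ slackA q - reals s₃ keyA 0
          fr₅ : Frame AIs ARs s (setᴿ (setᴺ s₃ outA parcel drone) slackA q slack′)
          fr₅ = frame-setᴿ slackA q slack′ ≡.refl (frame-setᴺ outA parcel drone ≡.refl fr₃)
        in run-writeᴺ-⨾ (run-writeᴿ-⨾ (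
          run-setKey posA (ready-frame ≡.refl ≡.refl fr₅ rdy)
          >> λ {s₆} (fr₆ , min) → let
              fr₆′ = frame-trans fr₅ (frame-⊆ {is′ = AIs} {rs′ = ARs} ≡.refl ≡.refl fr₆)
              q≡ = at0 (ints-≡ fr₆ posA ≡.refl) 0
              tree₆≡ = ≡.trans (reals-≡ fr₆ treeA ≡.refl) tree≡
            in run-map (λ s₇ updated → let
                open Updated updated renaming (tree to tree₇)
                slack₇≡ : reals s₇ slackA ≡ reals s₃ slackA [ q ↦ slack′ ]
                slack₇≡ = ≡.trans (reals-≡ framed slackA ≡.refl) (reals-≡ fr₆ slackA ≡.refl)
                out₇≡ : ints s₇ outA ≡ ints s₃ outA [ parcel ↦ drone ]
                out₇≡ = ≡.trans (ints-≡ framed outA ≡.refl) (ints-≡ fr₆ outA ≡.refl)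
                lf-old : ∀ p → p ≢ q → leaf H s₇ p ≡ leaf H s₁ p
                lf-old p p≢q = ≡.trans (leaf-q p p≢q) (at0 tree₆≡ _)
                slack-new : reals s₇ slackA q ≡ slack′
                slack-new = ≡.trans (at0 slack₇≡ q) (↦-at (reals s₃ slackA) q slack′)
              in ≡.trans (at0 (ints-≡ framed indexA ≡.refl) 0) (≡.trans (at0 (ints-≡ fr₆ indexA ≡.refl) 0) i≡) ,
                frame-setᴺ indexA 0 _ ≡.refl
                  (frame-trans fr₆′ (frame-⊆ {is′ = AIs} {rs′ = ARs} ≡.refl ≡.refl framed)) ,
                tree-ready tree₇ (λ x m≤x x< →
                  ≡.trans (lf-old x (λ eq → ℕ.<⇒≱ q<m (≡.subst (m ℕ.≤_) eq m≤x))) (beyond tr₁ x m≤x x<)) ,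
                inj₁
                  ( ≡.trans (at0 (ints-≡ framed flagA ≡.refl) 0) (≡.trans (at0 (ints-≡ fr₆ flagA ≡.refl) 0)
                      (≡.trans (at0 (ints-≡ Found.framed flagA ≡.refl) 0) flag≡))
                  , place-next (ints s₇ outA) (reals s₇ slackA) (leaf H s₇) {q} {ℓ k} k<n P q<m rank≡ ≡.refl
                      (λ t t≢ → ≡.trans (at0 out₇≡ t)
                        (≡.trans (↦-off (ints s₃ outA) drone (λ eq → t≢ (≡.trans (≡.sym eq) parcel≡))) (at0 out≡ t)))
                      (≡.trans (at0 out₇≡ (π k)) (≡.trans
                        (≡.cong (λ j → (ints s₃ outA [ j ↦ drone ]) (π k)) parcel≡)
                        (≡.trans (↦-at (ints s₃ outA) (π k) drone) drone≡)))
                      (λ p p≢q → ≡.trans (at0 slack₇≡ p)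
                        (≡.trans (↦-off (reals s₃ slackA) slack′ (λ eq → p≢q (≡.sym eq))) (at0 slack≡ p)))
                      (≡.trans slack-new (≡.cong₂ _-_ (at0 slack≡ q) key≡))
                      lf-old
                      (≡.subst₂ (λ x y → IsMin x y (d q)) (≡.sym leaf-p)
                        (≡.sym (≡.trans slack-new (≡.sym (↦-at (reals s₃ slackA) q slack′)))) min)))
              (run-update H q (width≡ (Ready.size (ready-frame ≡.refl ≡.refl fr₆′ rdy))) q≡ Found.pos<
                (≡.subst (Tree H) (≡.sym tree₆≡) (tree tr₁))))))
    (λ gt → run-writeᴺ (≡.refl ,
      frame-setᴺ indexA 0 _ ≡.refl (frame-setᴺ flagA 0 1 ≡.refl fr₂) ,
      tree-ready (tree tr₁) (beyond tr₁) ,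
      inj₂ (≡.refl , k , k<n , Placed.placed P , rank-none {κ} λ p p<m fit → does-false (_ ≤? _) gt
        (≡.subst (_≤ reals s₁ treeA 1) (≡.sym x≡) (≤-trans (Placed.fit⇒leaf P p p<m fit)
          (leaf≤root H (tree tr₁) p (ℕ.<-≤-trans p<m (Sized.fits (Ready.size rdy₁))))))))))
    where
    rdy₁ = ready-frame ≡.refl ≡.refl fr₁ rdy
    x : Carrier
    x = reals s₁ 0 (ints s₁ porderA k)
    x≡ : x ≡ ℓ k
    x≡ = ≡.trans (at0 (Ready.lengths≡ rdy₁) _) (≡.cong lengthℕ (at0 (Ready.porder rdy₁) k))
    fr₂ : Frame AIs ARs s (setᴿ s₁ keyA 0 x)
    fr₂ = frame-setᴿ keyA 0 x ≡.refl fr₁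

  run-attempt : ∀ {s} → Ready s → TreeReady s →
    Run attempt s (attemptCost m n H) (Attempted (reals s κA 0) s n)
  run-attempt {s} rdy tr =
    run-forEach {e = % 0} m Filled s
      (λ k s′ (fr , _) → Ready.m≡ (ready-frame ≡.refl ≡.refl fr rdy)) fill
      (frame-setᴺ indexA 0 0 ≡.refl frame-refl , λ _ ())
    >> λ {s₁} (fr₁ , slack≡) → let
        rdy₁ = ready-frame ≡.refl ≡.refl fr₁ rdy
        tr₁ = tree-ready-frame ≡.refl fr₁ tr
      in run-setLeaves (λ p x → IsMin x (κ * v p) (d p)) (Ready.size rdy₁) (tree tr₁)
        (λ { i s₂ i<m fr ≡.refl → run-map
          (λ s₃ (fr′ , min) → fr′ , ≡.subst (λ a → IsMin (reals s₃ keyA 0) a (d i))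
            (≡.trans (at0 (reals-≡ fr slackA ≡.refl) i) (slack≡ i i<m)) min)
          (run-setKey indexA (ready-frame ≡.refl ≡.refl fr rdy₁)) })
    >> λ {s₂} leaves → let
        module L = LeavesSet leaves
        fr₂ : Frame AIs ARs s s₂
        fr₂ = frame-trans (frame-⊆ ≡.refl ≡.refl fr₁) (frame-⊆ ≡.refl ≡.refl L.framed)
        slack₂≡ = λ p p<m → ≡.trans (at0 (reals-≡ L.framed slackA ≡.refl) p) (slack≡ p p<m)
      in run-writeᴺ-⨾ (run-forEach {e = % 1} n (Attempted κ s) (setᴺ s₂ flagA 0 0)
        (λ k s′ (fr , _) → Ready.n≡ (ready-frame ≡.refl ≡.refl fr rdy))
        body
        (frame-setᴺ indexA 0 0 ≡.refl (frame-setᴺ flagA 0 0 ≡.refl fr₂) ,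
         tree-ready L.tree (λ x m≤x x< → ≡.trans (L.unset x m≤x) (beyond tr₁ x m≤x x<)) ,
         inj₁ (≡.refl , record
           { placed = λ _ () ; output = λ _ ()
           ; slack≈ = λ p p<m → trans (+-identityʳ _) (reflexive (slack₂≡ p p<m))
           ; leaf-ok = λ p p<m → ≡.subst (λ a → IsMin (leaf H s₂ p) a (d p)) (≡.sym (slack₂≡ p p<m)) (L.set p p<m) })))
    where
    κ : Carrier
    κ = reals s κA 0
    Filled : ℕ → State → Set c
    Filled k s′ = Frame (indexA ∷ []) (slackA ∷ []) s s′ × (∀ p → p ℕ.< k → reals s′ slackA p ≡ κ * v p)
    fill : ∀ k s₁ → k ℕ.< m → ints s₁ indexA 0 ≡ k → Filled k s₁ →
      Run _ s₁ 15 (λ s′ → ints s′ indexA 0 ≡ k × Filled (suc k) (next s′))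
    fill k s₁ k<m ≡.refl (fr , filled) = run-writeᴿ (≡.refl ,
      frame-setᴺ indexA 0 _ ≡.refl (frame-setᴿ slackA k _ ≡.refl fr) ,
      λ p p<1+k → [ (λ p<k → ≡.trans (↦-off (reals s₁ slackA) _ (ℕ.>⇒≢ p<k)) (filled p p<k)) ,
        (λ { ≡.refl → ≡.trans (↦-at (reals s₁ slackA) k _) (≡.cong₂ _*_ (at0 (reals-≡ fr κA ≡.refl) 0) speed≡) }) ]′
        (ℕ.m<1+n⇒m<n∨m≡n p<1+k))
      where
      rdy₁ = ready-frame ≡.refl ≡.refl fr rdy
      speed≡ : reals s₁ 1 (⟦ droneAt (% indexA) ⟧ᴺ s₁) ≡ v k
      speed≡ = ≡.trans (at0 (Ready.speeds≡ rdy₁) _) (≡.cong speedℕ (≡.trans (at0 (Ready.order rdy₁) _)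
        (≡.cong (λ x → σ (x ℕ.∸ 1 ℕ.∸ k)) (Sized.size≡ (Ready.size rdy₁)))))
    body : ∀ k s₁ → k ℕ.< n → ints s₁ indexA 0 ≡ k → Attempted κ s k s₁ →
      Run (branch (% flagA ≤ᴺ litᴺ 0) place skip) s₁ (5 ℕ.+ ((placeCost H) ℕ.+ 1))
        (λ s′ → ints s′ indexA 0 ≡ k × Attempted κ s (suc k) (next s′))
    body k s₁ k<n i≡k (fr , tr₁ , inj₁ (flag≡ , P)) = run-branch
      (λ _ → run-place rdy fr tr₁ k<n i≡k flag≡ P)
      (λ flag≰0 → contradiction (ℕ.≤-reflexive flag≡) (does-false (_ ℕ.≤? 0) flag≰0))
    body k s₁ k<n i≡k (fr , tr₁ , inj₂ (flag≡ , stuck)) = run-branch {B = (placeCost H)} {1}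
      (λ flag≤0 → contradiction (≡.subst (ℕ._≤ 0) flag≡ (does-true (_ ℕ.≤? 0) flag≤0)) λ ())
      (λ _ → run-skip (i≡k , frame-setᴺ indexA 0 _ ≡.refl fr , tree-ready (tree tr₁) (beyond tr₁) ,
        inj₂ (flag≡ , stuck)))

  record SearchDone (s : State) : Set (c ⊔ ℓ₁ ⊔ ℓ₂) where
    field
      κ       : Carrier
      κ≥0     : 0# ≤ κ
      bounded : Bounded κ
      placed  : ∀ t → t ℕ.< n → rank κ t ℕ.< m
      output  : ∀ t → t ℕ.< n → ints s outA (π t) ≡ δ (rank κ t)

  -- While the flag is raised, the variant counts increases after which `κ` is sure to reach the
  -- solo time. The lower bound survives each failure because the failure itself proves it for the
  -- next value.
  run-search : ∀ {s} A → (attemptCost m n H) ℕ.≤ A → ScaledDown s → Run search s (searchCost m A) SearchDone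
  run-search {s} A attempt≤ (rdy , tr , k , k≤ , m≤2^k , κ≡) = run-writeᴺ-⨾ (run-mono
    (rounds≤ (A ℕ.+ 29)) (λ _ q → q) loop)
    where
    start-frame : Frame (flagA ∷ []) [] s (setᴺ s flagA 0 1)
    start-frame = frame-setᴺ flagA 0 1 ≡.refl frame-refl
    Success : Carrier → State → Set
    Success κ s′ = (∀ t → t ℕ.< n → rank κ t ℕ.< m) × (∀ t → t ℕ.< n → ints s′ outA (π t) ≡ δ (rank κ t))
    Inv : ℕ → State → Set (c ⊔ ℓ₂)
    Inv r s′ = Ready s′ × TreeReady s′ × 0# ≤ reals s′ κA 0 × Bounded (reals s′ κA 0) ×
      ((ints s′ flagA 0 ≡ 0 × Success (reals s′ κA 0) s′) ⊎
       (ints s′ flagA 0 ≡ 1 × ∃[ r′ ] r ≡ suc r′ × soloTime ≤ grow^ r′ (reals s′ κA 0)))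
    step : ∀ r s′ → Inv r s′ → (⟦ litᴺ 1 ≤ᴺ % flagA ⟧ᴮ s′ ≡ false × SearchDone s′) ⊎
      (⟦ litᴺ 1 ≤ᴺ % flagA ⟧ᴮ s′ ≡ true × ∃[ r′ ] r ≡ suc r′ × Run (attempt ⨾ growIfStuck) s′ (A ℕ.+ 29) (Inv r′))
    step r s′ (rdy , tr , κ≥0 , bounded , inj₁ (flag≡ , placed , output)) = inj₁
      ( dec-false (1 ℕ.≤? ints s′ flagA 0) (λ 1≤ → contradiction (≡.subst (1 ℕ.≤_) flag≡ 1≤) λ ())
      , record { κ≥0 = κ≥0 ; bounded = bounded ; placed = placed ; output = output })
    step r s₁ (rdy , tr , κ≥0 , bounded , inj₂ (flag≡ , r′ , ≡.refl , enough)) = inj₂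
      ( dec-true (1 ℕ.≤? ints s₁ flagA 0) (ℕ.≤-reflexive (≡.sym flag≡))
      , r′ , ≡.refl , (run-mono attempt≤ (λ _ q → q) (run-attempt rdy tr) >> λ {s₂} (fr , tr₂ , status) → after s₂ fr tr₂ status))
      where
      κ : Carrier
      κ = reals s₁ κA 0
      after : ∀ s₂ → Frame AIs ARs s₁ s₂ → TreeReady s₂ → Status κ n s₂ → Run growIfStuck s₂ 29 (Inv r′)
      after s₂ fr tr₂ (inj₁ (flag≡ , P)) = run-branch {B = 23} {1}
        (λ 1≤ → contradiction (≡.subst (1 ℕ.≤_) flag≡ (does-true (1 ℕ.≤? _) 1≤)) λ ())
        (λ _ → run-skip (ready-frame ≡.refl ≡.refl fr rdy , tr₂ ,
          ≡.subst (0# ≤_) (≡.sym κ₂≡) κ≥0 , ≡.subst Bounded (≡.sym κ₂≡) bounded ,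
          inj₁ (flag≡ , ≡.subst (λ x → Success x s₂) (≡.sym κ₂≡) (Placed.placed P , Placed.output P))))
        where
        κ₂≡ : reals s₂ κA 0 ≡ κ
        κ₂≡ = at0 (reals-≡ fr κA ≡.refl) 0
      after s₂ fr tr₂ (inj₂ (flag≡ , t , t<n , placed , stuck)) = run-branch {B = 23} {1}
        (λ _ → run-writeᴿ (grown _ (≡.cong grow (at0 (reals-≡ fr κA ≡.refl) 0))))
        (λ 1≰ → contradiction (ℕ.≤-reflexive (≡.sym flag≡)) (does-false (1 ℕ.≤? _) 1≰))
        where
        remaining : ∀ r′ → soloTime ≤ grow^ r′ κ → ∃[ r″ ] r′ ≡ suc r″ × soloTime ≤ grow^ r″ (grow κ)
        -- With no increase left, `soloTime ≤ κ`, and there first fit cannot be stuck.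
        remaining zero     enough = contradiction stuck (not-stuck enough t t<n)
        remaining (suc r″) enough = r″ , ≡.refl , enough
        grown : ∀ κ′ → κ′ ≡ grow κ → Inv r′ (setᴿ s₂ κA 0 κ′)
        grown κ′ κ′≡ =
          ready-frame {s = s₁} ≡.refl ≡.refl (frame-setᴿ κA 0 κ′ ≡.refl (frame-⊆ {is′ = Is} {rs′ = Rs} ≡.refl ≡.refl fr)) rdy ,
          tree-ready (tree tr₂) (beyond tr₂) ,
          ≡.subst (0# ≤_) (≡.sym κ′≡) (≤-trans κ≥0 (κ≤grow κ≥0)) ,
          ≡.subst Bounded (≡.sym κ′≡) (grow-bounded {κ} {t} κ≥0 t<n placed stuck) ,
          inj₂ (flag≡ , ≡.subst (λ x → ∃[ r″ ] r′ ≡ suc r″ × soloTime ≤ grow^ r″ x) (≡.sym κ′≡)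
            (remaining r′ enough))
    rounds≤ : ∀ A → suc (suc (k ℕ.* 16)) ℕ.* (5 ℕ.+ A) ℕ.≤ suc (suc ((halvings≤ m) ℕ.* 16)) ℕ.* (5 ℕ.+ A)
    rounds≤ A = ℕ.*-monoˡ-≤ (5 ℕ.+ A) (ℕ.s≤s (ℕ.s≤s (ℕ.*-monoˡ-≤ 16 k≤)))
    loop : Run _ (setᴺ s flagA 0 1) (suc (suc (k ℕ.* 16)) ℕ.* (5 ℕ.+ (A ℕ.+ 29))) SearchDone
    loop = run-while {B = A ℕ.+ 29} Inv step (suc (k ℕ.* 16)) (setᴺ s flagA 0 1)
      (ready-frame ≡.refl ≡.refl start-frame rdy , tree-ready (tree tr) (beyond tr) ,
       ≡.subst (0# ≤_) (≡.sym κ≡) (half^-≥0 k soloTime≥0) ,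
       ≡.subst Bounded (≡.sym κ≡) (start-bounded k m≤2^k) ,
       inj₂ (≡.refl , k ℕ.* 16 , ≡.refl ,
         ≡.subst (λ x → soloTime ≤ grow^ (k ℕ.* 16) x) (≡.sym κ≡) (x≤grow^[16*half^] k soloTime≥0)))

-- Asymptotic bounds for the costs

-- A record, so that the constant c is found by unification.
record _≼_·_ (t c X : ℕ) : Set where
  constructor bound
  field
    unbound : t ℕ.≤ c ℕ.* X
open _≼_·_

infixl 6 _⊕_
_⊕_ : ∀ {t u a b X} → t ≼ a · X → u ≼ b · X → (t ℕ.+ u) ≼ (a ℕ.+ b) · X
_⊕_ {a = a} {b} {X} (bound p) (bound q) =
  bound (ℕ.≤-trans (ℕ.+-mono-≤ p q) (ℕ.≤-reflexive (≡.sym (ℕ.*-distribʳ-+ X a b))))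

infixl 7 _⊗_
_⊗_ : ∀ {t u a b X Y} → t ≼ a · X → u ≼ b · Y → (t ℕ.* u) ≼ (a ℕ.* b) · (X ℕ.* Y)
_⊗_ {a = a} {b} {X} {Y} (bound p) (bound q) = bound (ℕ.≤-trans (ℕ.*-mono-≤ p q) (ℕ.≤-reflexive
  (solve 4 (λ a b X Y → a :* X :* (b :* Y) := a :* b :* (X :* Y)) ≡.refl a b X Y)))
  where open +-*-Solver

relax : ∀ {t c X b Y} → t ≼ c · X → X ≼ b · Y → t ≼ (c ℕ.* b) · Y
relax {c = c} {b = b} {Y} (bound p) (bound q) =
  bound (ℕ.≤-trans p (ℕ.≤-trans (ℕ.*-monoʳ-≤ c q) (ℕ.≤-reflexive (≡.sym (ℕ.*-assoc c b Y)))))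

const : ∀ {X} k → 1 ℕ.≤ X → k ≼ k · X
const k 1≤X = bound (ℕ.≤-trans (ℕ.≤-reflexive (≡.sym (ℕ.*-identityʳ k))) (ℕ.*-monoʳ-≤ k 1≤X))

self : ∀ {X} → X ≼ 1 · X
self {X} = bound (ℕ.≤-reflexive (≡.sym (ℕ.*-identityˡ X)))

times : ∀ X k → (X ℕ.* k) ≼ k · X
times X k = bound (ℕ.≤-reflexive (ℕ.*-comm X k))

-- The bound p is elaborated before its left side is compared with t.
cast : ∀ {t u c X} → u ≼ c · X → t ≡ u → t ≼ c · X
cast p ≡.refl = p

updateCost-≼ : ∀ H → updateCost H ≼ _ · suc H
updateCost-≼ H = let p = kH 12 ⊕ times (suc H) 46 in cast p ≡.refl
  where
  kH : ∀ k → k ≼ k · suc H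
  kH k = const k (ℕ.s≤s ℕ.z≤n)

findCost-≼ : ∀ H → findCost H ≼ _ · suc H
findCost-≼ H = let p = kH 3 ⊕ (times (suc H) 28 ⊕ kH 7) in cast p ≡.refl
  where
  kH : ∀ k → k ≼ k · suc H
  kH k = const k (ℕ.s≤s ℕ.z≤n)

module _ (N H : ℕ) where
  private
    kH : ∀ k → k ≼ k · suc H
    kH k = const k (ℕ.s≤s ℕ.z≤n)
    kX : ∀ k → k ≼ k · (suc N ℕ.* suc H)
    kX k = const k (ℕ.s≤s ℕ.z≤n)

  setLeavesCost-≼ : ∀ K → setLeavesCost N H K ≼ _ · (suc N ℕ.* suc H)
  setLeavesCost-≼ K =
    let p = kX 3 ⊕ self {suc N} ⊗ (kH 7 ⊕ (kH K ⊕ (kH 4 ⊕ updateCost-≼ H) ⊕ kH 6)) in cast p ≡.refl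

  selectionSortCost-≼ : selectionSortCost N H ≼ _ · (suc N ℕ.* suc H)
  selectionSortCost-≼ =
    let p = kX 3 ⊕ self {suc N} ⊗
              (kH 7 ⊕ (kH 4 ⊕ (findCost-≼ H ⊕ (kH 5 ⊕ (kH 3 ⊕ updateCost-≼ H))) ⊕ kH 6))
    in cast p ≡.refl

  suc-N≼ : suc N ≼ 1 · (suc N ℕ.* suc H)
  suc-N≼ = bound (ℕ.≤-trans (ℕ.m≤m*n (suc N) (suc H)) (ℕ.≤-reflexive (≡.sym (ℕ.*-identityˡ _))))

  suc-H≼ : suc H ≼ 1 · (suc N ℕ.* suc H)
  suc-H≼ = bound (ℕ.≤-trans (ℕ.m≤n*m (suc H) (suc N)) (ℕ.≤-reflexive (≡.sym (ℕ.*-identityˡ _))))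

clearCost-≼ : ∀ e N → clearCost e N ≼ _ · (suc N ℕ.* suc (halvings≤ N))
clearCost-≼ e N =
  let p = kX 2 ⊕ kX e ⊕ (kX 3 ⊕ (relax (times (suc H) 14) (suc-H≼ N H) ⊕
            (kX 3 ⊕ relax (relax (times _ 20) 4N) (suc-N≼ N H))))
  in cast p ≡.refl
  where
  open +-*-Solver using (solve; _:+_; _:*_; _:=_; con)
  H : ℕ
  H = halvings≤ N
  kX : ∀ k → k ≼ k · (suc N ℕ.* suc H)
  kX k = const k (ℕ.s≤s ℕ.z≤n)
  4N : suc (N ℕ.+ N ℕ.+ 1 ℕ.+ (N ℕ.+ N ℕ.+ 1)) ≼ 4 · suc N
  4N = bound (ℕ.≤-trans (ℕ.n≤1+n _) (ℕ.≤-reflexive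
    (solve 1 (λ N → con 2 :+ (N :+ N :+ con 1 :+ (N :+ N :+ con 1)) := con 4 :* (con 1 :+ N)) ≡.refl N)))

sortByCost-≼ : ∀ e N K → sortByCost e N K ≼ _ · (suc N ℕ.* suc (halvings≤ N))
sortByCost-≼ e N K =
  let p = clearCost-≼ e N ⊕ (setLeavesCost-≼ N (halvings≤ N) K ⊕ selectionSortCost-≼ N (halvings≤ N))
  in cast p ≡.refl

totalCost : ℕ → ℕ → ℕ
totalCost m n = sortParcelsCost n ℕ.+ (sortDronesCost m ℕ.+ (estimateCost m n (halvings≤ m) ℕ.+
  (scaleDownCost m ℕ.+ searchCost m (attemptCost m n (halvings≤ m)))))

1≤⌊log₂⌋ : ∀ {k} → 2 ℕ.≤ k → 1 ℕ.≤ ⌊log₂ k ⌋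
1≤⌊log₂⌋ {k} 2≤k = ⌊log₂⌋-mono-≤ {2} {k} 2≤k

module _ (m n : ℕ) (3≤n+m : 3 ℕ.≤ n ℕ.+ m) where
  private
    L P S E X G : ℕ
    L = ⌊log₂ m ⌋
    P = ⌊log₂ n ⌋
    S = n ℕ.+ m
    E = L ℕ.^ 2 ℕ.+ P
    X = S ℕ.* E
    G = suc (suc L)

    L≤L² : ∀ L → L ℕ.≤ L ℕ.^ 2
    L≤L² zero    = ℕ.z≤n
    L≤L² (suc L) = ℕ.m≤m*n (suc L) (suc L ℕ.* 1)

    1≤S : 1 ℕ.≤ S
    1≤S = ℕ.≤-trans (ℕ.s≤s ℕ.z≤n) 3≤n+m

    -- Since `3 ≤ n + m`, one of `m` and `n` is at least 2 and has a positive logarithm. This is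
    -- what absorbs additive constants; for m = n = 1 both logarithms vanish.
    1≤E : 1 ℕ.≤ E
    1≤E with 2 ℕ.≤? m
    ... | yes 2≤m = ℕ.≤-trans (1≤⌊log₂⌋ 2≤m) (ℕ.≤-trans (L≤L² L) (ℕ.m≤m+n _ P))
    ... | no 2≰m  = ℕ.≤-trans (1≤⌊log₂⌋ 2≤n) (ℕ.m≤n+m P _)
      where
      2≤n : 2 ℕ.≤ n
      2≤n = ℕ.+-cancelʳ-≤ 1 2 n (ℕ.≤-trans 3≤n+m (ℕ.+-monoʳ-≤ n (ℕ.s≤s⁻¹ (ℕ.≰⇒> 2≰m))))

    L≤E : L ℕ.≤ E
    L≤E = ℕ.≤-trans (L≤L² L) (ℕ.m≤m+n _ P)

    kS : ∀ k → k ≼ k · S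
    kS k = const k 1≤S

    kE : ∀ k → k ≼ k · E
    kE k = const k 1≤E

    kX : ∀ k → k ≼ k · X
    kX k = const k (ℕ.*-mono-≤ 1≤S 1≤E)

    ≤⇒≼ : ∀ {t X} → t ℕ.≤ X → t ≼ 1 · X
    ≤⇒≼ {X = X} t≤X = bound (ℕ.≤-trans t≤X (ℕ.≤-reflexive (≡.sym (ℕ.*-identityˡ X))))

    n≼S : suc n ≼ 2 · S
    n≼S = kS 1 ⊕ ≤⇒≼ (ℕ.m≤m+n n m)

    m≼S : suc m ≼ 2 · S
    m≼S = kS 1 ⊕ ≤⇒≼ (ℕ.m≤n+m m n)

    P≼E : suc (suc P) ≼ 3 · E
    P≼E = kE 2 ⊕ ≤⇒≼ (ℕ.m≤n+m P _)

    G≼E : G ≼ 3 · E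
    G≼E = kE 2 ⊕ ≤⇒≼ L≤E

    [2+L]² : ∀ L → suc (suc L) ℕ.* suc (suc L) ℕ.≤ 4 ℕ.+ 8 ℕ.* L ℕ.^ 2
    [2+L]² zero    = ℕ.≤-refl
    -- The summand 3 + 10L + 7L² is exactly the difference of the two sides at `suc L`.
    [2+L]² (suc L) = ℕ.≤-trans (ℕ.m≤m+n _ (3 ℕ.+ 10 ℕ.* L ℕ.+ 7 ℕ.* (L ℕ.* L))) (ℕ.≤-reflexive
      (solve 1 (λ L → (con 3 :+ L) :* (con 3 :+ L) :+ (con 3 :+ con 10 :* L :+ con 7 :* (L :* L))
        := con 4 :+ con 8 :* ((con 1 :+ L) :* ((con 1 :+ L) :* con 1))) ≡.refl L))
      where open +-*-Solver

    G²≼E : (G ℕ.* G) ≼ 12 · E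
    G²≼E = bound (ℕ.≤-trans ([2+L]² L) (unbound (kE 4 ⊕ relax (times8 (L ℕ.^ 2)) (≤⇒≼ (ℕ.m≤m+n _ P)))))
      where
      times8 : ∀ X → (8 ℕ.* X) ≼ 8 · X
      times8 X = bound ℕ.≤-refl

    mG≼X : (suc m ℕ.* G) ≼ 6 · X
    mG≼X = m≼S ⊗ G≼E

    nP≼X : (suc n ℕ.* suc (suc P)) ≼ 6 · X
    nP≼X = n≼S ⊗ P≼E

    kG : ∀ k → k ≼ k · G
    kG k = const k (ℕ.s≤s ℕ.z≤n)

    kSG : ∀ k → k ≼ k · (S ℕ.* G)
    kSG k = const k (ℕ.*-mono-≤ 1≤S (ℕ.s≤s ℕ.z≤n))

    -- This is the only phase with a tree over the parcels, hence the only source of log n.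
    parcels : sortParcelsCost n ≼ _ · X
    parcels =
      let p = relax (sortByCost-≼ 2 n 5) nP≼X ⊕ (kX 3 ⊕
                relax (relax (times (suc n) 19) (suc-N≼ n (suc P))) nP≼X)
      in cast p ≡.refl

    drones : sortDronesCost m ≼ _ · X
    drones = let p = relax (sortByCost-≼ 2 m 5) mG≼X in cast p ≡.refl

    estimates : estimateCost m n (suc L) ≼ _ · X
    estimates =
      let p = relax (setLeavesCost-≼ m (suc L) 6) mG≼X ⊕ (kX 3 ⊕ (kX 3 ⊕
                relax (self {suc n} ⊗ (kG 7 ⊕ (kG 6 ⊕ (findCost-≼ (suc L) ⊕ kG 12) ⊕ kG 6))) (n≼S ⊗ G≼E)))
      in cast p ≡.refl

    scale : scaleDownCost m ≼ _ · X
    scale = let p = kX 4 ⊕ relax (relax (times G 18) (suc-H≼ m (suc L))) mG≼X in cast p ≡.refl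

    place-≼ : placeCost (suc L) ≼ _ · G
    place-≼ =
      let p = kG 6 ⊕ (kG 6 ⊕ (findCost-≼ (suc L) ⊕
                (kG 12 ⊕ (kG 9 ⊕ (kG 30 ⊕ updateCost-≼ (suc L)))) ⊕ kG 3))
      in cast p ≡.refl

    attempt-≼ : attemptCost m n (suc L) ≼ _ · (S ℕ.* G)
    attempt-≼ =
      let p = kSG 3 ⊕ relax (relax (times (suc m) 28) (suc-N≼ m (suc L))) (m≼S ⊗ self {G}) ⊕
                (relax (setLeavesCost-≼ m (suc L) 30) (m≼S ⊗ self {G}) ⊕
                (kSG 3 ⊕ (kSG 3 ⊕ n≼S ⊗ (kG 7 ⊕ (kG 5 ⊕ (place-≼ ⊕ kG 1) ⊕ kG 6)))))
      in cast p ≡.refl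

    rounds : suc (suc (suc L ℕ.* 16)) ≼ _ · G
    rounds = let p = kG 2 ⊕ relax (times (suc L) 16) (≤⇒≼ {X = G} (ℕ.n≤1+n _)) in cast p ≡.refl

    -- O(G) attempts cost O(S G) each: one factor `G` is the number of attempts, the other the
    -- height of the tree over the drones. Together they give log² m.
    GSG≼X : (G ℕ.* (S ℕ.* G)) ≼ _ · X
    GSG≼X = let p = self {S} ⊗ G²≼E in cast p (solve 2 (λ S G → G :* (S :* G) := S :* (G :* G)) ≡.refl S G)
      where open +-*-Solver

    search-≼ : searchCost m (attemptCost m n (suc L)) ≼ _ · X
    search-≼ =
      let p = kX 3 ⊕ relax (rounds ⊗ (kSG 5 ⊕ (attempt-≼ ⊕ kSG 29))) GSG≼X in cast p ≡.refl

  totalCost-≼ : totalCost m n ≼ _ · ((n ℕ.+ m) ℕ.* (⌊log₂ m ⌋ ℕ.^ 2 ℕ.+ ⌊log₂ n ⌋))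
  totalCost-≼ = let p = parcels ⊕ (drones ⊕ (estimates ⊕ (scale ⊕ search-≼))) in cast p ≡.refl

-- The constant is read off from `totalCost-≼`, where it depends on neither `m` nor `n`.
time-bound : ∃[ C ] ∀ m n → 3 ℕ.≤ n ℕ.+ m →
  totalCost m n ≼ C · ((n ℕ.+ m) ℕ.* (⌊log₂ m ⌋ ℕ.^ 2 ℕ.+ ⌊log₂ n ⌋))
time-bound = _ , totalCost-≼

-- The phases combined

module Correctness {c ℓ₁ ℓ₂} (F : OrderedField c ℓ₁ ℓ₂) where
  open OrderedField F hiding (zero; sum)
  open OrderedFieldProperties F
  open Numerals F
  open DWP F
  open Runs F
  open Sorting F

  -- The height of the tree is known only through an upper bound, so the budgets are raised to their
  -- values at that bound.
  estimateCost-mono : ∀ {H H′} m n → H ℕ.≤ H′ → estimateCost m n H ℕ.≤ estimateCost m n H′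
  estimateCost-mono m n le = ℕ.+-mono-≤ (setLeavesCost-mono m 6 le)
    (ℕ.+-monoʳ-≤ 3 (ℕ.+-monoʳ-≤ 3 (ℕ.*-monoʳ-≤ (suc n) (ℕ.+-monoʳ-≤ 7 (ℕ.+-monoˡ-≤ 6
      (ℕ.+-monoʳ-≤ 6 (ℕ.+-monoˡ-≤ 12 (findCost-mono le))))))))

  attemptCost-mono : ∀ {H H′} m n → H ℕ.≤ H′ → attemptCost m n H ℕ.≤ attemptCost m n H′
  attemptCost-mono m n le = ℕ.+-monoʳ-≤ (3 ℕ.+ suc m ℕ.* 28) (ℕ.+-mono-≤ (setLeavesCost-mono m 30 le)
    (ℕ.+-monoʳ-≤ 3 (ℕ.+-monoʳ-≤ 3 (ℕ.*-monoʳ-≤ (suc n) (ℕ.+-monoʳ-≤ 7 (ℕ.+-monoˡ-≤ 6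
      (ℕ.+-monoʳ-≤ 5 (ℕ.+-monoˡ-≤ 1 (ℕ.+-monoʳ-≤ 6 (ℕ.+-monoʳ-≤ 6 (ℕ.+-monoˡ-≤ 3
        (ℕ.+-mono-≤ (findCost-mono le) (ℕ.+-monoʳ-≤ 12 (ℕ.+-monoʳ-≤ 9 (ℕ.+-monoʳ-≤ 30 (updateCost-mono le))))))))))))))))

  module _ {m n} (I : Instance m n) where
    open Phases F I

    Solved : State → Set _
    Solved s = ∃[ f ] Outputs F s f × Valid I f × ∃[ κ ] deliveryTime I f ≤ κ ×
      (∀ g → Valid I g → fromℕ 5 * κ ≤ fromℕ 8 * deliveryTime I g)

    run-algorithm : Run algorithm (input F I) (totalCost m n) Solved
    run-algorithm =
      run-sortParcels (inputs ≡.refl ≡.refl ≡.refl ≡.refl ≡.refl) >> λ {s₁} parcels →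
      run-sortDrones (ParcelsSorted.given parcels) >> λ {s₂} (drones , given) → let
          module P = ParcelsSorted parcels
          module D = SortDone drones
          porder≡ = ints-≡ D.framed porderA ≡.refl
          open Scheduling F I (ints s₁ porderA) (ints s₂ orderA) P.order D.order P.decreasing D.decreasing D.height
          open Sorted F I (ints s₁ porderA) (ints s₂ orderA) P.order D.order P.decreasing D.decreasing
      in run-mono (ℕ.+-monoˡ-≤ _ (estimateCost-mono {D.height} {halvings≤ m} m n D.height≤)) (λ _ q → q)
        (run-estimate (ready given D.size porder≡ ≡.refl) (tree-ready D.tree D.beyond)
        >> λ (rdy , tr , κ≡) → run-scaleDown rdy tr κ≡
        >> λ scaled → run-map
          (λ s′ done → let module S = SearchDone done in
            schedule (ints s′ outA) , ∈-schedule (ints s′ outA) ,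
            schedule-valid S.κ S.κ≥0 S.placed (ints s′ outA) S.output ,
            S.κ , schedule-time S.κ S.κ≥0 S.placed (ints s′ outA) S.output , Bounded.bound S.bounded)
          (run-search (attemptCost m n (halvings≤ m)) (attemptCost-mono {D.height} {halvings≤ m} m n D.height≤) scaled))

    within-φ : ∀ {√5 κ T} → IsSquareRootOf √5 (fromℕ 5) → 0# ≤ T →
      fromℕ 5 * κ ≤ fromℕ 8 * T → κ ≤ (1# + √5) / fromℕ 2 * T
    within-φ {√5} {κ} {T} root T≥0 le = fromℕ*-cancel-≤ 4 (begin
      fromℕ 5 * κ  ≤⟨ le ⟩
      fromℕ 8 * T  ≤⟨ *-monoʳ-≤ T≥0 (8/5≤φ root) ⟩
      fromℕ 5 * ((1# + √5) / fromℕ 2) * T  ≈⟨ *-assoc _ _ T ⟩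
      fromℕ 5 * ((1# + √5) / fromℕ 2 * T)  ∎)

theorem2 : ∀ {c ℓ₁ ℓ₂} →
    ∃[ algorithm ] ∃[ C ]
    ∀ (F : OrderedField c ℓ₁ ℓ₂) →
    let open OrderedField F
        open DWP F
        open RealRAM F
    in
    ∀ (√5 : Carrier) → IsSquareRootOf √5 (fromℕ 5) →
    let φ = (1# + √5) / fromℕ 2 in
    ∀ {m n} (I : Instance m n) →
    ∃[ s ] ∃[ t ] ∃[ f ]
      ( ⟨ algorithm , input F I ⟩⇓⟨ s , t ⟩
      × Outputs F s f
      × Valid I f
      × (∀ f* → Optimal I f* → deliveryTime I f ≤ φ * deliveryTime I f*)
      × (3 ℕ.≤ n ℕ.+ m →
           t ℕ.≤ C ℕ.* ((n ℕ.+ m) ℕ.* (⌊log₂ m ⌋ ℕ.^ 2 ℕ.+ ⌊log₂ n ⌋))))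
theorem2 = algorithm , proj₁ time-bound , λ F √5 root {m} {n} I →
  let open Correctness F
      open OrderedFieldProperties F
      (s , t , run , t≤ , f , outputs , valid , κ , time≤ , κ≤) = run-algorithm I
  in s , t , f , run , outputs , valid ,
    (λ f* (valid* , _) → ≤-trans time≤ (within-φ I root (Schedules.foldr-max-≥0 F I (DWP.load F I f*)) (κ≤ f* valid*))) ,
    (λ 3≤n+m → ℕ.≤-trans t≤ (_≼_·_.unbound (proj₂ time-bound m n 3≤n+m)))
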